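{- Let $\ell\ne p$ be a prime and let $e_i$ be the multiplicity of $\ell^i$ as an elementary divisor of the Laplacian matrix $L$ of the skew-lines graph $\Gamma$ on the $2$-dimensional subspaces of $V=\mathbb F_q^n$ ($n\ge4$, $q=p^t$). Put $f=[n]-1$, $g=\left[\begin{smallmatrix}n\\2\end{smallmatrix}\right]_q-[n]$, $$r=\frac{q^2[n-3][n]}{q+1},\qquad s=\frac{q[n-1]\left([n-1]-(q+2)\right)}{q+1},\qquad \mu=\frac{q^3[n-3]\left([n-1]-(q+2)\right)}{q+1}.$$ In each case below, $e_i=0$ for all $i$ not listed. (A) Suppose $\ell\nmid q+1$. Then $\ell$ divides at most one of $r$ and $s$; if it divides neither, then $\ell\nmid|K(\Gamma)|$. (i) Suppose $\ell\mid r$, $\ell\nmid s$. (a) If $\ell\mid[n]$ and $\ell\nmid[n-3]$, with $a=v_\ell([n])$: $e_a=f-1$, $e_0=g+1$. (b) If $\ell\mid[n]$ and $\ell\mid[n-3]$, with $a=v_\ell([n])$, $b=v_\ell([n-3])$: $e_{a+b}=f-1$, $e_b=1$, $e_0=g$. (c) If $\ell\nmid[n]$ and $\ell\mid[n-3]$, with $a=v_\ell([n-3])$: $e_a=f$, $e_0=g$. (ii) Suppose $\ell\mid s$, $\ell\nmid r$. (a) If $\ell\nmid[n-1]$, with $a=v_\ell(s)$: $e_a=g$, $e_0=f$. (b) If $\ell\mid[n-1]$, let $a=v_\ell([n-1])$ and $b=v_\ell(\mu)$, so that $v_\ell(s)=a+b$. If $b=0$: $e_a=g-1$, $e_0=f+1$.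 If $b>0$: $e_{a+b}=g-1$, $e_b=1$, $e_0=f$. (B) Suppose $\ell\mid q+1$ and $n$ is even. Let $a=v_\ell(r)$, $b=v_\ell(s)$. Then $a>0$ if and only if $b>0$. If $a=b=0$, then $\ell\nmid|K(\Gamma)|$. If $a,b>0$: $e_{a+b}=f-1$, $e_b=g-f+1$, $e_0=f$. (C) Suppose $\ell\mid q+1$, $n$ is odd and $\ell$ divides $|K(\Gamma)|$. Let $a=v_\ell(r)$, $b=v_\ell(s)$; exactly one of $a,b$ is nonzero. (a) Suppose $\ell\nmid\frac{n-1}{2}$. If $a>0$, $b=0$: $e_a=f$, $e_0=g$. If $a=0$, $b>0$: $e_b=g$, $e_0=f$. (b) Suppose $\ell\mid\frac{n-1}{2}$. Then $b>0$, $a=0$, and $e_b=g-1$, $e_0=f+1$.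
   Context: Let $p$ be a prime, $q=p^t$ with $t\ge1$, $n\ge4$, and $V$ an $n$-dimensional vector space over $\mathbb F_q$. Notation: $[m]=\frac{q^m-1}{q-1}$, and $\left[\begin{smallmatrix}m\\k\end{smallmatrix}\right]_q$ is the number of $k$-dimensional subspaces of $\mathbb F_q^m$; $v_\ell$ is the $\ell$-adic valuation. The skew-lines graph $\Gamma$ has as vertices the $2$-dimensional subspaces of $V$, two being adjacent when their intersection is $\{0\}$. If $A$ is its adjacency matrix and $k=q^4\left[\begin{smallmatrix}n-2\\2\end{smallmatrix}\right]_q$ its valency, $L=kI-A$. The integers $r$ and $s$ above are the nonzero eigenvalues of $L$ (with multiplicities $f$ and $g$). The critical group $K(\Gamma)$ is the torsion subgroup of the cokernel of $L$ over $\mathbb Z$. The multiplicity of $\ell^i$ as an elementary divisor of an integer matrix is the number of nonzero diagonal entries of its Smith normal form whose $\ell$-adic valuation is exactly $i$ (zero diagonal entries are not counted). -}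

module Defs where

open import Level using (Level; _⊔_) renaming (suc to lsuc)
open import Algebra.Bundles using (CommutativeRing; AbelianGroup)
open import Algebra.Morphism.Structures using (IsGroupHomomorphism)
import Algebra.Construct.Pointwise as Pointwise
import Algebra.Properties.AbelianGroup as AbelianGroupProperties
import Algebra.Properties.CommutativeMonoid.Mult as Mult
import Algebra.Properties.CommutativeSemigroup as CommutativeSemigroupProperties
import Algebra.Properties.Semiring.Sum as Sum
open import Data.Bool.Base using (if_then_else_)
open import Data.Fin.Base using (Fin; zero; suc; toℕ)
import Data.Fin.Properties as Fin
open import Data.Integer.Base as ℤ using (ℤ; +_)
import Data.Integer.Properties as ℤ
open import Data.List.Base using (List)
open import Data.List.Relation.Unary.All using (All)
open import Data.Nat.Base as ℕ using (ℕ; zero; suc; _+_; _*_; _∸_; _^_; _≤_; NonZero)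
import Data.Nat.Properties as ℕ
open import Data.Nat.Divisibility using (_∣_; _∣?_)
open import Data.Product.Base using (Σ; ∃; _×_; _,_)
open import Data.Vec.Base using (count; allFin)
open import Data.Vec.Functional using (Vector; head; tail) renaming (_∷_ to _∷ᶠ_)
open import Function.Base using (_∘_)
open import Function.Bundles using (Inverse; _⇔_; mk⇔; Equivalence)
open import Relation.Binary.Bundles using (Setoid)
open import Relation.Binary.Core using (Rel)
open import Relation.Binary.Definitions using (_Respects_) renaming (Decidable to Decidable₂)
open import Relation.Binary.PropositionalEquality using (_≡_; _≢_; refl; sym; trans; cong; setoid)
open import Relation.Nullary.Decidable
  using (Dec; does; _×-dec_; ¬?; map′; decidable-stable)
open import Relation.Nullary.Negation using (¬_)
open import Relation.Unary using (Pred; Decidable)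

private
  variable
    c ℓ₁ c′ ℓ₁′ : Level

-- Exact wherever it is used below, so the floor and the value at
-- divisor 0 play no role.
infixl 7 _÷_
_÷_ : ℕ → ℕ → ℕ
m ÷ zero  = 0
m ÷ suc d = m ℕ./ suc d

[_]_ : ℕ → ℕ → ℕ
[ m ] q = (q ^ m ∸ 1) ÷ (q ∸ 1)

-- With q ≥ 2 and n ≥ 4 the truncated subtractions are true ones:
-- [n-1] - (q+2) = q²[n-3] - 1 ≥ 3.
rᴸ sᴸ μᴸ : (q n : ℕ) → ℕ
rᴸ q n = (q ^ 2 * [ n ∸ 3 ] q * [ n ] q) ÷ (q + 1)
sᴸ q n = (q * [ n ∸ 1 ] q * ([ n ∸ 1 ] q ∸ (q + 2))) ÷ (q + 1)
μᴸ q n = (q ^ 3 * [ n ∸ 3 ] q * ([ n ∸ 1 ] q ∸ (q + 2))) ÷ (q + 1)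

-- The ℓ-adic valuation of m, as the number of k ∈ {1, …, m} with ℓ^k ∣ m;
-- for ℓ ≥ 2 and m ≥ 1, ℓ^k ∣ m already forces k ≤ m.  Junk value v ℓ 0 = 0.
v : ℕ → ℕ → ℕ
v ℓ m = count (λ k → ℓ ^ suc (toℕ k) ∣? m) (allFin m)

HasCardinality : Setoid c ℓ₁ → ℕ → Set (c ⊔ ℓ₁)
HasCardinality A m = Inverse A (setoid (Fin m))

record FiniteField (c ℓ₁ : Level) (q : ℕ) : Set (lsuc (c ⊔ ℓ₁)) where
  field
    commutativeRing : CommutativeRing c ℓ₁
  open CommutativeRing commutativeRing public
    using (Carrier; _≈_; 0#; 1#; semiring; refl; sym; trans; reflexive; *-congʳ)
    renaming (_+_ to _⊕_; _*_ to _⊙_; setoid to 𝔽-setoid)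
  field
    0≉1         : ¬ (0# ≈ 1#)
    inverse     : ∀ x → ¬ (x ≈ 0#) → ∃ λ y → x ⊙ y ≈ 1#
    cardinality : HasCardinality 𝔽-setoid q

module _ {q : ℕ} (F : FiniteField c ℓ₁ q) where

  private
    module F = FiniteField F
  open Sum F.semiring using (sum; sum-cong-≋)

  infix 4 _≋_
  _≋_ : ∀ {n} → Rel (Vector F.Carrier n) ℓ₁
  x ≋ y = ∀ i → x i F.≈ y i

  linearCombination : ∀ {k n} → Vector F.Carrier k → Vector (Vector F.Carrier n) k →
                      Vector F.Carrier n
  linearCombination α b j = sum (λ i → α i F.⊙ b i j)

  record Subspace (n : ℕ) : Set (lsuc (c ⊔ ℓ₁)) where
    field
      Mem      : Pred (Vector F.Carrier n) (c ⊔ ℓ₁)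
      respects : Mem Respects _≋_
      0-mem    : Mem (λ _ → F.0#)
      +-mem    : ∀ {x y} → Mem x → Mem y → Mem (λ i → x i F.⊕ y i)
      *-mem    : ∀ a {x} → Mem x → Mem (λ i → a F.⊙ x i)

  LinearlyIndependent : ∀ {k n} → Pred (Vector (Vector F.Carrier n) k) (c ⊔ ℓ₁)
  LinearlyIndependent b =
    ∀ α → linearCombination α b ≋ (λ _ → F.0#) → ∀ i → α i F.≈ F.0#

  record HasDimension {n} (U : Subspace n) (k : ℕ) : Set (c ⊔ ℓ₁) where
    open Subspace U
    field
      basis       : Vector (Vector F.Carrier n) k
      basis-mem   : ∀ i → Mem (basis i)
      independent : LinearlyIndependent basis
      spanning    : ∀ {x} → Mem x → ∃ λ α → x ≋ linearCombination α basis

  -- The k-dimensional subspaces of F^n, two being equal when they have the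
  -- same elements.  Its cardinality is the Gaussian binomial [n k]_q.
  Grassmannian : (n k : ℕ) → Setoid (lsuc (c ⊔ ℓ₁)) (c ⊔ ℓ₁)
  Grassmannian n k = record
    { Carrier       = Σ (Subspace n) (λ U → HasDimension U k)
    ; _≈_           = λ (U , _) (W , _) → ∀ x → Subspace.Mem U x ⇔ Subspace.Mem W x
    ; isEquivalence = record
      { refl  = λ x → mk⇔ (λ z → z) (λ z → z)
      ; sym   = λ e x → mk⇔ (from (e x)) (to (e x))
      ; trans = λ e e′ x → mk⇔ (to (e′ x) ∘ to (e x)) (from (e x) ∘ from (e′ x))
      }
    }
    where open Equivalence

  Skew : ∀ {n k} → Rel (Setoid.Carrier (Grassmannian n k)) (c ⊔ ℓ₁)
  Skew (U , _) (W , _) =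
    ∀ x → Subspace.Mem U x → Subspace.Mem W x → x ≋ (λ _ → F.0#)

  private
    open Inverse F.cardinality using (to; from; to-cong; strictlyInverseʳ)

    _≟_ : Decidable₂ F._≈_
    x ≟ y = map′ (λ e → F.trans (F.sym (strictlyInverseʳ x))
                        (F.trans (F.reflexive (cong from e)) (strictlyInverseʳ y)))
                 to-cong (to x Fin.≟ to y)

    _≋?_ : ∀ {n} → Decidable₂ (_≋_ {n})
    x ≋? y = Fin.all? (λ i → x i ≟ y i)

    ∃? : ∀ {a} n {P : Pred (Vector F.Carrier n) a} → P Respects _≋_ →
         Decidable P → Dec (∃ P)
    ∃? zero    resp P? = map′ (λ p → _ , p) (λ (x , p) → resp (λ ()) p) (P? (λ ()))
    ∃? (suc n) {P} resp P? = map′ fwd bwd (Fin.any? (λ i → rest (from i)))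
      where
      cons-cong : ∀ {a b} {x y : Vector F.Carrier n} → a F.≈ b → x ≋ y → (a ∷ᶠ x) ≋ (b ∷ᶠ y)
      cons-cong a≈b x≋y zero    = a≈b
      cons-cong a≈b x≋y (suc i) = x≋y i

      rest : ∀ a → Dec (∃ λ x → P (a ∷ᶠ x))
      rest a = ∃? n (λ x≋y → resp (cons-cong F.refl x≋y)) (λ x → P? (a ∷ᶠ x))

      fwd : (∃ λ i → ∃ λ x → P (from i ∷ᶠ x)) → ∃ P
      fwd (i , x , p) = from i ∷ᶠ x , p

      η : ∀ (x : Vector F.Carrier (suc n)) → x ≋ (from (to (head x)) ∷ᶠ tail x)
      η x zero    = F.sym (strictlyInverseʳ (x zero))
      η x (suc i) = F.refl

      bwd : ∃ P → ∃ λ i → ∃ λ x → P (from i ∷ᶠ x)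
      bwd (x , p) = to (head x) , tail x , resp (η x) p

    mem? : ∀ {n k} ((U , _) : Setoid.Carrier (Grassmannian n k)) → Decidable (Subspace.Mem U)
    mem? {n} {k} (U , dim) x =
      map′ (λ (α , e) → respects (λ i → F.sym (e i)) (lc-mem k basis basis-mem α))
           spanning
           (∃? k (λ α≋β e i → F.trans (e i) (sum-cong-≋ (λ j → F.*-congʳ (α≋β j))))
                 (λ α → x ≋? linearCombination α basis))
      where
      open Subspace U
      open HasDimension dim

      lc-mem : ∀ m (b : Vector (Vector F.Carrier n) m) → (∀ i → Mem (b i)) →
               ∀ α → Mem (linearCombination α b)
      lc-mem zero    b b∈ α = 0-mem
      lc-mem (suc m) b b∈ α =
        +-mem (*-mem (α zero) (b∈ zero)) (lc-mem m (tail b) (b∈ ∘ suc) (tail α))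

  skew? : ∀ {n k} → Decidable₂ (Skew {n} {k})
  skew? {n} U@(U′ , _) W@(W′ , _) =
    map′ (λ none x x∈U x∈W → decidable-stable (x ≋? _) (λ x≉0 → none (x , x∈U , x∈W , x≉0)))
         (λ skew (x , x∈U , x∈W , x≉0) → x≉0 (skew x x∈U x∈W))
         (¬? (∃? n (λ x≋y (x∈U , x∈W , x≉0) →
                      Subspace.respects U′ x≋y x∈U
                    , Subspace.respects W′ x≋y x∈W
                    , λ y≈0 → x≉0 (λ i → F.trans (x≋y i) (y≈0 i)))
                   (λ x → mem? U x ×-dec mem? W x ×-dec ¬? (x ≋? _))))

open Sum ℤ.+-*-semiring using (sum; sum-cong-≋; ∑-distrib-+)

Matrix : ℕ → Set
Matrix N = Fin N → Fin N → ℤ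

infixl 7 _⊛_
_⊛_ : ∀ {N} → Matrix N → Matrix N → Matrix N
(A ⊛ B) i j = sum (λ k → A i k ℤ.* B k j)

diagonal : ∀ {N} → (Fin N → ℕ) → Matrix N
diagonal d i j = if does (i Fin.≟ j) then + d i else + 0

identity : ∀ {N} → Matrix N
identity = diagonal (λ _ → 1)

infix 4 _≈ᴹ_
_≈ᴹ_ : ∀ {N} → Rel (Matrix N) _
A ≈ᴹ B = ∀ i j → A i j ≡ B i j

Unimodular : ∀ {N} → Pred (Matrix N) _
Unimodular P = ∃ λ P⁻¹ → P ⊛ P⁻¹ ≈ᴹ identity × P⁻¹ ⊛ P ≈ᴹ identity

record SmithNormalForm {N} (A : Matrix N) : Set where
  field
    P Q          : Matrix N
    P-unimodular : Unimodular P
    Q-unimodular : Unimodular Q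
    d            : Fin N → ℕ
    diagonalises : P ⊛ A ⊛ Q ≈ᴹ diagonal d
    d-divides    : ∀ i j → toℕ i ≤ toℕ j → d i ∣ d j

-- Zero entries are excluded explicitly, as v ℓ 0 is junk.
multiplicity : ∀ {N} {A : Matrix N} → SmithNormalForm A → (ℓ i : ℕ) → ℕ
multiplicity {N} S ℓ i = count (λ j → ¬? (d j ℕ.≟ 0) ×-dec (v ℓ (d j) ℕ.≟ i)) (allFin N)
  where open SmithNormalForm S

_IsExactly_ : (ℕ → ℕ) → List (ℕ × ℕ) → Set
e IsExactly xs = All (λ (i , m) → e i ≡ m) xs
               × (∀ i → All (λ (j , _) → i ≢ j) xs → e i ≡ 0)

module _ (G : AbelianGroup c ℓ₁) (H : AbelianGroup c′ ℓ₁′) where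
  private
    module G = AbelianGroup G
    module H = AbelianGroup H
  open H using (_≈_; _∙_; ε; _⁻¹)
  open CommutativeSemigroupProperties H.commutativeSemigroup using (interchange)
  open AbelianGroupProperties H using (⁻¹-∙-comm)
  open import Relation.Binary.Reasoning.Setoid H.setoid

  cokernel : (f : G.Carrier → H.Carrier) → IsGroupHomomorphism G.rawGroup H.rawGroup f →
             AbelianGroup c′ (c ⊔ ℓ₁′)
  cokernel f hom = record
    { Carrier = H.Carrier ; _≈_ = _∼_ ; _∙_ = _∙_ ; ε = ε ; _⁻¹ = _⁻¹
    ; isAbelianGroup = record
      { isGroup = record
        { isMonoid = record
          { isSemigroup = record
            { isMagma = record
              { isEquivalence = record { refl = lift H.refl ; sym = ∼-sym ; trans = ∼-trans }
              ; ∙-cong = ∼-cong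
              }
            ; assoc = λ x y z → lift (H.assoc x y z)
            }
          ; identity = (λ x → lift (H.identityˡ x)) , (λ x → lift (H.identityʳ x))
          }
        ; inverse = (λ x → lift (H.inverseˡ x)) , (λ x → lift (H.inverseʳ x))
        ; ⁻¹-cong = ∼-⁻¹
        }
      ; comm = λ x y → lift (H.comm x y)
      }
    }
    where
    open IsGroupHomomorphism hom using (homo; ε-homo; ⁻¹-homo)

    _∼_ : Rel H.Carrier _
    x ∼ y = ∃ λ z → x ≈ f z ∙ y

    lift : ∀ {x y} → x ≈ y → x ∼ y
    lift {x} {y} x≈y = G.ε , (begin
      x            ≈⟨ x≈y ⟩
      y            ≈⟨ H.identityˡ y ⟨
      ε ∙ y        ≈⟨ H.∙-congʳ ε-homo ⟨
      f G.ε ∙ y    ∎)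

    ∼-sym : ∀ {x y} → x ∼ y → y ∼ x
    ∼-sym {x} {y} (z , e) = z G.⁻¹ , (begin
      y                       ≈⟨ H.identityˡ y ⟨
      ε ∙ y                   ≈⟨ H.∙-congʳ (H.inverseˡ (f z)) ⟨
      f z ⁻¹ ∙ f z ∙ y        ≈⟨ H.assoc _ _ _ ⟩
      f z ⁻¹ ∙ (f z ∙ y)      ≈⟨ H.∙-cong (⁻¹-homo z) e ⟨
      f (z G.⁻¹) ∙ x          ∎)

    ∼-trans : ∀ {x y w} → x ∼ y → y ∼ w → x ∼ w
    ∼-trans {x} {y} {w} (z , e) (z′ , e′) = z G.∙ z′ , (begin
      x                    ≈⟨ e ⟩
      f z ∙ y              ≈⟨ H.∙-congˡ e′ ⟩
      f z ∙ (f z′ ∙ w)     ≈⟨ H.assoc _ _ _ ⟨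
      f z ∙ f z′ ∙ w       ≈⟨ H.∙-congʳ (homo z z′) ⟨
      f (z G.∙ z′) ∙ w     ∎)

    ∼-cong : ∀ {x y u w} → x ∼ y → u ∼ w → (x ∙ u) ∼ (y ∙ w)
    ∼-cong {x} {y} {u} {w} (z , e) (z′ , e′) = z G.∙ z′ , (begin
      x ∙ u                     ≈⟨ H.∙-cong e e′ ⟩
      (f z ∙ y) ∙ (f z′ ∙ w)    ≈⟨ interchange _ _ _ _ ⟩
      (f z ∙ f z′) ∙ (y ∙ w)    ≈⟨ H.∙-congʳ (homo z z′) ⟨
      f (z G.∙ z′) ∙ (y ∙ w)    ∎)

    ∼-⁻¹ : ∀ {x y} → x ∼ y → (x ⁻¹) ∼ (y ⁻¹)
    ∼-⁻¹ {x} {y} (z , e) = z G.⁻¹ , (begin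
      x ⁻¹                 ≈⟨ H.⁻¹-cong e ⟩
      (f z ∙ y) ⁻¹         ≈⟨ ⁻¹-∙-comm (f z) y ⟨
      f z ⁻¹ ∙ y ⁻¹        ≈⟨ H.∙-congʳ (⁻¹-homo z) ⟨
      f (z G.⁻¹) ∙ y ⁻¹    ∎)

module _ (G : AbelianGroup c ℓ₁) where
  private
    module G = AbelianGroup G
  open G using (_≈_; _∙_; ε; _⁻¹)
  open Mult G.commutativeMonoid using (×-distrib-+; ×-assocˡ; ×-congʳ; ×-congˡ)
    renaming (_×_ to _·_)
  open import Relation.Binary.Reasoning.Setoid G.setoid

  IsTorsion : Pred G.Carrier ℓ₁
  IsTorsion x = ∃ λ m → NonZero m × m · x ≈ ε

  private
    ·-ε : ∀ m → m · ε ≈ ε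
    ·-ε zero    = G.refl
    ·-ε (suc m) = G.trans (G.identityˡ _) (·-ε m)

    torsion-ε : IsTorsion ε
    torsion-ε = 1 , _ , ·-ε 1

    torsion-∙ : ∀ {x y} → IsTorsion x → IsTorsion y → IsTorsion (x ∙ y)
    torsion-∙ {x} {y} (m , m≢0 , mx≈ε) (n , n≢0 , ny≈ε) =
      m * n , ℕ.m*n≢0 m n {{m≢0}} {{n≢0}} , (begin
        (m * n) · (x ∙ y)              ≈⟨ ×-distrib-+ x y (m * n) ⟩
        (m * n) · x ∙ (m * n) · y      ≈⟨ G.∙-congʳ (×-congˡ (ℕ.*-comm m n)) ⟩
        (n * m) · x ∙ (m * n) · y      ≈⟨ G.∙-cong (×-assocˡ x n m) (×-assocˡ y m n) ⟨
        n · (m · x) ∙ m · (n · y)      ≈⟨ G.∙-cong (×-congʳ n mx≈ε) (×-congʳ m ny≈ε) ⟩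
        n · ε ∙ m · ε                  ≈⟨ G.∙-cong (·-ε n) (·-ε m) ⟩
        ε ∙ ε                          ≈⟨ G.identityˡ ε ⟩
        ε                              ∎)

    torsion-⁻¹ : ∀ {x} → IsTorsion x → IsTorsion (x ⁻¹)
    torsion-⁻¹ {x} (m , m≢0 , mx≈ε) = m , m≢0 , (begin
      m · (x ⁻¹)              ≈⟨ G.identityʳ _ ⟨
      m · (x ⁻¹) ∙ ε          ≈⟨ G.∙-congˡ mx≈ε ⟨
      m · (x ⁻¹) ∙ m · x      ≈⟨ ×-distrib-+ (x ⁻¹) x m ⟨
      m · (x ⁻¹ ∙ x)          ≈⟨ ×-congʳ m (G.inverseˡ x) ⟩
      m · ε                   ≈⟨ ·-ε m ⟩
      ε                       ∎)

  torsionSubgroup : AbelianGroup (c ⊔ ℓ₁) ℓ₁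
  torsionSubgroup = record
    { Carrier = Σ G.Carrier IsTorsion
    ; _≈_ = λ (x , _) (y , _) → x ≈ y
    ; _∙_ = λ (x , t) (y , u) → x ∙ y , torsion-∙ t u
    ; ε   = ε , torsion-ε
    ; _⁻¹ = λ (x , t) → x ⁻¹ , torsion-⁻¹ t
    ; isAbelianGroup = record
      { isGroup = record
        { isMonoid = record
          { isSemigroup = record
            { isMagma = record
              { isEquivalence = record { refl = G.refl ; sym = G.sym ; trans = G.trans }
              ; ∙-cong = G.∙-cong
              }
            ; assoc = λ (x , _) (y , _) (z , _) → G.assoc x y z
            }
          ; identity = (λ (x , _) → G.identityˡ x) , (λ (x , _) → G.identityʳ x)
          }
        ; inverse = (λ (x , _) → G.inverseˡ x) , (λ (x , _) → G.inverseʳ x)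
        ; ⁻¹-cong = G.⁻¹-cong
        }
      ; comm = λ (x , _) (y , _) → G.comm x y
      }
    }

ℤ^ : ℕ → AbelianGroup _ _
ℤ^ N = Pointwise.abelianGroup (Fin N) ℤ.+-0-abelianGroup

apply : ∀ {N} → Matrix N → (Fin N → ℤ) → (Fin N → ℤ)
apply A x i = sum (λ j → A i j ℤ.* x j)

apply-homomorphism : ∀ {N} (A : Matrix N) →
  IsGroupHomomorphism (AbelianGroup.rawGroup (ℤ^ N)) (AbelianGroup.rawGroup (ℤ^ N)) (apply A)
apply-homomorphism {N} A = record
  { isMonoidHomomorphism = record
    { isMagmaHomomorphism = record
      { isRelHomomorphism = record { cong = λ x≗y → A-cong x≗y }
      ; homo = A-+
      }
    ; ε-homo = A-0
    }
  ; ⁻¹-homo = λ x → inverseˡ-unique (apply A (-_ x)) (apply A x) (λ i →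
      trans (sym (A-+ (-_ x) x i))
            (trans (A-cong (λ j → ℤ.+-inverseˡ (x j)) i) (A-0 i)))
  }
  where
  open AbelianGroupProperties (ℤ^ N) using (inverseˡ-unique; identityˡ-unique)
  -_ : (Fin N → ℤ) → (Fin N → ℤ)
  -_ = AbelianGroup._⁻¹ (ℤ^ N)

  A-cong : ∀ {x y : Fin N → ℤ} → (∀ j → x j ≡ y j) → ∀ i → apply A x i ≡ apply A y i
  A-cong x≗y i = sum-cong-≋ (λ j → cong (A i j ℤ.*_) (x≗y j))

  A-+ : ∀ x y i → apply A (λ j → x j ℤ.+ y j) i ≡ apply A x i ℤ.+ apply A y i
  A-+ x y i = trans (sum-cong-≋ (λ j → ℤ.*-distribˡ-+ (A i j) (x j) (y j)))
                    (∑-distrib-+ (λ j → A i j ℤ.* x j) (λ j → A i j ℤ.* y j))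

  A-0 : ∀ i → apply A (λ _ → + 0) i ≡ + 0
  A-0 = identityˡ-unique (apply A (λ _ → + 0)) (apply A (λ _ → + 0))
          (λ i → sym (A-+ (λ _ → + 0) (λ _ → + 0) i))

criticalGroup : ∀ {N} → Matrix N → AbelianGroup _ _
criticalGroup {N} L = torsionSubgroup (cokernel (ℤ^ N) (ℤ^ N) (apply L) (apply-homomorphism L))

module _ {q : ℕ} (F : FiniteField c ℓ₁ q) {n N : ℕ}
         (vertices : HasCardinality (Grassmannian F n 2) N) where

  open Inverse vertices using (from)

  adjacencyMatrix : Matrix N
  adjacencyMatrix i j = if does (skew? F (from i) (from j)) then + 1 else + 0

  -- kI - A with k = q⁴[n-2 2]_q, the Gaussian binomial being the number N′
  -- of 2-dimensional subspaces of F^(n-2).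
  laplacian : ∀ {N′} → HasCardinality (Grassmannian F (n ∸ 2) 2) N′ → Matrix N
  laplacian {N′} _ i j = diagonal (λ _ → q ^ 4 * N′) i j ℤ.- adjacencyMatrix i j

{-# OPTIONS --safe #-}
-- Let B be the incidence matrix of the points against the lines of PG(n-1, q).
-- Two lines meet in a point unless they are skew or equal, two points lie on
-- one line, a line has q + 1 points and a point is on R = [n-1] lines.  Hence
-- L = BᵀB − J + sI and BBᵀ = (R − 1)I + J, so that L acts as s on ker B and as
-- r = R − 1 + s on the images Bᵀw of vectors w of sum 0.
--
-- Let c i be the number of diagonal entries of the Smith normal form that are
-- divisible by ℓ^i, that is, the dimension of {y : ℓ^i ∣ Ly} modulo ℓ.  It is
-- bounded from both sides by exhibiting linear families of vectors y, cut out by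
-- linear equations, which either all satisfy ℓ^i ∣ Ly and are independent modulo
-- ℓ, or satisfy ℓ^i ∣ Ly only if they vanish modulo ℓ.  The families come
-- from ker B, im Bᵀ, the constant vectors and single lines; if ℓ divides r and s,
-- then R − 1 is no unit and one also needs that q(p − p′) is in the image of B
-- for all points p and p′, by the lines of a plane through them.  In this way all
-- c i are found, and the multiplicity of ℓ^i is c i − c (i + 1).
module Submission where

open import Level using (Level; _⊔_)
open import Algebra.Bundles using (AbelianGroup; CommutativeRing)
open import Data.Bool.Base using (Bool; true; false; if_then_else_; not)
open import Data.Fin.Base using (Fin; zero; suc; toℕ; fromℕ<)
open import Data.Nat.Primality using (Prime; prime⇒nonTrivial; prime⇒nonZero; euclidsLemma)
open import Data.Product.Base using (∃; ∃₂; _×_; _,_; proj₁; proj₂)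
open import Data.Sum.Base using (_⊎_; inj₁; inj₂; [_,_]′)
open import Data.List.Base using (_∷_; [])
open import Function.Base using (_∘_; id)
open import Function.Bundles using (Inverse; Equivalence; _⇔_; mk⇔)
open import Relation.Binary.Bundles using (Setoid)
open import Relation.Nullary.Decidable
  using (Dec; yes; no; does; dec-true; dec-false; does-⇔; map′; ¬?; _×-dec_)
open import Relation.Nullary.Negation using (¬_; contradiction)
open import Data.Nat.Base as ℕ using (ℕ; zero; suc; s≤s; z≤n)
open import Data.Integer.Base as ℤ using (ℤ; 0ℤ; 1ℤ)
open import Relation.Binary.PropositionalEquality using (_≡_; _≢_)
import Data.Fin.Properties as Fin
import Data.Integer.Properties as ℤ

-- Nothing is ever reduced modulo ℓ. Every comparison of dimensions rests on one fact over the
-- integers: a linear system with fewer equations than unknowns has a solution that is not divisible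
-- by ℓ. Hence the families are cut out by exact equations, not by congruences, and each bound
-- carries the number of these equations.
--
-- The obstacle is that ker B, im Bᵀ and the constants need not span modulo ℓ and may meet there.
-- Two numbers measure this. A vector Bᵀw with weights of sum other than 0 brings in ρ = R - (q + 1)
-- = q²[n-3]. A vector y for which By has the constant value a satisfies θa = (q + 1)(sum y - (q +
-- 1)a) with θ = [n] - (q + 1)² = q([n-1] - (q + 2)). Since (q + 1)r = ρ[n] and (q + 1)s = θ[n-1],
-- the valuations of ρ and θ yield the exceptional exponents of multiplicity one in (A).
--
-- If ℓ divides r and s, then BBᵀ is no longer invertible modulo ℓ on weights of sum 0. Given z with
-- Bz = qw, the combination qBᵀw - rz is mapped by L to -rsz; this is the source of the exponent a +
-- b in (B).

-- Integer linear forms and primitive solutions of linear systems.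

module LinearForms where

  open import Data.Fin.Base using (punchIn; punchOut)
  open import Data.Integer.Base using (+_; _+_; _*_; -_; ∣_∣)
  open import Data.Integer.Divisibility.Signed using (_∣_; divides; _∣?_; ∣m∣n⇒∣m+n)
  open import Data.Integer.Tactic.RingSolver using (solve-∀)
  import Data.Nat.Properties as ℕ
  import Data.Nat.Divisibility as ℕ
  open import Data.Nat.Induction using (<-wellFounded)
  open import Data.Vec.Functional using () renaming (_∷_ to _∷ᶠ_)
  open import Induction.WellFounded using (Acc; acc)
  open import Relation.Binary.PropositionalEquality
    using (_≡_; _≢_; _≗_; refl; sym; trans; cong; cong₂; subst; module ≡-Reasoning)
  open import Algebra.Properties.Semiring.Sum ℤ.+-*-semiring
    using (sum; sum-cong-≗; sum-remove; sum-replicate-zero)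
  open ≡-Reasoning

  sum-zero : ∀ {n} {f : Fin n → ℤ} → (∀ i → f i ≡ 0ℤ) → sum f ≡ 0ℤ
  sum-zero {n} f≡0 = trans (sum-cong-≗ f≡0) (sum-replicate-zero n)

  sum-single : ∀ {n} (i : Fin n) {f : Fin n → ℤ} → (∀ j → j ≢ i → f j ≡ 0ℤ) → sum f ≡ f i
  sum-single {suc n} i {f} f≡0 = begin
    sum f                                ≡⟨ sum-remove {i = i} f ⟩
    f i + sum (λ j → f (punchIn i j))    ≡⟨ cong (λ z → f i + z) (sum-zero (λ j → f≡0 _ (Fin.punchInᵢ≢i i j))) ⟩
    f i + 0ℤ                             ≡⟨ ℤ.+-identityʳ (f i) ⟩
    f i                                  ∎

  ∣-sum : ∀ {n} {k} {f : Fin n → ℤ} → (∀ i → k ∣ f i) → k ∣ sum f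
  ∣-sum {zero}  k∣f = divides 0ℤ refl
  ∣-sum {suc n} k∣f = ∣m∣n⇒∣m+n (k∣f zero) (∣-sum (k∣f ∘ suc))

  -- Forms are functions rather than coefficient vectors, so that products with incidence matrices
  -- and their composites qualify as they stand. Vectors are functions too, which is why respect for
  -- pointwise equality is a field.
  record Linear {k} (φ : (Fin k → ℤ) → ℤ) : Set where
    field
      ≗-cong : ∀ {x y} → x ≗ y → φ x ≡ φ y
      homo   : ∀ a b x y → φ (λ i → a * x i + b * y i) ≡ a * φ x + b * φ y

    scale : ∀ a x → φ (λ i → a * x i) ≡ a * φ x
    scale a x = begin
      φ (λ i → a * x i)                 ≡⟨ ≗-cong (λ i → pad a (x i)) ⟩
      φ (λ i → a * x i + 0ℤ * x i)      ≡⟨ homo a 0ℤ x x ⟩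
      a * φ x + 0ℤ * φ x                ≡⟨ pad a (φ x) ⟨
      a * φ x                           ∎
      where
      pad : ∀ a b → a * b ≡ a * b + 0ℤ * b
      pad = solve-∀

  open Linear

  LinearMap : ∀ {k n} → ((Fin k → ℤ) → Fin n → ℤ) → Set
  LinearMap F = ∀ i → Linear (λ x → F x i)

  lin-proj : ∀ {k} (i : Fin k) → Linear (λ x → x i)
  lin-proj i .≗-cong e      = e i
  lin-proj i .homo a b x y  = refl

  lin-0 : ∀ {k} → Linear {k} (λ _ → 0ℤ)
  lin-0 .≗-cong e     = refl
  lin-0 .homo a b x y = identity a b
    where
    identity : ∀ a b → 0ℤ ≡ a * 0ℤ + b * 0ℤ
    identity = solve-∀

  lin-+ : ∀ {k} {φ ψ : (Fin k → ℤ) → ℤ} → Linear φ → Linear ψ → Linear (λ x → φ x + ψ x)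
  lin-+ Φ Ψ .≗-cong e     = cong₂ _+_ (Φ .≗-cong e) (Ψ .≗-cong e)
  lin-+ {φ = φ} {ψ} Φ Ψ .homo a b x y =
    trans (cong₂ _+_ (Φ .homo a b x y) (Ψ .homo a b x y)) (identity a b (φ x) (φ y) (ψ x) (ψ y))
    where
    identity : ∀ a b p q r s → (a * p + b * q) + (a * r + b * s) ≡ a * (p + r) + b * (q + s)
    identity = solve-∀

  lin-* : ∀ {k} c {φ : (Fin k → ℤ) → ℤ} → Linear φ → Linear (λ x → c * φ x)
  lin-* c Φ .≗-cong e = cong (c *_) (Φ .≗-cong e)
  lin-* c {φ} Φ .homo a b x y = trans (cong (c *_) (Φ .homo a b x y)) (identity a b c (φ x) (φ y))
    where
    identity : ∀ a b c p q → c * (a * p + b * q) ≡ a * (c * p) + b * (c * q)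
    identity = solve-∀

  lin-*ʳ : ∀ {k} c {φ : (Fin k → ℤ) → ℤ} → Linear φ → Linear (λ x → φ x * c)
  lin-*ʳ c Φ .≗-cong e = cong (_* c) (Φ .≗-cong e)
  lin-*ʳ c {φ} Φ .homo a b x y = trans (cong (_* c) (Φ .homo a b x y)) (identity a b c (φ x) (φ y))
    where
    identity : ∀ a b c p q → (a * p + b * q) * c ≡ a * (p * c) + b * (q * c)
    identity = solve-∀

  lin-- : ∀ {k} {φ ψ : (Fin k → ℤ) → ℤ} → Linear φ → Linear ψ → Linear (λ x → φ x ℤ.- ψ x)
  lin-- {φ = φ} {ψ} Φ Ψ .≗-cong e = cong₂ ℤ._-_ (Φ .≗-cong e) (Ψ .≗-cong e)
  lin-- {φ = φ} {ψ} Φ Ψ .homo a b x y =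
    trans (cong₂ ℤ._-_ (Φ .homo a b x y) (Ψ .homo a b x y)) (identity a b (φ x) (φ y) (ψ x) (ψ y))
    where
    identity : ∀ a b p q r s → (a * p + b * q) ℤ.- (a * r + b * s) ≡ a * (p ℤ.- r) + b * (q ℤ.- s)
    identity = solve-∀

  lin-sum : ∀ {k n} {F : (Fin k → ℤ) → Fin n → ℤ} → LinearMap F → Linear (λ x → sum (F x))
  lin-sum {n = zero}  Φ = lin-0
  lin-sum {n = suc n} Φ = lin-+ (Φ zero) (lin-sum (Φ ∘ suc))

  lin-∘ : ∀ {k n} {φ : (Fin n → ℤ) → ℤ} {F : (Fin k → ℤ) → Fin n → ℤ} →
          Linear φ → LinearMap F → Linear (λ x → φ (F x))
  lin-∘ Φ lin-F .≗-cong e     = Φ .≗-cong (λ i → lin-F i .≗-cong e)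
  lin-∘ Φ lin-F .homo a b x y = trans (Φ .≗-cong (λ i → lin-F i .homo a b x y)) (Φ .homo a b _ _)

  *≢0 : ∀ {a b} → a ≢ 0ℤ → b ≢ 0ℤ → a * b ≢ 0ℤ
  *≢0 {a} a≢0 b≢0 ab≡0 = [ a≢0 , b≢0 ]′ (ℤ.i*j≡0⇒i≡0∨j≡0 a ab≡0)

  -- Gaussian elimination without fractions: either the first unit vector lies in the kernel, or
  -- some equation has a nonzero pivot, which removes one unknown and one equation.
  wide-kernel : ∀ {k j} (F : (Fin k → ℤ) → Fin j → ℤ) → LinearMap F → j ℕ.< k →
                ∃ λ α → (∃ λ t → α t ≢ 0ℤ) × (∀ i → F α i ≡ 0ℤ)
  wide-kernel {suc k} {j} F lin-F j<k = go j F lin-F j<k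
    where
    e₀ : Fin (suc k) → ℤ
    e₀ = 1ℤ ∷ᶠ (λ _ → 0ℤ)

    go : ∀ j (F : (Fin (suc k) → ℤ) → Fin j → ℤ) → LinearMap F → j ℕ.< suc k →
         ∃ λ α → (∃ λ t → α t ≢ 0ℤ) × (∀ i → F α i ≡ 0ℤ)
    go j F lin-F j<k with Fin.all? (λ i → F e₀ i ℤ.≟ 0ℤ)
    ... | yes Fe₀≡0 = e₀ , (zero , λ ()) , Fe₀≡0
    ... | no  Fe₀≢0 with Fin.¬∀⟶∃¬ j _ (λ i → F e₀ i ℤ.≟ 0ℤ) Fe₀≢0
    go (suc j) F lin-F (s≤s j<k) | no _ | i₀ , p≢0 = α , (suc (proj₁ (proj₁ (proj₂ rec))) , *≢0 p≢0 (proj₂ (proj₁ (proj₂ rec)))) , vanish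
      where
      p : ℤ
      p = F e₀ i₀

      -- The first unknown is solved for up to the pivot. Multiplying the other unknowns by `p`
      -- keeps the solution integral and makes equation `i₀` hold identically.
      eliminate : (Fin k → ℤ) → Fin (suc k) → ℤ
      eliminate β = (- F (0ℤ ∷ᶠ β) i₀) ∷ᶠ (λ t → p * β t)

      lin-0∷ : LinearMap {k} (λ β → 0ℤ ∷ᶠ β)
      lin-0∷ zero    = lin-0
      lin-0∷ (suc t) = lin-proj t

      eliminate≗ : ∀ β t → eliminate β t ≡ (- F (0ℤ ∷ᶠ β) i₀) * e₀ t + p * (0ℤ ∷ᶠ β) t
      eliminate≗ β zero = identity (- F (0ℤ ∷ᶠ β) i₀) p
        where
        identity : ∀ a p → a ≡ a * 1ℤ + p * 0ℤ
        identity = solve-∀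
      eliminate≗ β (suc t) = identity (- F (0ℤ ∷ᶠ β) i₀) (p * β t)
        where
        identity : ∀ a b → b ≡ a * 0ℤ + b
        identity = solve-∀

      lin-eliminate : LinearMap eliminate
      lin-eliminate zero    = neg (lin-∘ (lin-F i₀) lin-0∷)
        where
        neg : {φ : (Fin k → ℤ) → ℤ} → Linear φ → Linear (λ x → - φ x)
        neg Φ .≗-cong e = cong -_ (Φ .≗-cong e)
        neg {φ} Φ .homo a b x y = trans (cong -_ (Φ .homo a b x y)) (identity a b (φ x) (φ y))
          where
          identity : ∀ a b p q → - (a * p + b * q) ≡ a * (- p) + b * (- q)
          identity = solve-∀
      lin-eliminate (suc t) = lin-* p (lin-proj t)

      rec : ∃ λ β → (∃ λ t → β t ≢ 0ℤ) × (∀ i → F (eliminate β) (punchIn i₀ i) ≡ 0ℤ)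
      rec = wide-kernel (λ β i → F (eliminate β) (punchIn i₀ i))
                        (λ i → lin-∘ (lin-F (punchIn i₀ i)) lin-eliminate) j<k

      β : Fin k → ℤ
      β = proj₁ rec

      α : Fin (suc k) → ℤ
      α = eliminate β

      vanish : ∀ i → F α i ≡ 0ℤ
      vanish i with i₀ Fin.≟ i
      ... | yes refl = trans (trans (lin-F i₀ .≗-cong (eliminate≗ β)) (lin-F i₀ .homo (- F (0ℤ ∷ᶠ β) i₀) p e₀ (0ℤ ∷ᶠ β)))
                             (identity (F (0ℤ ∷ᶠ β) i₀) p)
        where
        identity : ∀ a p → (- a) * p + p * a ≡ 0ℤ
        identity = solve-∀
      ... | no  i₀≢i = subst (λ i → F α i ≡ 0ℤ) (Fin.punchIn-punchOut i₀≢i) (proj₂ (proj₂ rec) (punchOut i₀≢i))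

  -- Dividing a kernel vector by ℓ as often as possible keeps it in the kernel.
  primitive-kernel : ∀ {k j} (F : (Fin k → ℤ) → Fin j → ℤ) → LinearMap F → j ℕ.< k →
                     ∀ ℓ → 1 ℕ.< ℓ → ∃ λ α → ¬ (∀ t → + ℓ ∣ α t) × (∀ i → F α i ≡ 0ℤ)
  primitive-kernel {k} {j} F lin-F j<k ℓ 1<ℓ with wide-kernel F lin-F j<k
  ... | α₀ , (t , α₀t≢0) , Fα₀≡0 = go α₀ α₀t≢0 Fα₀≡0 (<-wellFounded _)
    where
    -- The recursion is on the absolute value of one fixed nonzero coordinate, which drops with each
    -- division because ℓ > 1.
    go : ∀ α → α t ≢ 0ℤ → (∀ i → F α i ≡ 0ℤ) → Acc ℕ._<_ ∣ α t ∣ →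
         ∃ λ α → ¬ (∀ t → + ℓ ∣ α t) × (∀ i → F α i ≡ 0ℤ)
    go α αt≢0 Fα≡0 (acc rs) with Fin.all? (λ t → + ℓ ∣? α t)
    ... | no  ∤α = α , ∤α , Fα≡0
    ... | yes ∣α = go β βt≢0 Fβ≡0 (rs smaller)
      where
      β : Fin k → ℤ
      β i = _∣_.quotient (∣α i)

      α≗ : ∀ i → α i ≡ + ℓ * β i
      α≗ i = trans (_∣_.equality (∣α i)) (ℤ.*-comm (β i) (+ ℓ))

      βt≢0 : β t ≢ 0ℤ
      βt≢0 e = αt≢0 (trans (α≗ t) (trans (cong (+ ℓ *_) e) (ℤ.*-zeroʳ (+ ℓ))))

      Fβ≡0 : ∀ i → F β i ≡ 0ℤ
      Fβ≡0 i with ℤ.i*j≡0⇒i≡0∨j≡0 (+ ℓ) (trans (sym (trans (lin-F i .≗-cong α≗) (scale (lin-F i) (+ ℓ) β))) (Fα≡0 i))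
      ... | inj₁ ℓ≡0 = contradiction (subst (1 ℕ.<_) (ℤ.+-injective ℓ≡0) 1<ℓ) λ ()
      ... | inj₂ e   = e

      smaller : ∣ β t ∣ ℕ.< ∣ α t ∣
      smaller = subst (∣ β t ∣ ℕ.<_) (trans (ℕ.*-comm ∣ β t ∣ ℓ) (sym (trans (cong ∣_∣ (α≗ t)) (ℤ.abs-* (+ ℓ) (β t)))))
                  (ℕ.m<m*n ∣ β t ∣ ℓ {{ℕ.≢-nonZero (λ e → βt≢0 (ℤ.∣i∣≡0⇒i≡0 e))}} 1<ℓ)

open import Defs

-- Counting Smith entries divisible by a prime power, with bounds from both sides.

module SmithForms where

  open LinearForms
  open import Data.Fin.Base using (splitAt; _↑ˡ_; _↑ʳ_)
  open import Data.Integer.Base using (+_; _+_; _*_; ∣_∣)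
  open import Data.Integer.Divisibility.Signed
    using (_∣_; divides; _∣?_; ∣ᵤ⇒∣; ∣⇒∣ᵤ; ∣n⇒∣m*n; ∣-trans; *-cancelˡ-∣)
  import Data.Nat.Properties as ℕ
  import Data.Nat.Divisibility as ℕ
  open import Data.Vec.Base using (count; tabulate)
  open import Relation.Unary using (Pred; Decidable)
  open import Relation.Binary.PropositionalEquality
    using (_≡_; _≢_; _≗_; refl; sym; trans; cong; subst; module ≡-Reasoning)
  open import Algebra.Properties.Semiring.Sum ℤ.+-*-semiring
    using (sum; sum-cong-≗; ∑-comm; *-distribˡ-sum; *-distribʳ-sum)
  open ≡-Reasoning

  # : ∀ {n} → (Fin n → Bool) → ℕ
  # {zero}  p = 0
  # {suc n} p = if p zero then suc (# (p ∘ suc)) else # (p ∘ suc)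

  #-cong : ∀ {n} {p q : Fin n → Bool} → p ≗ q → # p ≡ # q
  #-cong {zero}          e = refl
  #-cong {suc n} {p} {q} e with p zero | q zero | e zero | #-cong (e ∘ suc)
  ... | true  | true  | refl | e′ = cong suc e′
  ... | false | false | refl | e′ = e′

  count-tabulate : ∀ {a p} {A : Set a} {P : Pred A p} (P? : Decidable P) {n} (f : Fin n → A) →
                   count P? (tabulate f) ≡ # (λ i → does (P? (f i)))
  count-tabulate P? {zero}  f = refl
  count-tabulate P? {suc n} f with does (P? (f zero))
  ... | true  = cong suc (count-tabulate P? (f ∘ suc))
  ... | false = count-tabulate P? (f ∘ suc)

  -- Disjoint union of truth values. The combination of two `true` is missing, so that a pointwise
  -- proof makes the counts add up.
  data _⊕_≡ᵇ_ : Bool → Bool → Bool → Set where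
    left    : true  ⊕ false ≡ᵇ true
    right   : false ⊕ true  ≡ᵇ true
    neither : false ⊕ false ≡ᵇ false

  #-disjoint : ∀ {n} {p q r : Fin n → Bool} → (∀ i → p i ⊕ q i ≡ᵇ r i) → # p ℕ.+ # q ≡ # r
  #-disjoint {zero}              e = refl
  #-disjoint {suc n} {p} {q} {r} e with p zero | q zero | r zero | e zero | #-disjoint (e ∘ suc)
  ... | _ | _ | _ | left    | e′ = cong suc e′
  ... | _ | _ | _ | right   | e′ = trans (ℕ.+-suc _ _) (cong suc e′)
  ... | _ | _ | _ | neither | e′ = e′

  #-true : ∀ n → # {n} (λ _ → true) ≡ n
  #-true zero    = refl
  #-true (suc n) = cong suc (#-true n)

  #-not : ∀ {n} (p : Fin n → Bool) → # p ℕ.+ # (not ∘ p) ≡ n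
  #-not {n} p = trans (#-disjoint (λ i → split (p i))) (#-true n)
    where
    split : ∀ b → b ⊕ not b ≡ᵇ true
    split true  = left
    split false = right

  enumerate : ∀ {n} (p : Fin n → Bool) → Fin (# p) → Fin n
  enumerate {suc n} p t with p zero
  enumerate {suc n} p zero    | true  = zero
  enumerate {suc n} p (suc t) | true  = suc (enumerate (p ∘ suc) t)
  enumerate {suc n} p t       | false = suc (enumerate (p ∘ suc) t)

  enumerate-onto : ∀ {n} (p : Fin n → Bool) j → p j ≡ true → ∃ λ t → enumerate p t ≡ j
  enumerate-onto {suc n} p zero    pj with p zero
  ... | true = zero , refl
  enumerate-onto {suc n} p (suc j) pj with p zero | enumerate-onto (p ∘ suc) j pj
  ... | true  | t , e = suc t , cong suc e
  ... | false | t , e = t , cong suc e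

  prime>1 : ∀ {p} → Prime p → 1 ℕ.< p
  prime>1 {p} pr = ℕ.nonTrivial⇒n>1 p {{prime⇒nonTrivial pr}}

  cancel-prime-power : ∀ {ℓ} → Prime ℓ → ∀ i {m k} → ¬ (ℓ ℕ.∣ k) → ℓ ℕ.^ i ℕ.∣ m ℕ.* k → ℓ ℕ.^ i ℕ.∣ m
  cancel-prime-power     pr zero            ℓ∤k _    = ℕ.1∣ _
  cancel-prime-power {ℓ} pr (suc i) {m} {k} ℓ∤k ∣mk with euclidsLemma m k pr (ℕ.∣-trans (ℕ.m∣m*n (ℓ ℕ.^ i)) ∣mk)
  ... | inj₂ ℓ∣k = contradiction ℓ∣k ℓ∤k
  ... | inj₁ (ℕ.divides m′ refl) =
    subst (ℓ ℕ.^ suc i ℕ.∣_) (ℕ.*-comm ℓ m′)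
      (ℕ.*-monoʳ-∣ ℓ (cancel-prime-power pr i ℓ∤k (ℕ.*-cancelˡ-∣ ℓ {{prime⇒nonZero pr}}
        (subst (ℓ ℕ.^ suc i ℕ.∣_) (trans (cong (ℕ._* k) (ℕ.*-comm m′ ℓ)) (ℕ.*-assoc ℓ m′ k)) ∣mk))))

  apply-cong : ∀ {N} (A : Matrix N) {x y} → x ≗ y → ∀ i → apply A x i ≡ apply A y i
  apply-cong A e i = sum-cong-≗ (λ j → cong (A i j *_) (e j))

  apply-congˡ : ∀ {N} {A B : Matrix N} → A ≈ᴹ B → ∀ x i → apply A x i ≡ apply B x i
  apply-congˡ e x i = sum-cong-≗ (λ j → cong (_* x j) (e i j))

  apply-⊛ : ∀ {N} (A B : Matrix N) x i → apply (A ⊛ B) x i ≡ apply A (apply B x) i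
  apply-⊛ A B x i = begin
    sum (λ j → sum (λ k → A i k * B k j) * x j)    ≡⟨ sum-cong-≗ (λ j → *-distribʳ-sum (x j) (λ k → A i k * B k j)) ⟩
    sum (λ j → sum (λ k → A i k * B k j * x j))    ≡⟨ ∑-comm (λ j k → A i k * B k j * x j) ⟩
    sum (λ k → sum (λ j → A i k * B k j * x j))    ≡⟨ sum-cong-≗ (λ k → sum-cong-≗ (λ j → ℤ.*-assoc (A i k) (B k j) (x j))) ⟩
    sum (λ k → sum (λ j → A i k * (B k j * x j)))  ≡⟨ sum-cong-≗ (λ k → *-distribˡ-sum (A i k) (λ j → B k j * x j)) ⟨
    sum (λ k → A i k * sum (λ j → B k j * x j))    ∎

  diagonal-≡ : ∀ {N} (d : Fin N → ℕ) i → diagonal d i i ≡ + d i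
  diagonal-≡ d i with i Fin.≟ i
  ... | yes _   = refl
  ... | no  i≢i = contradiction refl i≢i

  diagonal-≢ : ∀ {N} (d : Fin N → ℕ) {i j} → i ≢ j → diagonal d i j ≡ 0ℤ
  diagonal-≢ d {i} {j} i≢j with i Fin.≟ j
  ... | yes i≡j = contradiction i≡j i≢j
  ... | no  _   = refl

  apply-diagonal : ∀ {N} (d : Fin N → ℕ) x i → apply (diagonal d) x i ≡ + d i * x i
  apply-diagonal d x i = trans
    (sum-single i (λ j j≢i → trans (cong (_* x j) (diagonal-≢ d (j≢i ∘ sym))) (ℤ.*-zeroˡ (x j))))
    (cong (_* x i) (diagonal-≡ d i))

  apply-inverse : ∀ {N} (A A⁻¹ : Matrix N) → A ⊛ A⁻¹ ≈ᴹ identity → ∀ x i → apply A (apply A⁻¹ x) i ≡ x i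
  apply-inverse A A⁻¹ e x i = begin
    apply A (apply A⁻¹ x) i    ≡⟨ apply-⊛ A A⁻¹ x i ⟨
    apply (A ⊛ A⁻¹) x i        ≡⟨ apply-congˡ e x i ⟩
    apply identity x i         ≡⟨ apply-diagonal (λ _ → 1) x i ⟩
    1ℤ * x i                   ≡⟨ ℤ.*-identityˡ (x i) ⟩
    x i                        ∎

  lin-apply : ∀ {N} (A : Matrix N) → LinearMap (apply A)
  lin-apply A i = lin-sum (λ j → lin-* (A i j) (lin-proj j))

  ∣-apply : ∀ {N} (A : Matrix N) {k x} → (∀ j → k ∣ x j) → ∀ i → k ∣ apply A x i
  ∣-apply A k∣x i = ∣-sum (λ j → ∣n⇒∣m*n (A i j) (k∣x j))

  module Diagonalised {N} {L : Matrix N} (S : SmithNormalForm L) where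
    open SmithNormalForm S

    P⁻¹ Q⁻¹ : Matrix N
    P⁻¹ = proj₁ P-unimodular
    Q⁻¹ = proj₁ Q-unimodular

    PP⁻¹ : ∀ x i → apply P (apply P⁻¹ x) i ≡ x i
    PP⁻¹ = apply-inverse P P⁻¹ (proj₁ (proj₂ P-unimodular))

    P⁻¹P : ∀ x i → apply P⁻¹ (apply P x) i ≡ x i
    P⁻¹P = apply-inverse P⁻¹ P (proj₂ (proj₂ P-unimodular))

    QQ⁻¹ : ∀ x i → apply Q (apply Q⁻¹ x) i ≡ x i
    QQ⁻¹ = apply-inverse Q Q⁻¹ (proj₁ (proj₂ Q-unimodular))

    Q⁻¹Q : ∀ x i → apply Q⁻¹ (apply Q x) i ≡ x i
    Q⁻¹Q = apply-inverse Q⁻¹ Q (proj₂ (proj₂ Q-unimodular))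

    -- The equation PLQ = D in the form PL = DQ⁻¹, which makes `apply Q⁻¹ y` the coordinates of y in
    -- which divisibility of Ly can be read off entry by entry.
    PL : ∀ y j → apply P (apply L y) j ≡ + d j * apply Q⁻¹ y j
    PL y j = begin
      apply P (apply L y) j                          ≡⟨ apply-cong P (apply-cong L (sym ∘ QQ⁻¹ y)) j ⟩
      apply P (apply L (apply Q (apply Q⁻¹ y))) j    ≡⟨ apply-⊛ P L (apply Q (apply Q⁻¹ y)) j ⟨
      apply (P ⊛ L) (apply Q (apply Q⁻¹ y)) j        ≡⟨ apply-⊛ (P ⊛ L) Q (apply Q⁻¹ y) j ⟨
      apply (P ⊛ L ⊛ Q) (apply Q⁻¹ y) j              ≡⟨ apply-congˡ diagonalises (apply Q⁻¹ y) j ⟩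
      apply (diagonal d) (apply Q⁻¹ y) j             ≡⟨ apply-diagonal d (apply Q⁻¹ y) j ⟩
      + d j * apply Q⁻¹ y j                          ∎

    L-via-diagonal : ∀ y i → apply L y i ≡ apply P⁻¹ (λ j → + d j * apply Q⁻¹ y j) i
    L-via-diagonal y i = trans (sym (P⁻¹P (apply L y) i)) (apply-cong P⁻¹ (PL y) i)

    LQ : ∀ z i → apply L (apply Q z) i ≡ apply P⁻¹ (λ j → + d j * z j) i
    LQ z i = trans (L-via-diagonal (apply Q z) i) (apply-cong P⁻¹ (λ j → cong (+ d j *_) (Q⁻¹Q z j)) i)

  module LocalSmith {N} {L : Matrix N} (S : SmithNormalForm L) {ℓ} (ℓ-prime : Prime ℓ) where
    open SmithNormalForm S
    open Diagonalised S

    divisible : ℕ → Fin N → Bool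
    divisible i j = does (ℓ ℕ.^ i ℕ.∣? d j)

    -- Zero entries count for every i.
    c : ℕ → ℕ
    c i = # (divisible i)

    private
      -- The common core of both bounds on `c`. The equations are those of `G` and the vanishing of
      -- the Smith coordinates marked by `p`; if they are fewer than the unknowns, a primitive
      -- solution remains. The two bounds mark complementary sets of coordinates.
      prescribe : ∀ {k j} (p : Fin N → Bool) (F : (Fin k → ℤ) → Fin N → ℤ) → LinearMap F →
        (G : (Fin k → ℤ) → Fin j → ℤ) → LinearMap G → # p ℕ.+ j ℕ.< k →
        ∃ λ α → ¬ (∀ t → + ℓ ∣ α t) × (∀ t → G α t ≡ 0ℤ) × (∀ t → p t ≡ true → apply Q⁻¹ (F α) t ≡ 0ℤ)
      prescribe {k} {j} p F lin-F G lin-G small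
        with primitive-kernel H lin-H small ℓ (prime>1 ℓ-prime)
        where
        H′ : (Fin k → ℤ) → Fin (# p) ⊎ Fin j → ℤ
        H′ α (inj₁ t) = apply Q⁻¹ (F α) (enumerate p t)
        H′ α (inj₂ t) = G α t

        H : (Fin k → ℤ) → Fin (# p ℕ.+ j) → ℤ
        H α t = H′ α (splitAt (# p) t)

        lin-H : LinearMap H
        lin-H t with splitAt (# p) t
        ... | inj₁ t′ = lin-∘ (lin-apply Q⁻¹ (enumerate p t′)) lin-F
        ... | inj₂ t′ = lin-G t′
      ... | α , ∤α , Hα≡0 = α , ∤α , Gα≡0 , zα≡0
        where
        Gα≡0 : ∀ t → G α t ≡ 0ℤ
        Gα≡0 t with Hα≡0 (# p ↑ʳ t)
        ... | e rewrite Fin.splitAt-↑ʳ (# p) j t = e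

        zα≡0 : ∀ t → p t ≡ true → apply Q⁻¹ (F α) t ≡ 0ℤ
        zα≡0 t pt with enumerate-onto p t pt
        ... | t′ , refl with Hα≡0 (t′ ↑ˡ j)
        ...   | e rewrite Fin.splitAt-↑ˡ (# p) t′ j = e

    -- Otherwise some primitive α satisfies the equations and has coordinate 0 wherever ℓ^i divides
    -- `d`. At the other places ℓ^i divides the product of `d` and the coordinate but not `d`, so ℓ
    -- divides the coordinate. Then ℓ divides all coordinates, hence F α, hence α.
    c-lower : ∀ {k j} i (F : (Fin k → ℤ) → Fin N → ℤ) → LinearMap F →
              (G : (Fin k → ℤ) → Fin j → ℤ) → LinearMap G →
              (∀ α → (∀ t → G α t ≡ 0ℤ) → ∀ x → + (ℓ ℕ.^ i) ∣ apply L (F α) x) →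
              (∀ α → (∀ t → G α t ≡ 0ℤ) → (∀ x → + ℓ ∣ F α x) → ∀ t → + ℓ ∣ α t) →
              k ℕ.≤ c i ℕ.+ j
    c-lower i F lin-F G lin-G ℓⁱ∣LF F-independent = ℕ.≮⇒≥ λ small →
      let α , ∤α , Gα≡0 , zα≡0 = prescribe (divisible i) F lin-F G lin-G small
          ℓ∣z : ∀ j → + ℓ ∣ apply Q⁻¹ (F α) j
          ℓ∣z j = coordinate α (ℓⁱ∣LF α Gα≡0) zα≡0 j
      in ∤α (F-independent α Gα≡0 λ x → subst (+ ℓ ∣_) (QQ⁻¹ (F α) x) (∣-apply Q ℓ∣z x))
      where
      coordinate : ∀ α → (∀ x → + (ℓ ℕ.^ i) ∣ apply L (F α) x) →
                   (∀ t → divisible i t ≡ true → apply Q⁻¹ (F α) t ≡ 0ℤ) →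
                   ∀ j → + ℓ ∣ apply Q⁻¹ (F α) j
      coordinate α ∣LFα zα≡0 j with ℓ ℕ.^ i ℕ.∣? d j | zα≡0 j
      ... | yes _   | z≡0 = subst (+ ℓ ∣_) (sym (z≡0 refl)) (divides 0ℤ refl)
      ... | no  ∤dj | _   with ℓ ℕ.∣? ∣ apply Q⁻¹ (F α) j ∣
      ...   | yes ℓ∣z = ∣ᵤ⇒∣ ℓ∣z
      ...   | no  ℓ∤z = contradiction (cancel-prime-power ℓ-prime i ℓ∤z
                  (subst (ℓ ℕ.^ i ℕ.∣_) (ℤ.abs-* (+ d j) (apply Q⁻¹ (F α) j))
                    (∣⇒∣ᵤ (subst (+ (ℓ ℕ.^ i) ∣_) (PL (F α) j) (∣-apply P ∣LFα j))))) ∤dj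

    -- Dual to `c-lower`: now the coordinates vanish wherever ℓ^i does not divide `d`, so ℓ^i
    -- divides every product of entry and coordinate and therefore L(F α). By hypothesis ℓ then
    -- divides the primitive α.
    c-upper : ∀ {k j} i (F : (Fin k → ℤ) → Fin N → ℤ) → LinearMap F →
              (G : (Fin k → ℤ) → Fin j → ℤ) → LinearMap G →
              (∀ α → (∀ t → G α t ≡ 0ℤ) → (∀ x → + (ℓ ℕ.^ i) ∣ apply L (F α) x) → ∀ t → + ℓ ∣ α t) →
              k ℕ.+ c i ℕ.≤ N ℕ.+ j
    c-upper {k} {j} i F lin-F G lin-G ∣LF⇒∣α =
      subst (k ℕ.+ c i ℕ.≤_) total (ℕ.+-monoˡ-≤ (c i) bound)
      where
      other : ℕ
      other = # (not ∘ divisible i)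

      total : other ℕ.+ j ℕ.+ c i ≡ N ℕ.+ j
      total = begin
        other ℕ.+ j ℕ.+ c i    ≡⟨ ℕ.+-comm (other ℕ.+ j) (c i) ⟩
        c i ℕ.+ (other ℕ.+ j)  ≡⟨ ℕ.+-assoc (c i) other j ⟨
        c i ℕ.+ other ℕ.+ j    ≡⟨ cong (ℕ._+ j) (#-not (divisible i)) ⟩
        N ℕ.+ j                ∎

      bound : k ℕ.≤ other ℕ.+ j
      bound = ℕ.≮⇒≥ λ small →
        let α , ∤α , Gα≡0 , zα≡0 = prescribe (not ∘ divisible i) F lin-F G lin-G small
        in ∤α (∣LF⇒∣α α Gα≡0 λ x → subst (+ (ℓ ℕ.^ i) ∣_) (sym (L-via-diagonal (F α) x)) (∣-apply P⁻¹ (entry α zα≡0) x))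
        where
        entry : ∀ α → (∀ t → not (divisible i t) ≡ true → apply Q⁻¹ (F α) t ≡ 0ℤ) →
                ∀ t → + (ℓ ℕ.^ i) ∣ + d t * apply Q⁻¹ (F α) t
        entry α zα≡0 t with ℓ ℕ.^ i ℕ.∣? d t | zα≡0 t
        ... | yes ∣d | _   = ∣ᵤ⇒∣ (subst (ℓ ℕ.^ i ℕ.∣_) (sym (ℤ.abs-* (+ d t) (apply Q⁻¹ (F α) t))) (ℕ.∣m⇒∣m*n _ ∣d))
        ... | no  _  | z≡0 = divides 0ℤ (trans (cong (+ d t *_) (z≡0 refl)) (ℤ.*-zeroʳ (+ d t)))

-- Valuations, and multiplicities as differences of the counts.

module ElementaryDivisors where

  open LinearForms
  open SmithForms
  open import Data.List.Relation.Unary.All using (_∷_; [])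
  open import Data.Nat.Base
  open import Data.Nat.Properties
  open import Data.Nat.Divisibility
  open import Data.Nat.Induction using (<-wellFounded)
  open import Induction.WellFounded using (Acc; acc)
  open import Relation.Binary.Definitions using (tri<; tri≈; tri>)
  open import Relation.Binary.PropositionalEquality

  #-initial : ∀ {m} a → a ≤ m → # {m} (λ k → toℕ k <ᵇ a) ≡ a
  #-initial {zero}  zero    z≤n       = refl
  #-initial {suc m} zero    z≤n       = #-initial {m} zero z≤n
  #-initial {suc m} (suc a) (s≤s a≤m) = cong suc (#-initial a a≤m)

  #≡0 : ∀ {n} {p : Fin n → Bool} → # p ≡ 0 → ∀ i → p i ≡ false
  #≡0 {suc n} {p} e i with p zero in eq
  #≡0 {suc n} {p} e zero    | false = eq
  #≡0 {suc n} {p} e (suc i) | false = #≡0 e i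

  dec-⊕ : ∀ {a b c} {A : Set a} {B : Set b} {C : Set c} (A? : Dec A) (B? : Dec B) (C? : Dec C) →
          (A → ¬ B) → (A → C) → (B → C) → (C → A ⊎ B) → does A? ⊕ does B? ≡ᵇ does C?
  dec-⊕ (yes a) (yes b) C?      a⇒¬b _   _   _    = contradiction b (a⇒¬b a)
  dec-⊕ (yes a) (no ¬b) (yes c) _    _   _   _    = left
  dec-⊕ (yes a) (no ¬b) (no ¬c) _    a⇒c _   _    = contradiction (a⇒c a) ¬c
  dec-⊕ (no ¬a) (yes b) (yes c) _    _   _   _    = right
  dec-⊕ (no ¬a) (yes b) (no ¬c) _    _   b⇒c _    = contradiction (b⇒c b) ¬c
  dec-⊕ (no ¬a) (no ¬b) (yes c) _    _   _   c⇒ab = contradiction (c⇒ab c) [ ¬a , ¬b ]′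
  dec-⊕ (no ¬a) (no ¬b) (no ¬c) _    _   _   _    = neither

  module Valuation {ℓ} (ℓ-prime : Prime ℓ) where

    instance
      ℓ-nonZero : NonZero ℓ
      ℓ-nonZero = prime⇒nonZero ℓ-prime

    private
      ℓ>1 : 1 < ℓ
      ℓ>1 = prime>1 ℓ-prime

      ℓ∤1 : ¬ (ℓ ∣ 1)
      ℓ∤1 ℓ∣1 = <⇒≱ ℓ>1 (∣⇒≤ ℓ∣1)

    ∤-* : ∀ {m n} → ¬ (ℓ ∣ m) → ¬ (ℓ ∣ n) → ¬ (ℓ ∣ m * n)
    ∤-* {m} {n} ℓ∤m ℓ∤n ℓ∣mn = [ ℓ∤m , ℓ∤n ]′ (euclidsLemma m n ℓ-prime ℓ∣mn)

    ^-mono-∣ : ∀ {i j} → i ≤ j → ℓ ^ i ∣ ℓ ^ j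
    ^-mono-∣ {i} {j} i≤j = divides (ℓ ^ (j ∸ i)) (trans (cong (ℓ ^_) (sym (m∸n+n≡m i≤j))) (^-distribˡ-+-* ℓ (j ∸ i) i))

    private
      n<ℓ^n : ∀ n → n < ℓ ^ n
      n<ℓ^n zero    = ≤-refl
      n<ℓ^n (suc n) = begin-strict
        suc n        ≤⟨ n<ℓ^n n ⟩
        ℓ ^ n        <⟨ m<m*n (ℓ ^ n) ℓ {{m^n≢0 ℓ n}} ℓ>1 ⟩
        ℓ ^ n * ℓ    ≡⟨ *-comm (ℓ ^ n) ℓ ⟩
        ℓ ^ suc n    ∎
        where open ≤-Reasoning

      factor : ∀ m → m ≢ 0 → Acc _<_ m → ∃ λ a → ∃ λ m′ → m ≡ ℓ ^ a * m′ × ¬ (ℓ ∣ m′)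
      factor m m≢0 (acc rs) with ℓ ∣? m
      ... | no  ℓ∤m = 0 , m , sym (*-identityˡ m) , ℓ∤m
      ... | yes (divides k refl) with factor k k≢0 (rs (m<m*n k ℓ {{≢-nonZero k≢0}} ℓ>1))
        where
        k≢0 : k ≢ 0
        k≢0 refl = m≢0 refl
      ...   | a , m′ , refl , ℓ∤m′ = suc a , m′ , trans (*-comm (ℓ ^ a * m′) ℓ) (sym (*-assoc ℓ (ℓ ^ a) m′)) , ℓ∤m′

      ∣⇒≤ᶠ : ∀ i a {m′} → ¬ (ℓ ∣ m′) → ℓ ^ i ∣ ℓ ^ a * m′ → i ≤ a
      ∣⇒≤ᶠ i a {m′} ℓ∤m′ ℓⁱ∣ = ≮⇒≥ λ a<i → ℓ∤m′ (*-cancelˡ-∣ (ℓ ^ a) {{m^n≢0 ℓ a}}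
        (∣-trans (subst (_∣ ℓ ^ i) (*-comm ℓ (ℓ ^ a)) (^-mono-∣ a<i)) ℓⁱ∣))

    -- The exponents counted by `v` form an initial segment of length `a`, and all of it lies in the
    -- range of the count because a < ℓ^a ≤ m.
    v-unique : ∀ {m} a m′ → m ≢ 0 → m ≡ ℓ ^ a * m′ → ¬ (ℓ ∣ m′) → v ℓ m ≡ a
    v-unique {m} a m′ m≢0 m≡ ℓ∤m′ =
      trans (count-tabulate (λ k → ℓ ^ suc (toℕ k) ∣? m) {m} id)
            (trans (#-cong {m} {λ k → does (ℓ ^ suc (toℕ k) ∣? m)} (λ k → threshold (toℕ k)))
                   (#-initial {m} a a≤m))
      where
      threshold : ∀ k → does (ℓ ^ suc k ∣? m) ≡ does (k <? a)
      threshold k = does-⇔ (mk⇔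
        (λ ∣m → ∣⇒≤ᶠ (suc k) a ℓ∤m′ (subst (ℓ ^ suc k ∣_) m≡ ∣m))
        (λ k<a → ∣-trans (^-mono-∣ k<a) (subst (ℓ ^ a ∣_) (sym m≡) (m∣m*n m′)))) (ℓ ^ suc k ∣? m) (k <? a)

      a≤m : a ≤ m
      a≤m = ≤-trans (<⇒≤ (n<ℓ^n a)) (∣⇒≤ {{≢-nonZero m≢0}} (subst (ℓ ^ a ∣_) (sym m≡) (m∣m*n m′)))

    v-factor : ∀ {m} → m ≢ 0 → ∃ λ m′ → m ≡ ℓ ^ v ℓ m * m′ × ¬ (ℓ ∣ m′)
    v-factor {m} m≢0 with factor m m≢0 (<-wellFounded m)
    ... | a , m′ , m≡ , ℓ∤m′ = m′ , subst (λ a → m ≡ ℓ ^ a * m′) (sym (v-unique a m′ m≢0 m≡ ℓ∤m′)) m≡ , ℓ∤m′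

    ∣⇒≤v : ∀ i {m} → m ≢ 0 → ℓ ^ i ∣ m → i ≤ v ℓ m
    ∣⇒≤v i {m} m≢0 ∣m with v-factor m≢0
    ... | m′ , m≡ , ℓ∤m′ = ∣⇒≤ᶠ i (v ℓ m) ℓ∤m′ (subst (ℓ ^ i ∣_) m≡ ∣m)

    ≤v⇒∣ : ∀ {i m} → i ≤ v ℓ m → ℓ ^ i ∣ m
    -- Here `v ℓ 0` is the junk value 0; the claim survives because 0 is divisible by everything.
    ≤v⇒∣ {i} {zero}  _   = _ ∣0
    ≤v⇒∣ {i} {suc m} i≤v with v-factor {suc m} (λ ())
    ... | m′ , m≡ , _ = ∣-trans (^-mono-∣ i≤v) (subst (ℓ ^ v ℓ (suc m) ∣_) (sym m≡) (m∣m*n m′))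

    v-* : ∀ {m n} → m ≢ 0 → n ≢ 0 → v ℓ (m * n) ≡ v ℓ m + v ℓ n
    v-* {m} {n} m≢0 n≢0 with v-factor m≢0 | v-factor n≢0
    ... | m′ , m≡ , ℓ∤m′ | n′ , n≡ , ℓ∤n′ =
      v-unique (v ℓ m + v ℓ n) (m′ * n′) (λ e → [ m≢0 , n≢0 ]′ (m*n≡0⇒m≡0∨n≡0 m e)) mn≡ (∤-* ℓ∤m′ ℓ∤n′)
      where
      mn≡ : m * n ≡ ℓ ^ (v ℓ m + v ℓ n) * (m′ * n′)
      mn≡ = begin
        m * n                                      ≡⟨ cong₂ _*_ m≡ n≡ ⟩
        (ℓ ^ v ℓ m * m′) * (ℓ ^ v ℓ n * n′)        ≡⟨ [m*n]*[o*p]≡[m*o]*[n*p] (ℓ ^ v ℓ m) m′ (ℓ ^ v ℓ n) n′ ⟩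
        (ℓ ^ v ℓ m * ℓ ^ v ℓ n) * (m′ * n′)        ≡⟨ cong (_* (m′ * n′)) (^-distribˡ-+-* ℓ (v ℓ m) (v ℓ n)) ⟨
        ℓ ^ (v ℓ m + v ℓ n) * (m′ * n′)            ∎
        where open ≡-Reasoning

    v-cancel : ∀ {i j t} x → t ≢ 0 → v ℓ t + j ≤ i → ℓ ^ i ∣ t * x → ℓ ^ j ∣ x
    v-cancel {i} {j} {t} x t≢0 vt+j≤i ∣tx with v-factor t≢0
    ... | t′ , t≡ , ℓ∤t′ = cancel-prime-power ℓ-prime j ℓ∤t′ (*-cancelˡ-∣ (ℓ ^ v ℓ t) {{m^n≢0 ℓ (v ℓ t)}}
      (subst₂ _∣_ (^-distribˡ-+-* ℓ (v ℓ t) j) rearrange (∣-trans (^-mono-∣ vt+j≤i) ∣tx)))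
      where
      rearrange : t * x ≡ ℓ ^ v ℓ t * (x * t′)
      rearrange = begin
        t * x                      ≡⟨ cong (_* x) t≡ ⟩
        ℓ ^ v ℓ t * t′ * x         ≡⟨ *-assoc (ℓ ^ v ℓ t) t′ x ⟩
        ℓ ^ v ℓ t * (t′ * x)       ≡⟨ cong (ℓ ^ v ℓ t *_) (*-comm t′ x) ⟩
        ℓ ^ v ℓ t * (x * t′)       ∎
        where open ≡-Reasoning

    ∤⇒v≡0 : ∀ {m} → ¬ (ℓ ∣ m) → v ℓ m ≡ 0
    ∤⇒v≡0 {m} ℓ∤m = v-unique 0 m (λ { refl → ℓ∤m (ℓ ∣0) }) (sym (*-identityˡ m)) ℓ∤m

    ∣⇒v>0 : ∀ {m} → m ≢ 0 → ℓ ∣ m → 0 < v ℓ m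
    ∣⇒v>0 m≢0 ℓ∣m = ∣⇒≤v 1 m≢0 (subst (_∣ _) (sym (*-identityʳ ℓ)) ℓ∣m)

    v>0⇒∣ : ∀ {m} → 0 < v ℓ m → ℓ ∣ m
    v>0⇒∣ {m} v>0 = subst (_∣ m) (*-identityʳ ℓ) (≤v⇒∣ {1} {m} v>0)

  module Multiplicities {N} {L : Matrix N} (S : SmithNormalForm L) {ℓ} (ℓ-prime : Prime ℓ) where
    open SmithNormalForm S
    open LocalSmith S ℓ-prime
    open Valuation ℓ-prime

    private
      e : ℕ → ℕ
      e = multiplicity S ℓ

      exactly : ℕ → Fin N → Bool
      exactly i j = does (¬? (d j ≟ 0) ×-dec (v ℓ (d j) ≟ i))

      e≡# : ∀ i → e i ≡ # (exactly i)
      e≡# i = count-tabulate (λ j → ¬? (d j ≟ 0) ×-dec (v ℓ (d j) ≟ i)) id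

    -- A zero entry is counted in `c i` and in `c (suc i)`, so the difference sees only nonzero
    -- entries, in agreement with `multiplicity`.
    e-difference : ∀ i → e i + c (suc i) ≡ c i
    e-difference i = trans (cong (_+ c (suc i)) (e≡# i)) (#-disjoint pointwise)
      where
      pointwise : ∀ j → exactly i j ⊕ divisible (suc i) j ≡ᵇ divisible i j
      pointwise j = dec-⊕ (¬? (d j ≟ 0) ×-dec (v ℓ (d j) ≟ i)) (ℓ ^ suc i ∣? d j) (ℓ ^ i ∣? d j)
        (λ (d≢0 , v≡i) ∣d → 1+n≰n (subst (suc i ≤_) v≡i (∣⇒≤v (suc i) d≢0 ∣d)))
        (λ (_ , v≡i) → ≤v⇒∣ {i} {d j} (≤-reflexive (sym v≡i)))
        (∣-trans (^-mono-∣ (n≤1+n i)))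
        strict
        where
        strict : ℓ ^ i ∣ d j → (d j ≢ 0 × v ℓ (d j) ≡ i) ⊎ ℓ ^ suc i ∣ d j
        strict ∣d with d j ≟ 0 | v ℓ (d j) ≟ i
        ... | yes d≡0 | _       = inj₂ (subst (ℓ ^ suc i ∣_) (sym d≡0) (_ ∣0))
        ... | no  d≢0 | yes v≡i = inj₁ (d≢0 , v≡i)
        ... | no  d≢0 | no  v≢i = inj₂ (≤v⇒∣ (≤∧≢⇒< (∣⇒≤v i d≢0 ∣d) (v≢i ∘ sym)))

    c-0 : c 0 ≡ N
    c-0 = trans (#-cong (λ j → dec-true (ℓ ^ 0 ∣? d j) (1∣ d j))) (#-true N)

    private
      jump : ∀ {i x y z} → c i ≡ x → c (suc i) ≡ y → z + y ≡ x → e i ≡ z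
      jump {i} {x} {y} {z} ci≡x csi≡y z+y≡x = +-cancelʳ-≡ y (e i) z (begin
        e i + y            ≡⟨ cong (e i +_) csi≡y ⟨
        e i + c (suc i)    ≡⟨ e-difference i ⟩
        c i                ≡⟨ ci≡x ⟩
        x                  ≡⟨ z+y≡x ⟨
        z + y              ∎)
        where open ≡-Reasoning

    -- A staircase of counts turned into a list of multiplicities: each drop is the multiplicity of
    -- the last exponent before it. The final level 1 is the single zero entry, which belongs to the
    -- constant vectors in the kernel of L.
    one-step : ∀ {h C x y} → 0 < h → (∀ i → 0 < i → i ≤ h → c i ≡ C) → (∀ i → h < i → c i ≡ 1) →
               x + 1 ≡ C → y + C ≡ N → e IsExactly ((h , x) ∷ (0 , y) ∷ [])
    one-step {h} 0<h low high x+1≡C y+C≡N =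
      (jump (low h 0<h ≤-refl) (high (suc h) ≤-refl) x+1≡C ∷ jump c-0 (low 1 (s≤s z≤n) 0<h) y+C≡N ∷ []) , rest
      where
      rest : ∀ i → _ → e i ≡ 0
      rest i (i≢h ∷ i≢0 ∷ []) with <-cmp i h
      ... | tri< i<h _ _ = jump (low i (n≢0⇒n>0 i≢0) (<⇒≤ i<h)) (low (suc i) (s≤s z≤n) i<h) refl
      ... | tri≈ _ i≡h _ = contradiction i≡h i≢h
      ... | tri> _ _ h<i = jump (high i h<i) (high (suc i) (m<n⇒m<1+n h<i)) refl

    two-steps : ∀ {b h C₁ C₂ x y z} → 0 < b → b < h →
                (∀ i → 0 < i → i ≤ b → c i ≡ C₁) → (∀ i → b < i → i ≤ h → c i ≡ C₂) → (∀ i → h < i → c i ≡ 1) →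
                x + 1 ≡ C₂ → y + C₂ ≡ C₁ → z + C₁ ≡ N → e IsExactly ((h , x) ∷ (b , y) ∷ (0 , z) ∷ [])
    two-steps {b} {h} 0<b b<h low middle high x+1≡C₂ y+C₂≡C₁ z+C₁≡N =
      ( jump (middle h b<h ≤-refl) (high (suc h) ≤-refl) x+1≡C₂
      ∷ jump (low b 0<b ≤-refl) (middle (suc b) ≤-refl b<h) y+C₂≡C₁
      ∷ jump c-0 (low 1 (s≤s z≤n) 0<b) z+C₁≡N ∷ []) , rest
      where
      rest : ∀ i → _ → e i ≡ 0
      rest i (i≢h ∷ i≢b ∷ i≢0 ∷ []) with <-cmp i b | <-cmp i h
      ... | tri< i<b _ _ | _ = jump (low i (n≢0⇒n>0 i≢0) (<⇒≤ i<b)) (low (suc i) (s≤s z≤n) i<b) refl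
      ... | tri≈ _ i≡b _ | _ = contradiction i≡b i≢b
      ... | tri> _ _ b<i | tri< i<h _ _ = jump (middle i b<i (<⇒≤ i<h)) (middle (suc i) (m<n⇒m<1+n b<i) i<h) refl
      ... | tri> _ _ b<i | tri≈ _ i≡h _ = contradiction i≡h i≢h
      ... | tri> _ _ b<i | tri> _ _ h<i = jump (high i h<i) (high (suc i) (m<n⇒m<1+n h<i)) refl

    -- A nonzero entry divisible by ℓ would be counted by the multiplicity of its own valuation i >
    -- 0, but there `c` does not drop.
    entries-prime-to : (∀ i → 0 < i → c i ≡ 1) → ∀ j → d j ≢ 0 → ¬ (ℓ ∣ d j)
    entries-prime-to c≡1 j d≢0 ℓ∣d =
      contradiction (trans (sym (dec-true (¬? (d j ≟ 0) ×-dec (v ℓ (d j) ≟ v ℓ (d j))) (d≢0 , refl)))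
                           (#≡0 (trans (sym (e≡# (v ℓ (d j)))) (jump (c≡1 (v ℓ (d j)) pos) (c≡1 (suc (v ℓ (d j))) (s≤s z≤n)) refl)) j))
                    λ ()
      where
      pos : 0 < v ℓ (d j)
      pos = ∣⇒v>0 d≢0 ℓ∣d

-- Bounds on the counts from the incidence matrix of points and lines.

module IncidenceBounds where

  open LinearForms
  open SmithForms
  open ElementaryDivisors
  open import Data.Integer.Base using (+_; _+_; _*_; -_; _-_)
  open import Data.Integer.Divisibility.Signed
    using (_∣_; divides; ∣ᵤ⇒∣; ∣⇒∣ᵤ; ∣m∣n⇒∣m+n; ∣m∣n⇒∣m-n; ∣m⇒∣-m; ∣n⇒∣m*n; ∣m⇒∣m*n; ∣-trans)
  open import Data.Integer.Tactic.RingSolver using (solve-∀)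
  import Data.Nat.Properties as ℕ
  import Data.Nat.Divisibility as ℕ
  open import Relation.Binary.PropositionalEquality
    using (_≡_; _≢_; refl; sym; trans; cong; cong₂; subst; module ≡-Reasoning)
  open import Algebra.Properties.Semiring.Sum ℤ.+-*-semiring
    using (sum; sum-cong-≗; ∑-comm; *-distribˡ-sum; *-distribʳ-sum)
  open ≡-Reasoning
  open Linear

  sum-const : ∀ n a → sum {n} (λ _ → a) ≡ + n * a
  sum-const zero    a = sym (ℤ.*-zeroˡ a)
  sum-const (suc n) a = begin
    a + sum {n} (λ _ → a)    ≡⟨ cong (λ z → a + z) (sum-const n a) ⟩
    a + + n * a              ≡⟨ identity₁ a (+ n) ⟩
    (1ℤ + + n) * a           ≡⟨⟩
    + suc n * a              ∎
    where
    identity₁ : ∀ a n → a + n * a ≡ (1ℤ + n) * a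
    identity₁ = solve-∀

  sum-exchange : ∀ {k n} (M : Fin k → Fin n → ℤ) (x : Fin n → ℤ) →
                 sum (λ i → sum (λ j → M i j * x j)) ≡ sum (λ j → sum (λ i → M i j) * x j)
  sum-exchange M x = trans (∑-comm (λ i j → M i j * x j)) (sum-cong-≗ (λ j → sym (*-distribʳ-sum (x j) (λ i → M i j))))

  sum-exchange-* : ∀ {k n} (a : Fin k → ℤ) (M : Fin k → Fin n → ℤ) (x : Fin n → ℤ) →
                   sum (λ i → a i * sum (λ j → M i j * x j)) ≡ sum (λ j → sum (λ i → a i * M i j) * x j)
  sum-exchange-* a M x = trans
    (sum-cong-≗ (λ i → trans (*-distribˡ-sum (a i) (λ j → M i j * x j))
                             (sum-cong-≗ (λ j → sym (ℤ.*-assoc (a i) (M i j) (x j))))))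
    (sum-exchange (λ i j → a i * M i j) x)

  sum-identity : ∀ {n} (i : Fin n) (f : Fin n → ℤ) → sum (λ j → identity i j * f j) ≡ f i
  sum-identity i f = trans (apply-diagonal (λ _ → 1) f i) (ℤ.*-identityˡ (f i))

  identity-sym : ∀ {n} (i j : Fin n) → identity i j ≡ identity j i
  identity-sym i j with i Fin.≟ j
  ... | yes refl = sym (diagonal-≡ (λ _ → 1) i)
  ... | no  i≢j  = sym (diagonal-≢ (λ _ → 1) (i≢j ∘ sym))

  lin-id : ∀ {k} → LinearMap {k} id
  lin-id = lin-proj

  axpy : ∀ {k} {φ : (Fin k → ℤ) → ℤ} → Linear φ → ∀ x c y → φ (λ i → x i + c * y i) ≡ φ x + c * φ y
  axpy {φ = φ} Φ x c y = begin
    φ (λ i → x i + c * y i)          ≡⟨ Φ .≗-cong (λ i → cong (_+ c * y i) (sym (ℤ.*-identityˡ (x i)))) ⟩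
    φ (λ i → 1ℤ * x i + c * y i)     ≡⟨ Φ .homo 1ℤ c x y ⟩
    1ℤ * φ x + c * φ y               ≡⟨ cong (_+ c * φ y) (ℤ.*-identityˡ (φ x)) ⟩
    φ x + c * φ y                    ∎

  lin-zero : ∀ {k} {φ : (Fin k → ℤ) → ℤ} → Linear φ → φ (λ _ → 0ℤ) ≡ 0ℤ
  lin-zero {φ = φ} Φ = trans (scale Φ 0ℤ (λ _ → 0ℤ)) (ℤ.*-zeroˡ (φ (λ _ → 0ℤ)))

  sum-linear : ∀ {k} → Linear {k} sum
  sum-linear = lin-sum lin-proj

  ∣-zero : ∀ {k} → k ∣ 0ℤ
  ∣-zero = divides 0ℤ refl

  -- B is the incidence matrix of points against lines, q + 1 the number of
  -- points on a line and R the number of lines through a point.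
  module Incidence {m′ N : ℕ} (B : Fin (suc m′) → Fin N → ℤ) (L : Matrix N) (q R s : ℤ)
    (points-on-line : ∀ l → sum (λ p → B p l) ≡ q + 1ℤ)
    (lines-through : ∀ p → sum (λ l → B p l) ≡ R)
    (joining-lines : ∀ p p′ → sum (λ l → B p l * B p′ l) ≡ 1ℤ + (R - 1ℤ) * identity p p′)
    (L-entries : ∀ l l′ → L l l′ ≡ sum (λ p → B p l * B p l′) - 1ℤ + s * identity l l′)
    (line-count : + N ≡ s + (q + 1ℤ) * R)
    (q+1≢0 : q + 1ℤ ≢ 0ℤ)
    (l₀ : Fin N)
    where

    m : ℕ
    m = suc m′

    -- On weights of sum 0, BBᵀ acts as `u`, and L acts as `r` on their images under Bᵀ. In the
    -- geometry `ρ` = q²[n-3] and `θ` = q([n-1] - (q + 2)).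
    u r ρ θ : ℤ
    u = R - 1ℤ
    r = u + s
    ρ = R - (q + 1ℤ)
    θ = + m - (q + 1ℤ) * (q + 1ℤ)

    B· : (Fin N → ℤ) → Fin m → ℤ
    B· y p = sum (λ l → B p l * y l)

    Bᵀ : (Fin m → ℤ) → Fin N → ℤ
    Bᵀ w l = sum (λ p → B p l * w p)

    lin-B : LinearMap B·
    lin-B p = lin-sum (λ l → lin-* (B p l) (lin-proj l))

    lin-Bᵀ : LinearMap Bᵀ
    lin-Bᵀ l = lin-sum (λ p → lin-* (B p l) (lin-proj p))

    sum-B : ∀ y → sum (B· y) ≡ (q + 1ℤ) * sum y
    sum-B y = begin
      sum (B· y)                              ≡⟨ sum-exchange B y ⟩
      sum (λ l → sum (λ p → B p l) * y l)     ≡⟨ sum-cong-≗ (λ l → cong (_* y l) (points-on-line l)) ⟩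
      sum (λ l → (q + 1ℤ) * y l)              ≡⟨ *-distribˡ-sum (q + 1ℤ) y ⟨
      (q + 1ℤ) * sum y                        ∎

    sum-Bᵀ : ∀ w → sum (Bᵀ w) ≡ R * sum w
    sum-Bᵀ w = begin
      sum (Bᵀ w)                              ≡⟨ sum-exchange (λ l p → B p l) w ⟩
      sum (λ p → sum (λ l → B p l) * w p)     ≡⟨ sum-cong-≗ (λ p → cong (_* w p) (lines-through p)) ⟩
      sum (λ p → R * w p)                     ≡⟨ *-distribˡ-sum R w ⟨
      R * sum w                               ∎

    B-const : ∀ a p → B· (λ _ → a) p ≡ R * a
    B-const a p = trans (sym (*-distribʳ-sum a (B p))) (cong (_* a) (lines-through p))

    Bᵀ-const : ∀ a l → Bᵀ (λ _ → a) l ≡ (q + 1ℤ) * a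
    Bᵀ-const a l = trans (sym (*-distribʳ-sum a (λ p → B p l))) (cong (_* a) (points-on-line l))

    B-line : ∀ p l → B· (identity l) p ≡ B p l
    B-line p l = trans (sum-cong-≗ (λ l′ → ℤ.*-comm (B p l′) (identity l l′))) (sum-identity l (B p))

    sum-line : ∀ {n} (i : Fin n) → sum (identity i) ≡ 1ℤ
    sum-line i = trans (sum-cong-≗ (λ j → sym (ℤ.*-identityʳ (identity i j)))) (sum-identity i (λ _ → 1ℤ))

    BBᵀ : ∀ w p → B· (Bᵀ w) p ≡ u * w p + sum w
    BBᵀ w p = begin
      B· (Bᵀ w) p                                               ≡⟨ sum-exchange-* (B p) (λ l p′ → B p′ l) w ⟩
      sum (λ p′ → sum (λ l → B p l * B p′ l) * w p′)            ≡⟨ sum-cong-≗ (λ p′ → cong (_* w p′) (joining-lines p p′)) ⟩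
      sum (λ p′ → (1ℤ + u * identity p p′) * w p′)              ≡⟨ sum-cong-≗ (λ p′ → expand u (identity p p′) (w p′)) ⟩
      sum (λ p′ → w p′ + u * (identity p p′ * w p′))            ≡⟨ axpy sum-linear w u (λ p′ → identity p p′ * w p′) ⟩
      sum w + u * sum (λ p′ → identity p p′ * w p′)             ≡⟨ cong (λ z → sum w + u * z) (sum-identity p w) ⟩
      sum w + u * w p                                           ≡⟨ ℤ.+-comm (sum w) (u * w p) ⟩
      u * w p + sum w                                           ∎
      where
      expand : ∀ u a x → (1ℤ + u * a) * x ≡ x + u * (a * x)
      expand = solve-∀

    L-apply : ∀ y l → apply L y l ≡ Bᵀ (B· y) l - sum y + s * y l
    L-apply y l = begin
      sum (λ l′ → L l l′ * y l′)
        ≡⟨ sum-cong-≗ (λ l′ → trans (cong (_* y l′) (L-entries l l′))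
             (expand (sum (λ p → B p l * B p l′)) s (identity l l′) (y l′))) ⟩
      sum (λ l′ → (sum (λ p → B p l * B p l′) * y l′ + - 1ℤ * y l′) + s * (identity l l′ * y l′))
        ≡⟨ axpy sum-linear (λ l′ → sum (λ p → B p l * B p l′) * y l′ + - 1ℤ * y l′) s (λ l′ → identity l l′ * y l′) ⟩
      sum (λ l′ → sum (λ p → B p l * B p l′) * y l′ + - 1ℤ * y l′) + s * sum (λ l′ → identity l l′ * y l′)
        ≡⟨ cong₂ (λ a b → a + s * b) (axpy sum-linear (λ l′ → sum (λ p → B p l * B p l′) * y l′) (- 1ℤ) y) (sum-identity l y) ⟩
      (sum (λ l′ → sum (λ p → B p l * B p l′) * y l′) + - 1ℤ * sum y) + s * y l
        ≡⟨ cong₂ (λ a b → a + b + s * y l) (sym (sum-exchange-* (λ p → B p l) B y)) (negate (sum y)) ⟩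
      Bᵀ (B· y) l - sum y + s * y l    ∎
      where
      expand : ∀ a s e y → (a - 1ℤ + s * e) * y ≡ (a * y + - 1ℤ * y) + s * (e * y)
      expand = solve-∀
      negate : ∀ a → - 1ℤ * a ≡ - a
      negate = solve-∀

    -- The row sums are (q + 1)R - N + s, and `line-count` is exactly the condition that they
    -- vanish.
    L-const : ∀ a l → apply L (λ _ → a) l ≡ 0ℤ
    L-const a l = begin
      apply L (λ _ → a) l                                   ≡⟨ L-apply (λ _ → a) l ⟩
      Bᵀ (B· (λ _ → a)) l - sum {N} (λ _ → a) + s * a
        ≡⟨ cong₂ (λ x y → x - y + s * a)
             (trans (lin-Bᵀ l .≗-cong (B-const a)) (Bᵀ-const (R * a) l))
             (trans (sum-const N a) (cong (_* a) line-count)) ⟩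
      (q + 1ℤ) * (R * a) - (s + (q + 1ℤ) * R) * a + s * a   ≡⟨ cancels q R s a ⟩
      0ℤ                                                    ∎
      where
      cancels : ∀ q R s a → (q + 1ℤ) * (R * a) - (s + (q + 1ℤ) * R) * a + s * a ≡ 0ℤ
      cancels = solve-∀

    Bᵀ-shift : ∀ v a l → Bᵀ v l ≡ (q + 1ℤ) * a + Bᵀ (λ p → v p - a) l
    Bᵀ-shift v a l = begin
      Bᵀ v l                                              ≡⟨ lin-Bᵀ l .≗-cong (λ p → split (v p) a) ⟩
      Bᵀ (λ p → (v p - a) + 1ℤ * a) l                     ≡⟨ axpy (lin-Bᵀ l) (λ p → v p - a) 1ℤ (λ _ → a) ⟩
      Bᵀ (λ p → v p - a) l + 1ℤ * Bᵀ (λ _ → a) l          ≡⟨ cong (λ z → Bᵀ (λ p → v p - a) l + 1ℤ * z) (Bᵀ-const a l) ⟩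
      Bᵀ (λ p → v p - a) l + 1ℤ * ((q + 1ℤ) * a)          ≡⟨ swap (Bᵀ (λ p → v p - a) l) ((q + 1ℤ) * a) ⟩
      (q + 1ℤ) * a + Bᵀ (λ p → v p - a) l                 ∎
      where
      split : ∀ v a → v ≡ (v - a) + 1ℤ * a
      split = solve-∀
      swap : ∀ x y → x + 1ℤ * y ≡ y + x
      swap = solve-∀

    sum-shift : ∀ (v : Fin m → ℤ) a → sum v ≡ + m * a + sum (λ p → v p - a)
    sum-shift v a = begin
      sum v                                                 ≡⟨ sum-cong-≗ (λ p → split (v p) a) ⟩
      sum (λ p → (v p - a) + 1ℤ * a)                        ≡⟨ axpy sum-linear (λ p → v p - a) 1ℤ (λ _ → a) ⟩
      sum (λ p → v p - a) + 1ℤ * sum {m} (λ _ → a)          ≡⟨ cong (λ z → sum (λ p → v p - a) + 1ℤ * z) (sum-const m a) ⟩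
      sum (λ p → v p - a) + 1ℤ * (+ m * a)                  ≡⟨ swap (sum (λ p → v p - a)) (+ m * a) ⟩
      + m * a + sum (λ p → v p - a)                         ∎
      where
      split : ∀ v a → v ≡ (v - a) + 1ℤ * a
      split = solve-∀
      swap : ∀ x y → x + 1ℤ * y ≡ y + x
      swap = solve-∀

    -- The sum of y enters twice: BBᵀ produces the sum of By, which is q + 1 times that of y, and BJ
    -- produces it R times. The difference is `ρ`; the same cancellation gives `LBᵀ`.
    BL : ∀ y p → B· (apply L y) p ≡ r * B· y p - ρ * sum y
    BL y p = begin
      B· (apply L y) p
        ≡⟨ lin-B p .≗-cong (λ l → trans (L-apply y l) (regroup (Bᵀ (B· y) l) (sum y) (s * y l))) ⟩
      B· (λ l → (Bᵀ (B· y) l + s * y l) + - 1ℤ * sum y) p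
        ≡⟨ axpy (lin-B p) (λ l → Bᵀ (B· y) l + s * y l) (- 1ℤ) (λ _ → sum y) ⟩
      B· (λ l → Bᵀ (B· y) l + s * y l) p + - 1ℤ * B· (λ _ → sum y) p
        ≡⟨ cong₂ (λ a b → a + - 1ℤ * b) (axpy (lin-B p) (Bᵀ (B· y)) s y) (B-const (sum y) p) ⟩
      (B· (Bᵀ (B· y)) p + s * B· y p) + - 1ℤ * (R * sum y)
        ≡⟨ cong (λ a → (a + s * B· y p) + - 1ℤ * (R * sum y))
             (trans (BBᵀ (B· y) p) (cong (λ z → u * B· y p + z) (sum-B y))) ⟩
      ((u * B· y p + (q + 1ℤ) * sum y) + s * B· y p) + - 1ℤ * (R * sum y)
        ≡⟨ collect u s q R (B· y p) (sum y) ⟩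
      r * B· y p - ρ * sum y    ∎
      where
      regroup : ∀ a b c → a - b + c ≡ (a + c) + - 1ℤ * b
      regroup = solve-∀
      collect : ∀ u s q R v c → ((u * v + (q + 1ℤ) * c) + s * v) + - 1ℤ * (R * c) ≡ (u + s) * v - (R - (q + 1ℤ)) * c
      collect = solve-∀

    LBᵀ : ∀ w l → apply L (Bᵀ w) l ≡ r * Bᵀ w l - ρ * sum w
    LBᵀ w l = begin
      apply L (Bᵀ w) l                                        ≡⟨ L-apply (Bᵀ w) l ⟩
      Bᵀ (B· (Bᵀ w)) l - sum (Bᵀ w) + s * Bᵀ w l
        ≡⟨ cong₂ (λ a b → a - b + s * Bᵀ w l) inner (sum-Bᵀ w) ⟩
      ((q + 1ℤ) * sum w + u * Bᵀ w l) - R * sum w + s * Bᵀ w l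
        ≡⟨ collect u s q R (Bᵀ w l) (sum w) ⟩
      r * Bᵀ w l - ρ * sum w                                  ∎
      where
      inner : Bᵀ (B· (Bᵀ w)) l ≡ (q + 1ℤ) * sum w + u * Bᵀ w l
      inner = begin
        Bᵀ (B· (Bᵀ w)) l                            ≡⟨ lin-Bᵀ l .≗-cong (λ p → trans (BBᵀ w p) (ℤ.+-comm (u * w p) (sum w))) ⟩
        Bᵀ (λ p → sum w + u * w p) l                ≡⟨ axpy (lin-Bᵀ l) (λ _ → sum w) u w ⟩
        Bᵀ (λ _ → sum w) l + u * Bᵀ w l             ≡⟨ cong (_+ u * Bᵀ w l) (Bᵀ-const (sum w) l) ⟩
        (q + 1ℤ) * sum w + u * Bᵀ w l               ∎
      collect : ∀ u s q R a b → ((q + 1ℤ) * b + u * a) - R * b + s * a ≡ (u + s) * a - (R - (q + 1ℤ)) * b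
      collect = solve-∀

    -- Comparing By with a constant vector splits Ly into a part independent of the line, a
    -- correction from B y - a, and sy. Once the correction is under control, differences of Ly
    -- determine sy.
    L-shift : ∀ y a l → apply L y l ≡ ((q + 1ℤ) * a - sum y) + Bᵀ (λ p → B· y p - a) l + s * y l
    L-shift y a l = trans (L-apply y l)
      (trans (cong (λ z → z - sum y + s * y l) (Bᵀ-shift (B· y) a l))
             (regroup ((q + 1ℤ) * a) (Bᵀ (λ p → B· y p - a) l) (sum y) (s * y l)))
      where
      regroup : ∀ a b c d → a + b - c + d ≡ (a - c) + b + d
      regroup = solve-∀

    -- The sum of By is evaluated twice, as (q + 1) sum y and as `m` times a plus the deviations
    -- from a. This is the only constraint on a vector a that is nearly the value of By, and the
    -- origin of `θ`.
    θ-shift : ∀ y a → θ * a ≡ (q + 1ℤ) * (sum y - (q + 1ℤ) * a) - sum (λ p → B· y p - a)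
    θ-shift y a = begin
      θ * a                                              ≡⟨ expand (+ m) q a (sum (λ p → B· y p - a)) ⟩
      (+ m * a + sum (λ p → B· y p - a)) - sum (λ p → B· y p - a) - (q + 1ℤ) * (q + 1ℤ) * a
        ≡⟨ cong (λ z → z - sum (λ p → B· y p - a) - (q + 1ℤ) * (q + 1ℤ) * a)
             (trans (sym (sum-shift (B· y) a)) (sum-B y)) ⟩
      (q + 1ℤ) * sum y - sum (λ p → B· y p - a) - (q + 1ℤ) * (q + 1ℤ) * a
        ≡⟨ collect q a (sum y) (sum (λ p → B· y p - a)) ⟩
      (q + 1ℤ) * (sum y - (q + 1ℤ) * a) - sum (λ p → B· y p - a)    ∎
      where
      expand : ∀ m q a e → (m - (q + 1ℤ) * (q + 1ℤ)) * a ≡ (m * a + e) - e - (q + 1ℤ) * (q + 1ℤ) * a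
      expand = solve-∀
      collect : ∀ q a y e → (q + 1ℤ) * y - e - (q + 1ℤ) * (q + 1ℤ) * a ≡ (q + 1ℤ) * (y - (q + 1ℤ) * a) - e
      collect = solve-∀

    -- The factor q + 1 is cancelled in ℤ, which remains possible when ℓ divides q + 1. Exact
    -- equations pay off here.
    sum-zero-of-B-zero : ∀ {y} → sum (B· y) ≡ 0ℤ → sum y ≡ 0ℤ
    sum-zero-of-B-zero {y} e with ℤ.i*j≡0⇒i≡0∨j≡0 (q + 1ℤ) (trans (sym (sum-B y)) e)
    ... | inj₁ q+1≡0 = contradiction q+1≡0 q+1≢0
    ... | inj₂ e′    = e′

    ∣-Bᵀ : ∀ {k w} → (∀ p → k ∣ w p) → ∀ l → k ∣ Bᵀ w l
    ∣-Bᵀ k∣w l = ∣-sum (λ p → ∣n⇒∣m*n (B p l) (k∣w p))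

    ∣-B : ∀ {k y} → (∀ l → k ∣ y l) → ∀ p → k ∣ B· y p
    ∣-B k∣y p = ∣-sum (λ l → ∣n⇒∣m*n (B p l) (k∣y l))

    module Bounds (S : SmithNormalForm L) {ℓ} (ℓ-prime : Prime ℓ) where
      open LocalSmith S ℓ-prime
      open Valuation ℓ-prime using (^-mono-∣)

      infix 10 ℓ^_
      ℓ^_ : ℕ → ℤ
      ℓ^ i = + (ℓ ℕ.^ i)

      -- A bound on the valuation of t in the form in which it is applied; for k = ℓ^j it follows
      -- from v(t) + j ≤ i when t is not 0.
      Cancels : ℤ → ℕ → ℤ → Set
      Cancels t i k = ∀ x → ℓ^ i ∣ t * x → k ∣ x

      private
        ∣-≡ : ∀ {k a b} → a ≡ b → k ∣ a → k ∣ b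
        ∣-≡ {k} = subst (k ∣_)

        ℓ∣ℓ^ : ∀ {i} → 0 ℕ.< i → + ℓ ∣ ℓ^ i
        ℓ∣ℓ^ {suc i} _ = ∣ᵤ⇒∣ (ℕ.m∣m*n (ℓ ℕ.^ i))

        ∣^-mono : ∀ {i j x} → j ℕ.≤ i → ℓ^ i ∣ x → ℓ^ j ∣ x
        ∣^-mono {i} {j} j≤i = ∣-trans (∣ᵤ⇒∣ {ℓ^ j} {ℓ^ i} (^-mono-∣ j≤i))

        none : ∀ {k} → (Fin k → ℤ) → Fin 0 → ℤ
        none _ ()

      unit-cancels : ∀ {t} → ¬ (+ ℓ ∣ t) → ∀ i → Cancels t i (ℓ^ i)
      unit-cancels {t} ℓ∤t i x ∣tx = ∣ᵤ⇒∣ (cancel-prime-power ℓ-prime i (λ ℓ∣t → ℓ∤t (∣ᵤ⇒∣ ℓ∣t))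
        (subst (ℓ ℕ.^ i ℕ.∣_) (trans (ℤ.abs-* t x) (ℕ.*-comm ℤ.∣ t ∣ ℤ.∣ x ∣)) (∣⇒∣ᵤ ∣tx)))

      unit-cancels₁ : ∀ {t} → ¬ (+ ℓ ∣ t) → ∀ x → + ℓ ∣ t * x → + ℓ ∣ x
      unit-cancels₁ {t} ℓ∤t x ∣tx with euclidsLemma ℤ.∣ t ∣ ℤ.∣ x ∣ ℓ-prime (subst (ℓ ℕ.∣_) (ℤ.abs-* t x) (∣⇒∣ᵤ ∣tx))
      ... | inj₁ ℓ∣t = contradiction (∣ᵤ⇒∣ ℓ∣t) ℓ∤t
      ... | inj₂ ℓ∣x = ∣ᵤ⇒∣ ℓ∣x

      c-upper-id : ∀ {j} i (G : (Fin N → ℤ) → Fin j → ℤ) → LinearMap G →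
                   (∀ y → (∀ t → G y t ≡ 0ℤ) → (∀ l → ℓ^ i ∣ apply L y l) → ∀ l → + ℓ ∣ y l) → c i ℕ.≤ j
      c-upper-id i G lin-G h = ℕ.+-cancelˡ-≤ N _ _ (c-upper i id lin-id G lin-G h)

      c-lower-id : ∀ {j} i (G : (Fin N → ℤ) → Fin j → ℤ) → LinearMap G →
                   (∀ y → (∀ t → G y t ≡ 0ℤ) → ∀ l → ℓ^ i ∣ apply L y l) → N ℕ.≤ c i ℕ.+ j
      c-lower-id i G lin-G h = c-lower i id lin-id G lin-G h (λ _ _ ∣y → ∣y)

      c≥1 : ∀ i → 1 ℕ.≤ c i
      c≥1 i = subst (1 ℕ.≤_) (ℕ.+-identityʳ (c i))
        (c-lower {1} i (λ α _ → α zero) (λ _ → lin-proj zero) none (λ ())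
          (λ α _ l → ∣-≡ (sym (L-const (α zero) l)) ∣-zero)
          (λ { α _ ∣α zero → ∣α l₀ }))


      -- The one equation removes the constants. The differences of BLy between points are r times
      -- those of By, so By is constant modulo ℓ^j. Then the differences of Ly between lines leave
      -- only sy.
      c≤1 : ∀ {i j} → j ℕ.≤ i → Cancels r i (ℓ^ j) → Cancels s j (+ ℓ) → c i ℕ.≤ 1
      c≤1 {i} {j} j≤i r-cancels s-cancels = c-upper-id i (λ y (_ : Fin 1) → y l₀) (λ _ → lin-proj l₀) small
        where
        small : ∀ y → (∀ t → y l₀ ≡ 0ℤ) → (∀ l → ℓ^ i ∣ apply L y l) → ∀ l → + ℓ ∣ y l
        small y yl₀≡0 ∣Ly l = s-cancels (y l) (∣-≡ combine
          (∣m∣n⇒∣m-n (∣m∣n⇒∣m-n (∣^-mono j≤i (∣Ly l)) (∣^-mono j≤i (∣Ly l₀)))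
                     (∣m∣n⇒∣m-n (∣-Bᵀ ∣e l) (∣-Bᵀ ∣e l₀))))
          where
          w : ℤ
          w = B· y zero

          e : Fin m → ℤ
          e p = B· y p - w

          ∣e : ∀ p → ℓ^ j ∣ e p
          ∣e p = r-cancels (e p) (∣-≡
            (trans (cong₂ _-_ (BL y p) (BL y zero)) (factor r ρ (B· y p) w (sum y)))
            (∣m∣n⇒∣m-n (∣-B ∣Ly p) (∣-B ∣Ly zero)))
            where
            factor : ∀ r ρ v w σ → (r * v - ρ * σ) - (r * w - ρ * σ) ≡ r * (v - w)
            factor = solve-∀

          combine : (apply L y l - apply L y l₀) - (Bᵀ e l - Bᵀ e l₀) ≡ s * y l
          combine = trans
            (cong₂ (λ x z → (x - z) - (Bᵀ e l - Bᵀ e l₀)) (L-shift y w l)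
                   (trans (L-shift y w l₀) (cong (λ z → ((q + 1ℤ) * w - sum y) + Bᵀ e l₀ + s * z) (yl₀≡0 zero))))
            (simplify ((q + 1ℤ) * w - sum y) (Bᵀ e l) (Bᵀ e l₀) s (y l))
            where
            simplify : ∀ k a b s y → ((k + a + s * y) - (k + b + s * 0ℤ)) - (a - b) ≡ s * y
            simplify = solve-∀

      -- Modulo ℓ^i the number r equals the unit `u`, so the differences of BLy show that By is
      -- constant. Evaluating Ly at `l₀` then relates that constant to the sum of y, and `θ-shift`
      -- turns the relation into a condition on the constant alone.
      flat : ∀ i → ℓ^ i ∣ s → ¬ (+ ℓ ∣ u) → ∀ y → (∀ l → ℓ^ i ∣ apply L y l) →
             (∀ p → ℓ^ i ∣ B· y p - B· y zero) ×
             ℓ^ i ∣ (q + 1ℤ) * B· y zero - sum y ×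
             ℓ^ i ∣ θ * B· y zero
      flat i ∣s ℓ∤u y ∣Ly = ∣e , ∣w , ∣θw
        where
        w : ℤ
        w = B· y zero

        e : Fin m → ℤ
        e p = B· y p - w

        ∣e : ∀ p → ℓ^ i ∣ e p
        ∣e p = unit-cancels ℓ∤u i (e p) (∣-≡
          (trans (cong₂ (λ a b → a - b - s * e p) (BL y p) (BL y zero)) (factor u s ρ (B· y p) w (sum y)))
          (∣m∣n⇒∣m-n (∣m∣n⇒∣m-n (∣-B ∣Ly p) (∣-B ∣Ly zero)) (∣m⇒∣m*n (e p) ∣s)))
          where
          factor : ∀ u s ρ v w σ → ((u + s) * v - ρ * σ) - ((u + s) * w - ρ * σ) - s * (v - w) ≡ u * (v - w)
          factor = solve-∀

        ∣w : ℓ^ i ∣ (q + 1ℤ) * w - sum y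
        ∣w = ∣-≡
          (trans (cong (λ z → z - Bᵀ e l₀ - s * y l₀) (L-shift y w l₀)) (drop ((q + 1ℤ) * w - sum y) (Bᵀ e l₀) (s * y l₀)))
          (∣m∣n⇒∣m-n (∣m∣n⇒∣m-n (∣Ly l₀) (∣-Bᵀ ∣e l₀)) (∣m⇒∣m*n (y l₀) ∣s))
          where
          drop : ∀ a b c → a + b + c - b - c ≡ a
          drop = solve-∀

        ∣θw : ℓ^ i ∣ θ * w
        ∣θw = ∣-≡ (sym (trans (θ-shift y w) (flip (q + 1ℤ) (sum y) ((q + 1ℤ) * w) (sum e))))
          (∣m∣n⇒∣m-n (∣n⇒∣m*n (- (q + 1ℤ)) ∣w) (∣-sum ∣e))
          where
          flip : ∀ k a b c → k * (a - b) - c ≡ - k * (b - a) - c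
          flip = solve-∀

      private
        Bᵀ-of-zero : ∀ {v} → (∀ p → v p ≡ 0ℤ) → ∀ l → Bᵀ v l ≡ 0ℤ
        Bᵀ-of-zero v≡0 l = trans (lin-Bᵀ l .≗-cong v≡0) (lin-zero (lin-Bᵀ l))

        L-on-kernel : ∀ y → (∀ p → B· y p ≡ 0ℤ) → ∀ l → apply L y l ≡ s * y l
        L-on-kernel y v≡0 l = trans (L-apply y l)
          (trans (cong₂ (λ a b → a - b + s * y l) (Bᵀ-of-zero v≡0 l) (sum-zero-of-B-zero (sum-zero v≡0)))
                 (ℤ.+-identityˡ (s * y l)))

      N≤c+m : ∀ {i} → ℓ^ i ∣ s → N ℕ.≤ c i ℕ.+ m
      N≤c+m {i} ∣s = c-lower-id i B· lin-B (λ y v≡0 l → ∣-≡ (sym (L-on-kernel y v≡0 l)) (∣m⇒∣m*n (y l) ∣s))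

      -- Compared with ker B one equation is saved by letting By be any constant w. Then Ly = sy - e
      -- with (q + 1)e = θw. The hypothesis has this form because it must serve both for q + 1 prime
      -- to ℓ, where ℓ^i ∣ θ is enough, and for ℓ ∣ q + 1, where θ is first divided by q + 1.
      N≤c+m-1 : ∀ {i} → ℓ^ i ∣ s → (∀ w e → (q + 1ℤ) * e ≡ θ * w → ℓ^ i ∣ e) → N ℕ.≤ c i ℕ.+ m′
      N≤c+m-1 {i} ∣s θ-divides = c-lower-id i (λ y t → B· y (suc t) - B· y zero) (λ t → lin-- (lin-B (suc t)) (lin-B zero))
        λ y v-const l → ∣-≡ (sym (value y v-const l))
          (∣m∣n⇒∣m-n (∣m⇒∣m*n (y l) ∣s) (θ-divides (B· y zero) (sum y - (q + 1ℤ) * B· y zero) (sym (error y v-const))))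
        where
        e≡0 : ∀ y → (∀ t → B· y (suc t) - B· y zero ≡ 0ℤ) → ∀ p → B· y p - B· y zero ≡ 0ℤ
        e≡0 y v-const zero    = ℤ.+-inverseʳ (B· y zero)
        e≡0 y v-const (suc t) = v-const t

        error : ∀ y → (∀ t → B· y (suc t) - B· y zero ≡ 0ℤ) →
                θ * B· y zero ≡ (q + 1ℤ) * (sum y - (q + 1ℤ) * B· y zero)
        error y v-const = trans (θ-shift y (B· y zero))
          (trans (cong (λ z → (q + 1ℤ) * (sum y - (q + 1ℤ) * B· y zero) - z) (sum-zero (e≡0 y v-const)))
                 (ℤ.+-identityʳ _))

        value : ∀ y → (∀ t → B· y (suc t) - B· y zero ≡ 0ℤ) → ∀ l →
                apply L y l ≡ s * y l - (sum y - (q + 1ℤ) * B· y zero)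
        value y v-const l = trans (L-shift y (B· y zero) l)
          (trans (cong (λ z → ((q + 1ℤ) * B· y zero - sum y) + z + s * y l) (Bᵀ-of-zero (e≡0 y v-const) l))
                 (regroup ((q + 1ℤ) * B· y zero) (sum y) (s * y l)))
          where
          regroup : ∀ a b c → (a - b) + 0ℤ + c ≡ c - (b - a)
          regroup = solve-∀

      -- The family consists of Bᵀw with sum w = 0, enlarged by multiples of one line. The sum of
      -- its members is the multiplicity of that line. `flat` and the bound on θ give ℓ ∣ By, hence
      -- ℓ divides that sum, and then uw.
      m+1+c≤N+1 : ∀ {i} → 0 ℕ.< i → ℓ^ i ∣ s → ¬ (+ ℓ ∣ u) → Cancels θ i (+ ℓ) → suc m ℕ.+ c i ℕ.≤ N ℕ.+ 1
      m+1+c≤N+1 {i} 0<i ∣s ℓ∤u θ-cancels = c-upper i F lin-F (λ α (_ : Fin 1) → sum (α ∘ suc))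
          (λ _ → lin-∘ sum-linear (λ p → lin-proj (suc p))) small
        where
        F : (Fin (suc m) → ℤ) → Fin N → ℤ
        F α l = Bᵀ (α ∘ suc) l + α zero * identity l₀ l

        lin-F : LinearMap F
        lin-F l = lin-+ (lin-∘ (lin-Bᵀ l) (λ p → lin-proj (suc p))) (lin-*ʳ (identity l₀ l) (lin-proj zero))

        small : ∀ α → (∀ t → sum (α ∘ suc) ≡ 0ℤ) → (∀ l → ℓ^ i ∣ apply L (F α) l) → ∀ t → + ℓ ∣ α t
        small α Σw≡0 ∣L = ∣α
          where
          w : Fin m → ℤ
          w = α ∘ suc

          BF : ∀ p → B· (F α) p ≡ u * w p + α zero * B p l₀
          BF p = trans (axpy (lin-B p) (Bᵀ w) (α zero) (identity l₀))
            (cong₂ (λ a b → a + α zero * b)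
              (trans (BBᵀ w p) (trans (cong (λ z → u * w p + z) (Σw≡0 zero)) (ℤ.+-identityʳ (u * w p))))
              (B-line p l₀))

          ΣF : sum (F α) ≡ α zero
          ΣF = trans (axpy sum-linear (Bᵀ w) (α zero) (identity l₀))
            (trans (cong₂ (λ a b → a + α zero * b) (trans (sum-Bᵀ w) (cong (R *_) (Σw≡0 zero))) (sum-line l₀))
                   (simplify R (α zero)))
            where
            simplify : ∀ R a → R * 0ℤ + a * 1ℤ ≡ a
            simplify = solve-∀

          facts : _
          facts = flat i ∣s ℓ∤u (F α) ∣L

          ℓ∣v₀ : + ℓ ∣ B· (F α) zero
          ℓ∣v₀ = θ-cancels _ (proj₂ (proj₂ facts))

          ℓ∣v : ∀ p → + ℓ ∣ B· (F α) p
          ℓ∣v p = ∣-≡ (rejoin (B· (F α) p) (B· (F α) zero))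
            (∣m∣n⇒∣m+n (∣-trans (ℓ∣ℓ^ 0<i) (proj₁ facts p)) ℓ∣v₀)
            where
            rejoin : ∀ a b → (a - b) + b ≡ a
            rejoin = solve-∀

          ∣α : ∀ t → + ℓ ∣ α t
          ∣α zero = ∣-≡ (trans (rejoin ((q + 1ℤ) * B· (F α) zero) (sum (F α))) ΣF)
            (∣m∣n⇒∣m-n (∣n⇒∣m*n (q + 1ℤ) ℓ∣v₀) (∣-trans (ℓ∣ℓ^ 0<i) (proj₁ (proj₂ facts))))
            where
            rejoin : ∀ a b → a - (a - b) ≡ b
            rejoin = solve-∀
          ∣α (suc p) = unit-cancels₁ ℓ∤u (w p)
            (∣-≡ (trans (cong (_- α zero * B p l₀) (BF p)) (drop (u * w p) (α zero * B p l₀)))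
                 (∣m∣n⇒∣m-n (ℓ∣v p) (∣m⇒∣m*n (B p l₀) (∣α zero))))
            where
            drop : ∀ a b → a + b - b ≡ a
            drop = solve-∀

      -- Without a bound on θ the extra line of `m+1+c≤N+1` is given up. The members Bᵀw then have
      -- sum 0, so `flat` yields (q + 1) times the constant alone, and q + 1 is a unit.
      m+c≤N+1 : ∀ {i} → 0 ℕ.< i → ℓ^ i ∣ s → ¬ (+ ℓ ∣ u) → ¬ (+ ℓ ∣ q + 1ℤ) → m ℕ.+ c i ℕ.≤ N ℕ.+ 1
      m+c≤N+1 {i} 0<i ∣s ℓ∤u ℓ∤q+1 = c-upper i Bᵀ lin-Bᵀ (λ w (_ : Fin 1) → sum w) (λ _ → sum-linear) small
        where
        small : ∀ w → (∀ t → sum w ≡ 0ℤ) → (∀ l → ℓ^ i ∣ apply L (Bᵀ w) l) → ∀ p → + ℓ ∣ w p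
        small w Σw≡0 ∣L p = unit-cancels₁ ℓ∤u (w p) (∣-≡ BF ℓ∣v)
          where
          facts : _
          facts = flat i ∣s ℓ∤u (Bᵀ w) ∣L

          x : Fin m → ℤ
          x = B· (Bᵀ w)

          BF : x p ≡ u * w p
          BF = trans (BBᵀ w p) (trans (cong (λ z → u * w p + z) (Σw≡0 zero)) (ℤ.+-identityʳ (u * w p)))

          ℓ∣v₀ : + ℓ ∣ x zero
          ℓ∣v₀ = unit-cancels₁ ℓ∤q+1 (x zero) (∣-≡
            (trans (cong (λ z → (q + 1ℤ) * x zero - z) (trans (sum-Bᵀ w) (trans (cong (R *_) (Σw≡0 zero)) (ℤ.*-zeroʳ R))))
                   (ℤ.+-identityʳ ((q + 1ℤ) * x zero)))
            (∣-trans (ℓ∣ℓ^ 0<i) (proj₁ (proj₂ facts))))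

          ℓ∣v : + ℓ ∣ x p
          ℓ∣v = ∣-≡ (rejoin (x p) (x zero)) (∣m∣n⇒∣m+n (∣-trans (ℓ∣ℓ^ 0<i) (proj₁ facts p)) ℓ∣v₀)
            where
            rejoin : ∀ a b → (a - b) + b ≡ a
            rejoin = solve-∀

      -- L is multiplication by r on Bᵀw with sum w = 0, and BBᵀw = uw recovers w modulo ℓ.
      m≤c+1 : ∀ {i} → ℓ^ i ∣ r → ¬ (+ ℓ ∣ u) → m ℕ.≤ c i ℕ.+ 1
      m≤c+1 {i} ∣r ℓ∤u = c-lower i Bᵀ lin-Bᵀ (λ w (_ : Fin 1) → sum w) (λ _ → sum-linear)
        (λ w Σw≡0 l → ∣-≡ (sym (trans (LBᵀ w l) (trans (cong (λ z → r * Bᵀ w l - ρ * z) (Σw≡0 zero)) (simplify ρ (r * Bᵀ w l)))))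
                           (∣m⇒∣m*n (Bᵀ w l) ∣r))
        (λ w Σw≡0 ∣F p → unit-cancels₁ ℓ∤u (w p) (∣-≡
           (trans (BBᵀ w p) (trans (cong (λ z → u * w p + z) (Σw≡0 zero)) (ℤ.+-identityʳ (u * w p))))
           (∣-B ∣F p)))
        where
        simplify : ∀ ρ a → a - ρ * 0ℤ ≡ a
        simplify = solve-∀

      -- If ℓ^i also divides ρ, the weights need not sum to 0 for L to send Bᵀw into multiples of
      -- ℓ^i. Constants join the family, and the equation sum w = (q + 1)α₀ is chosen so that B
      -- applied to a member is ρα₀ - uw, which isolates w modulo ℓ.
      m+1≤c+1 : ∀ {i} → 0 ℕ.< i → ℓ^ i ∣ r → ℓ^ i ∣ ρ → ¬ (+ ℓ ∣ u) → suc m ℕ.≤ c i ℕ.+ 1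
      m+1≤c+1 {i} 0<i ∣r ∣ρ ℓ∤u = c-lower i F lin-F G lin-G ∣LF independent
        where
        F : (Fin (suc m) → ℤ) → Fin N → ℤ
        F α l = α zero - Bᵀ (α ∘ suc) l

        lin-F : LinearMap F
        lin-F l = lin-- (lin-proj zero) (lin-∘ (lin-Bᵀ l) (λ p → lin-proj (suc p)))

        G : (Fin (suc m) → ℤ) → Fin 1 → ℤ
        G α _ = sum (α ∘ suc) - (q + 1ℤ) * α zero

        lin-G : LinearMap G
        lin-G _ = lin-- (lin-∘ sum-linear (λ p → lin-proj (suc p))) (lin-* (q + 1ℤ) (lin-proj zero))

        F≗ : ∀ α l → F α l ≡ α zero + - 1ℤ * Bᵀ (α ∘ suc) l
        F≗ α l = negate (α zero) (Bᵀ (α ∘ suc) l)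
          where
          negate : ∀ a b → a - b ≡ a + - 1ℤ * b
          negate = solve-∀

        ∣LF : ∀ α → (∀ t → G α t ≡ 0ℤ) → ∀ l → ℓ^ i ∣ apply L (F α) l
        ∣LF α _ l = ∣-≡ (sym value) (∣m∣n⇒∣m-n (∣m⇒∣m*n (sum (α ∘ suc)) ∣ρ) (∣m⇒∣m*n (Bᵀ (α ∘ suc) l) ∣r))
          where
          value : apply L (F α) l ≡ ρ * sum (α ∘ suc) - r * Bᵀ (α ∘ suc) l
          value = begin
            apply L (F α) l                                                 ≡⟨ apply-cong L (F≗ α) l ⟩
            apply L (λ l → α zero + - 1ℤ * Bᵀ (α ∘ suc) l) l                ≡⟨ axpy (lin-apply L l) (λ _ → α zero) (- 1ℤ) (Bᵀ (α ∘ suc)) ⟩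
            apply L (λ _ → α zero) l + - 1ℤ * apply L (Bᵀ (α ∘ suc)) l      ≡⟨ cong₂ (λ a b → a + - 1ℤ * b) (L-const (α zero) l) (LBᵀ (α ∘ suc) l) ⟩
            0ℤ + - 1ℤ * (r * Bᵀ (α ∘ suc) l - ρ * sum (α ∘ suc))            ≡⟨ simplify (r * Bᵀ (α ∘ suc) l) (ρ * sum (α ∘ suc)) ⟩
            ρ * sum (α ∘ suc) - r * Bᵀ (α ∘ suc) l                          ∎
            where
            simplify : ∀ a b → 0ℤ + - 1ℤ * (a - b) ≡ b - a
            simplify = solve-∀

        independent : ∀ α → (∀ t → G α t ≡ 0ℤ) → (∀ l → + ℓ ∣ F α l) → ∀ t → + ℓ ∣ α t
        independent α Gα≡0 ∣F = ∣α
          where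
          w : Fin m → ℤ
          w = α ∘ suc

          BF : ∀ p → B· (F α) p ≡ α zero * ρ - u * w p
          BF p = begin
            B· (F α) p                                       ≡⟨ lin-B p .≗-cong (F≗ α) ⟩
            B· (λ l → α zero + - 1ℤ * Bᵀ w l) p              ≡⟨ axpy (lin-B p) (λ _ → α zero) (- 1ℤ) (Bᵀ w) ⟩
            B· (λ _ → α zero) p + - 1ℤ * B· (Bᵀ w) p         ≡⟨ cong₂ (λ a b → a + - 1ℤ * b) (B-const (α zero) p) (BBᵀ w p) ⟩
            R * α zero + - 1ℤ * (u * w p + sum w)            ≡⟨ cong (λ z → R * α zero + - 1ℤ * (u * w p + z)) (ℤ.i-j≡0⇒i≡j (sum w) _ (Gα≡0 zero)) ⟩
            R * α zero + - 1ℤ * (u * w p + (q + 1ℤ) * α zero)    ≡⟨ collect R q (α zero) (u * w p) ⟩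
            α zero * ρ - u * w p                             ∎
            where
            collect : ∀ R q a x → R * a + - 1ℤ * (x + (q + 1ℤ) * a) ≡ a * (R - (q + 1ℤ)) - x
            collect = solve-∀

          ∣w : ∀ p → + ℓ ∣ w p
          ∣w p = unit-cancels₁ ℓ∤u (w p) (∣-≡
            (trans (cong (λ z → α zero * ρ - z) (BF p)) (rejoin (α zero * ρ) (u * w p)))
            (∣m∣n⇒∣m-n (∣n⇒∣m*n (α zero) (∣-trans (ℓ∣ℓ^ 0<i) ∣ρ)) (∣-B ∣F p)))
            where
            rejoin : ∀ a b → a - (a - b) ≡ b
            rejoin = solve-∀

          ∣α : ∀ t → + ℓ ∣ α t
          ∣α (suc p) = ∣w p
          ∣α zero    = ∣-≡ (rejoin (α zero) (Bᵀ w l₀)) (∣m∣n⇒∣m+n (∣F l₀) (∣-Bᵀ ∣w l₀))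
            where
            rejoin : ∀ a b → (a - b) + b ≡ a
            rejoin = solve-∀

      c≤m : ∀ {i} → Cancels s i (+ ℓ) → c i ℕ.≤ m
      c≤m {i} s-cancels = c-upper-id i B· lin-B
        (λ y v≡0 ∣Ly l → s-cancels (y l) (∣-≡ (L-on-kernel y v≡0 l) (∣Ly l)))

      -- The value of By is left free at the first point. At another point BLy reduces to -ρ sum y,
      -- so ℓ divides sum y; the free value is (q + 1) sum y and is divisible as well, which leaves
      -- sy.
      c≤m-1 : ∀ {i} → 0 ℕ.< i → Cancels ρ i (+ ℓ) → ¬ (+ ℓ ∣ s) → Fin m′ → c i ℕ.≤ m′
      c≤m-1 {i} 0<i ρ-cancels ℓ∤s p₁ = c-upper-id i (λ y t → B· y (suc t)) (λ t → lin-B (suc t)) small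
        where
        small : ∀ y → (∀ t → B· y (suc t) ≡ 0ℤ) → (∀ l → ℓ^ i ∣ apply L y l) → ∀ l → + ℓ ∣ y l
        small y v≡0 ∣Ly l = unit-cancels₁ ℓ∤s (y l) (∣-≡
            (trans (cong (λ z → z - Bᵀ (B· y) l + sum y) (L-apply y l)) (drop (Bᵀ (B· y) l) (sum y) (s * y l)))
            (∣m∣n⇒∣m+n (∣m∣n⇒∣m-n (∣-trans (ℓ∣ℓ^ 0<i) (∣Ly l)) (∣-Bᵀ ∣v l)) ∣σ))
          where
          drop : ∀ a b c → (a - b + c) - a + b ≡ c
          drop = solve-∀

          ∣σ : + ℓ ∣ sum y
          ∣σ = ρ-cancels (sum y) (∣-≡
            (trans (cong -_ (trans (BL y (suc p₁)) (cong (λ z → r * z - ρ * sum y) (v≡0 p₁)))) (simplify r (ρ * sum y)))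
            (∣m⇒∣-m (∣-B ∣Ly (suc p₁))))
            where
            simplify : ∀ r a → - (r * 0ℤ - a) ≡ a
            simplify = solve-∀

          ∣v : ∀ p → + ℓ ∣ B· y p
          ∣v zero    = ∣-≡ (trans (sym (sum-B y))
            (trans (cong (λ z → B· y zero + z) (sum-zero v≡0)) (ℤ.+-identityʳ (B· y zero))))
            (∣n⇒∣m*n (q + 1ℤ) ∣σ)
          ∣v (suc t) = ∣-≡ (sym (v≡0 t)) ∣-zero

      private
        ℓ^suc∣* : ∀ {b x y} → + ℓ ∣ x → ℓ^ b ∣ y → ℓ^ suc b ∣ x * y
        ℓ^suc∣* {b} {x} {y} ℓ∣x ∣y = ∣ᵤ⇒∣ (subst (ℓ ℕ.^ suc b ℕ.∣_) (sym (ℤ.abs-* x y))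
          (ℕ.*-pres-∣ (∣⇒∣ᵤ ℓ∣x) (∣⇒∣ᵤ ∣y)))

      -- The equations make By constant away from the first point. Then Ly takes the value K + sy
      -- off that point and K + δ + sy on lines through it, where δ is the deviation there. A line
      -- missing the point gives ℓ^b ∣ K only; the missing factor ℓ for K and δ has to come from ℓ ∣
      -- q + 1.
      c≤m-1′ : ∀ {b i} → b ℕ.< i → + ℓ ∣ q + 1ℤ → ℓ^ b ∣ s → Cancels s (suc b) (+ ℓ) → ℓ^ suc b ∣ θ →
               Fin m′ → ∀ {l₁ l₂} → B zero l₁ ≡ 0ℤ → B zero l₂ ≡ 1ℤ → c i ℕ.≤ m′
      c≤m-1′ {b} {i} b<i ℓ∣q+1 ∣s s-cancels ∣θ p₁ {l₁} {l₂} 0∉l₁ 0∈l₂ = c-upper-id i G lin-G small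
        where
        -- One of the m − 1 equations is trivial and makes room for y l₀ = 0.
        equation : ∀ {t} → Dec (t ≡ p₁) → (Fin N → ℤ) → ℤ
        equation     (yes _) y = y l₀
        equation {t} (no _)  y = B· y (suc t) - B· y (suc p₁)

        G : (Fin N → ℤ) → Fin m′ → ℤ
        G y t = equation (t Fin.≟ p₁) y

        lin-G : LinearMap G
        lin-G t with t Fin.≟ p₁
        ... | yes _ = lin-proj l₀
        ... | no  _ = lin-- (lin-B (suc t)) (lin-B (suc p₁))

        small : ∀ y → (∀ t → G y t ≡ 0ℤ) → (∀ l → ℓ^ i ∣ apply L y l) → ∀ l → + ℓ ∣ y l
        small y Gy≡0 ∣Lyⁱ l = s-cancels (y l) (∣-≡
            (trans (cong (λ z → z - K - B zero l * δ) (Ly l)) (drop K (B zero l * δ) (s * y l)))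
            (∣m∣n⇒∣m-n (∣m∣n⇒∣m-n (∣Ly l) ∣K) (∣n⇒∣m*n (B zero l) ∣δ)))
          where
          drop : ∀ a b c → (a + b + c) - a - b ≡ c
          drop = solve-∀

          yl₀≡0 : y l₀ ≡ 0ℤ
          yl₀≡0 with p₁ Fin.≟ p₁ | Gy≡0 p₁
          ... | yes _   | e = e
          ... | no  p≢p | _ = contradiction refl p≢p

          ∣Ly : ∀ l → ℓ^ suc b ∣ apply L y l
          ∣Ly l = ∣^-mono b<i (∣Lyⁱ l)

          a K δ : ℤ
          a = B· y (suc p₁)
          K = (q + 1ℤ) * a - sum y
          δ = B· y zero - a

          e≡0 : ∀ t → B· y (suc t) - a ≡ 0ℤ
          e≡0 t with t Fin.≟ p₁ | Gy≡0 t
          ... | yes refl | _ = ℤ.+-inverseʳ a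
          ... | no  _    | e = e

          only-zero : ∀ p → p ≢ zero → B· y p - a ≡ 0ℤ
          only-zero zero    p≢0 = contradiction refl p≢0
          only-zero (suc t) _   = e≡0 t

          Ly : ∀ l → apply L y l ≡ K + B zero l * δ + s * y l
          Ly l = trans (L-shift y a l) (cong (λ z → K + z + s * y l)
            (sum-single zero (λ p p≢0 → trans (cong (B p l *_) (only-zero p p≢0)) (ℤ.*-zeroʳ (B p l)))))

          weak : ∀ {l} → ℓ^ b ∣ K + B zero l * δ
          weak {l} = ∣-≡ (trans (cong (_- s * y l) (Ly l)) (chop (K + B zero l * δ) (s * y l)))
            (∣m∣n⇒∣m-n (∣^-mono (ℕ.n≤1+n b) (∣Ly l)) (∣m⇒∣m*n (y l) ∣s))
            where
            chop : ∀ a b → (a + b) - b ≡ a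
            chop = solve-∀

          ∣Kᵇ : ℓ^ b ∣ K
          ∣Kᵇ = ∣-≡ (trans (cong (λ z → K + z * δ) 0∉l₁) (simplify K δ)) weak
            where
            simplify : ∀ a b → a + 0ℤ * b ≡ a
            simplify = solve-∀

          -- By `θ-shift`, δ = -(q + 1)K - θa: the factor q + 1 raises the divisibility of K by one
          -- power of ℓ.
          ∣δ : ℓ^ suc b ∣ δ
          ∣δ = ∣-≡ (trans (cong (λ z → - ((q + 1ℤ) * K) - z)
                     (trans (θ-shift y a) (cong (λ z → (q + 1ℤ) * (sum y - (q + 1ℤ) * a) - z) (sum-single zero only-zero))))
                     (simplify (q + 1ℤ) ((q + 1ℤ) * a) (sum y) δ))
            (∣m∣n⇒∣m-n (∣m⇒∣-m (ℓ^suc∣* {b} ℓ∣q+1 ∣Kᵇ)) (∣m⇒∣m*n a ∣θ))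
            where
            simplify : ∀ k a σ d → - (k * (a - σ)) - (k * (σ - a) - d) ≡ d
            simplify = solve-∀

          -- At `l₀` the term sy is absent, so the divisibility of δ passes to K.
          ∣K : ℓ^ suc b ∣ K
          ∣K = ∣-≡ (trans (cong (_- B zero l₀ * δ) (trans (Ly l₀) (cong (λ z → K + B zero l₀ * δ + s * z) yl₀≡0)))
                          (simplify K (B zero l₀ * δ) s))
            (∣m∣n⇒∣m-n (∣Ly l₀) (∣n⇒∣m*n (B zero l₀) ∣δ))
            where
            simplify : ∀ a b s → (a + b + s * 0ℤ) - b ≡ a
            simplify = solve-∀

      -- `D p` is a preimage under B of q times the difference of p and the first point. As q is a
      -- unit at ℓ, `Z` replaces Bᵀ as an inverse of B up to a unit on weights of sum 0, also when ℓ
      -- ∣ `u`.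
      module Differences (D : Fin m → Fin N → ℤ)
        (B-D : ∀ p p′ → B· (D p) p′ ≡ q * (identity p′ p - identity p′ zero))
        (ℓ∤q : ¬ (+ ℓ ∣ q)) where

        Z : (Fin m → ℤ) → Fin N → ℤ
        Z w l = sum (λ p → D p l * w p)

        lin-Z : LinearMap Z
        lin-Z l = lin-sum (λ p → lin-* (D p l) (lin-proj p))

        private
          sum-identityᵀ : ∀ (i : Fin m) (f : Fin m → ℤ) → sum (λ j → identity j i * f j) ≡ f i
          sum-identityᵀ i f = trans (sum-cong-≗ (λ j → cong (_* f j) (identity-sym j i))) (sum-identity i f)

          weighted : ∀ (f g w : Fin m → ℤ) → sum (λ p → q * (f p - g p) * w p) ≡
                     q * (sum (λ p → f p * w p) + - 1ℤ * sum (λ p → g p * w p))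
          weighted f g w = begin
            sum (λ p → q * (f p - g p) * w p)                             ≡⟨ sum-cong-≗ (λ p → expand q (f p) (g p) (w p)) ⟩
            sum (λ p → q * (f p * w p + - 1ℤ * (g p * w p)))              ≡⟨ *-distribˡ-sum q (λ p → f p * w p + - 1ℤ * (g p * w p)) ⟨
            q * sum (λ p → f p * w p + - 1ℤ * (g p * w p))                ≡⟨ cong (q *_) (axpy sum-linear (λ p → f p * w p) (- 1ℤ) (λ p → g p * w p)) ⟩
            q * (sum (λ p → f p * w p) + - 1ℤ * sum (λ p → g p * w p))    ∎
            where
            expand : ∀ q f g w → q * (f - g) * w ≡ q * (f * w + - 1ℤ * (g * w))
            expand = solve-∀

        B-Z : ∀ w → sum w ≡ 0ℤ → ∀ p → B· (Z w) p ≡ q * w p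
        B-Z w Σw≡0 p = begin
          B· (Z w) p                                         ≡⟨ sum-exchange-* (B p) (λ l p′ → D p′ l) w ⟩
          sum (λ p′ → B· (D p′) p * w p′)                    ≡⟨ sum-cong-≗ (λ p′ → cong (_* w p′) (B-D p′ p)) ⟩
          sum (λ p′ → q * (identity p p′ - identity p zero) * w p′)
            ≡⟨ weighted (identity p) (λ _ → identity p zero) w ⟩
          q * (sum (λ p′ → identity p p′ * w p′) + - 1ℤ * sum (λ p′ → identity p zero * w p′))
            ≡⟨ cong₂ (λ a b → q * (a + - 1ℤ * b)) (sum-identity p w)
                 (trans (sym (*-distribˡ-sum (identity p zero) w)) (cong (identity p zero *_) Σw≡0)) ⟩
          q * (w p + - 1ℤ * (identity p zero * 0ℤ))          ≡⟨ simplify q (w p) (identity p zero) ⟩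
          q * w p                                            ∎
          where
          simplify : ∀ q w i → q * (w + - 1ℤ * (i * 0ℤ)) ≡ q * w
          simplify = solve-∀

        sum-D : ∀ p → sum (D p) ≡ 0ℤ
        sum-D p = sum-zero-of-B-zero (begin
          sum (B· (D p))                                              ≡⟨ sum-cong-≗ (λ p′ → trans (B-D p p′) (sym (ℤ.*-identityʳ _))) ⟩
          sum (λ p′ → q * (identity p′ p - identity p′ zero) * 1ℤ)    ≡⟨ weighted (λ p′ → identity p′ p) (λ p′ → identity p′ zero) (λ _ → 1ℤ) ⟩
          q * (sum (λ p′ → identity p′ p * 1ℤ) + - 1ℤ * sum {m} (λ p′ → identity p′ zero * 1ℤ))
            ≡⟨ cong₂ (λ a b → q * (a + - 1ℤ * b)) (sum-identityᵀ p (λ _ → 1ℤ)) (sum-identityᵀ zero (λ _ → 1ℤ)) ⟩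
          q * (1ℤ + - 1ℤ * 1ℤ)                                        ≡⟨ ℤ.*-zeroʳ q ⟩
          0ℤ                                                          ∎)

        sum-Z : ∀ w → sum w ≡ 0ℤ → sum (Z w) ≡ 0ℤ
        sum-Z w Σw≡0 = sum-zero-of-B-zero (begin
          sum (B· (Z w))       ≡⟨ sum-cong-≗ (B-Z w Σw≡0) ⟩
          sum (λ p → q * w p)  ≡⟨ *-distribˡ-sum q w ⟨
          q * sum w            ≡⟨ cong (q *_) Σw≡0 ⟩
          q * 0ℤ               ≡⟨ ℤ.*-zeroʳ q ⟩
          0ℤ                   ∎)

        -- Pairing with D p turns constant line sums into equal weights.
        constant-line-sums : ∀ w k → (∀ l → + ℓ ∣ Bᵀ w l - k) → ∀ p → + ℓ ∣ w p - w zero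
        constant-line-sums w k ∣w p = unit-cancels₁ ℓ∤q (w p - w zero) (∣-≡ pairing (∣-sum (λ l → ∣n⇒∣m*n (D p l) (∣w l))))
          where
          expand : ∀ d a k → d * (a - k) ≡ d * a + - k * d
          expand = solve-∀
          simplify : ∀ q a b k → q * (a + - 1ℤ * b) + - k * 0ℤ ≡ q * (a - b)
          simplify = solve-∀

          pairing : sum (λ l → D p l * (Bᵀ w l - k)) ≡ q * (w p - w zero)
          pairing = begin
            sum (λ l → D p l * (Bᵀ w l - k))                            ≡⟨ sum-cong-≗ (λ l → expand (D p l) (Bᵀ w l) k) ⟩
            sum (λ l → D p l * Bᵀ w l + - k * D p l)                    ≡⟨ axpy sum-linear (λ l → D p l * Bᵀ w l) (- k) (D p) ⟩
            sum (λ l → D p l * Bᵀ w l) + - k * sum (D p)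
              ≡⟨ cong₂ (λ a b → a + - k * b) (sum-exchange-* (D p) (λ l p′ → B p′ l) w) (sum-D p) ⟩
            sum (λ p′ → sum (λ l → D p l * B p′ l) * w p′) + - k * 0ℤ
              ≡⟨ cong (_+ - k * 0ℤ) (sum-cong-≗ (λ p′ → cong (_* w p′)
                   (trans (sum-cong-≗ (λ l → ℤ.*-comm (D p l) (B p′ l))) (B-D p p′)))) ⟩
            sum (λ p′ → q * (identity p′ p - identity p′ zero) * w p′) + - k * 0ℤ
              ≡⟨ cong (_+ - k * 0ℤ) (trans (weighted (λ p′ → identity p′ p) (λ p′ → identity p′ zero) w)
                   (cong₂ (λ a b → q * (a + - 1ℤ * b)) (sum-identityᵀ p w) (sum-identityᵀ zero w))) ⟩
            q * (w p + - 1ℤ * w zero) + - k * 0ℤ                        ≡⟨ simplify q (w p) (w zero) k ⟩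
            q * (w p - w zero)                                          ∎

        private
          -- Pairing with `D p` yields only differences of weights. The second equation fixes the
          -- weight of the first point to make up for that.
          G : (Fin (suc m) → ℤ) → Fin 2 → ℤ
          G α zero       = sum (α ∘ suc)
          G α (suc zero) = α (suc zero)

          lin-G : LinearMap G
          lin-G zero       = lin-∘ sum-linear (λ p → lin-proj (suc p))
          lin-G (suc zero) = lin-proj (suc zero)

          weights : ∀ (w : Fin m → ℤ) → w zero ≡ 0ℤ → (∀ p → + ℓ ∣ q * w p - q * w zero) → ∀ p → + ℓ ∣ w p
          weights w w₀≡0 ∣w p = unit-cancels₁ ℓ∤q (w p)
            (∣-≡ (trans (cong (λ z → q * w p - q * z) w₀≡0) (simplify q (w p))) (∣w p))
            where
            simplify : ∀ q a → q * a - q * 0ℤ ≡ q * a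
            simplify = solve-∀

        -- Modulo ℓ the condition on Ly says that the weights By have constant line sums, so they
        -- are constant. A constant has line sums divisible by q + 1, hence by ℓ; this kills the
        -- coefficient of `l₀` and then the differences of qw.
        m+1+c≤N+2 : ∀ {i} → 0 ℕ.< i → + ℓ ∣ s → + ℓ ∣ q + 1ℤ → suc m ℕ.+ c i ℕ.≤ N ℕ.+ 2
        m+1+c≤N+2 {i} 0<i ℓ∣s ℓ∣q+1 = c-upper i F lin-F G lin-G small
          where
          F : (Fin (suc m) → ℤ) → Fin N → ℤ
          F α l = Z (α ∘ suc) l + α zero * identity l₀ l

          lin-F : LinearMap F
          lin-F l = lin-+ (lin-∘ (lin-Z l) (λ p → lin-proj (suc p))) (lin-*ʳ (identity l₀ l) (lin-proj zero))

          small : ∀ α → (∀ t → G α t ≡ 0ℤ) → (∀ l → ℓ^ i ∣ apply L (F α) l) → ∀ t → + ℓ ∣ α t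
          small α Gα≡0 ∣LF = ∣α
            where
            w : Fin m → ℤ
            w = α ∘ suc

            BF : ∀ p → B· (F α) p ≡ q * w p + α zero * B p l₀
            BF p = trans (axpy (lin-B p) (Z w) (α zero) (identity l₀))
              (cong₂ (λ a b → a + α zero * b) (B-Z w (Gα≡0 zero) p) (B-line p l₀))

            ΣF : sum (F α) ≡ α zero
            ΣF = trans (axpy sum-linear (Z w) (α zero) (identity l₀))
              (trans (cong₂ (λ a b → a + α zero * b) (sum-Z w (Gα≡0 zero)) (sum-line l₀)) (simplify (α zero)))
              where
              simplify : ∀ a → 0ℤ + a * 1ℤ ≡ a
              simplify = solve-∀

            ∣line-sums : ∀ l → + ℓ ∣ Bᵀ (B· (F α)) l - α zero
            ∣line-sums l = ∣-≡
              (trans (cong (_- s * F α l) (trans (L-apply (F α) l) (cong (λ z → Bᵀ (B· (F α)) l - z + s * F α l) ΣF)))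
                     (chop (Bᵀ (B· (F α)) l - α zero) (s * F α l)))
              (∣m∣n⇒∣m-n (∣-trans (ℓ∣ℓ^ 0<i) (∣LF l)) (∣m⇒∣m*n (F α l) ℓ∣s))
              where
              chop : ∀ a b → (a + b) - b ≡ a
              chop = solve-∀

            ∣e : ∀ p → + ℓ ∣ B· (F α) p - B· (F α) zero
            ∣e = constant-line-sums (B· (F α)) (α zero) ∣line-sums

            ∣α₀ : + ℓ ∣ α zero
            ∣α₀ = ∣-≡ (trans (cong (λ z → a + b - (z - α zero)) (Bᵀ-shift (B· (F α)) (B· (F α) zero) l₀)) (simplify a b (α zero)))
              (∣m∣n⇒∣m-n (∣m∣n⇒∣m+n (∣m⇒∣m*n (B· (F α) zero) ℓ∣q+1) (∣-Bᵀ ∣e l₀)) (∣line-sums l₀))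
              where
              a b : ℤ
              a = (q + 1ℤ) * B· (F α) zero
              b = Bᵀ (λ p → B· (F α) p - B· (F α) zero) l₀
              simplify : ∀ a b c → a + b - (a + b - c) ≡ c
              simplify = solve-∀

            ∣α : ∀ t → + ℓ ∣ α t
            ∣α zero    = ∣α₀
            ∣α (suc p) = weights w (Gα≡0 (suc zero)) (λ p → ∣-≡
              (trans (cong₂ (λ a b → (a - b) - α zero * (B p l₀ - B zero l₀)) (BF p) (BF zero))
                     (simplify (q * w p) (q * w zero) (α zero) (B p l₀) (B zero l₀)))
              (∣m∣n⇒∣m-n (∣e p) (∣m⇒∣m*n (B p l₀ - B zero l₀) ∣α₀))) p
              where
              simplify : ∀ x y a b c → ((x + a * b) - (y + a * c)) - a * (b - c) ≡ x - y
              simplify = solve-∀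

        -- L maps Bᵀw to rBᵀw and Zw to qBᵀw + sZw, so in qBᵀw - rZw the terms with Bᵀw cancel and
        -- -rsZw is left. Modulo ℓ this vector is just qBᵀw, since ℓ ∣ r.
        m+1≤c+2 : ∀ {i} → + ℓ ∣ r → ℓ^ i ∣ r * s → suc m ℕ.≤ c i ℕ.+ 2
        m+1≤c+2 {i} ℓ∣r ∣rs = c-lower i F lin-F G lin-G ∣LF independent
          where
          F : (Fin (suc m) → ℤ) → Fin N → ℤ
          F α l = (q * Bᵀ (α ∘ suc) l + - r * Z (α ∘ suc) l) + 1ℤ * α zero

          lin-F : LinearMap F
          lin-F l = lin-+ (lin-+ (lin-* q (lin-∘ (lin-Bᵀ l) (λ p → lin-proj (suc p))))
                                 (lin-* (- r) (lin-∘ (lin-Z l) (λ p → lin-proj (suc p)))))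
                          (lin-* 1ℤ (lin-proj zero))

          ∣LF : ∀ α → (∀ t → G α t ≡ 0ℤ) → ∀ l → ℓ^ i ∣ apply L (F α) l
          ∣LF α Gα≡0 l = ∣-≡ (sym value) (∣m⇒∣-m (∣m⇒∣m*n (Z w l) ∣rs))
            where
            w : Fin m → ℤ
            w = α ∘ suc

            LZ : apply L (Z w) l ≡ q * Bᵀ w l + s * Z w l
            LZ = trans (L-apply (Z w) l) (trans
              (cong₂ (λ a b → a - b + s * Z w l)
                (trans (lin-Bᵀ l .≗-cong (B-Z w (Gα≡0 zero))) (scale (lin-Bᵀ l) q w)) (sum-Z w (Gα≡0 zero)))
              (cong (_+ s * Z w l) (ℤ.+-identityʳ (q * Bᵀ w l))))

            value : apply L (F α) l ≡ - (r * s * Z w l)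
            value = begin
              apply L (F α) l
                ≡⟨ axpy (lin-apply L l) (λ l → q * Bᵀ w l + - r * Z w l) 1ℤ (λ _ → α zero) ⟩
              apply L (λ l → q * Bᵀ w l + - r * Z w l) l + 1ℤ * apply L (λ _ → α zero) l
                ≡⟨ cong₂ (λ a b → a + 1ℤ * b) (lin-apply L l .homo q (- r) (Bᵀ w) (Z w)) (L-const (α zero) l) ⟩
              (q * apply L (Bᵀ w) l + - r * apply L (Z w) l) + 1ℤ * 0ℤ
                ≡⟨ cong₂ (λ a b → (q * a + - r * b) + 1ℤ * 0ℤ)
                     (trans (LBᵀ w l) (cong (λ z → r * Bᵀ w l - ρ * z) (Gα≡0 zero))) LZ ⟩
              (q * (r * Bᵀ w l - ρ * 0ℤ) + - r * (q * Bᵀ w l + s * Z w l)) + 1ℤ * 0ℤ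
                ≡⟨ simplify q r ρ s (Bᵀ w l) (Z w l) ⟩
              - (r * s * Z w l)    ∎
              where
              simplify : ∀ q r ρ s x z → (q * (r * x - ρ * 0ℤ) + - r * (q * x + s * z)) + 1ℤ * 0ℤ ≡ - (r * s * z)
              simplify = solve-∀

          independent : ∀ α → (∀ t → G α t ≡ 0ℤ) → (∀ l → + ℓ ∣ F α l) → ∀ t → + ℓ ∣ α t
          independent α Gα≡0 ∣F = ∣α
            where
            w : Fin m → ℤ
            w = α ∘ suc

            ∣qBᵀ : ∀ l → + ℓ ∣ Bᵀ (λ p → q * w p) l - - α zero
            ∣qBᵀ l = ∣-≡ (trans (simplify (q * Bᵀ w l) r (Z w l) (α zero)) (cong (_- - α zero) (sym (scale (lin-Bᵀ l) q w))))
              (∣m∣n⇒∣m+n (∣F l) (∣m⇒∣m*n (Z w l) ℓ∣r))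
              where
              simplify : ∀ x r z a → ((x + - r * z) + 1ℤ * a) + r * z ≡ x - - a
              simplify = solve-∀

            ∣w : ∀ p → + ℓ ∣ w p
            ∣w = weights w (Gα≡0 (suc zero)) (constant-line-sums (λ p → q * w p) (- α zero) ∣qBᵀ)

            ∣α : ∀ t → + ℓ ∣ α t
            ∣α (suc p) = ∣w p
            ∣α zero    = ∣-≡ (simplify (Bᵀ (λ p → q * w p) l₀) (α zero))
              (∣m∣n⇒∣m-n (∣qBᵀ l₀) (∣-Bᵀ (λ p → ∣n⇒∣m*n q (∣w p)) l₀))
              where
              simplify : ∀ x a → (x - - a) - x ≡ a
              simplify = solve-∀

-- Projective points and two-dimensional spans over a finite field.

module Vectors where

  open import Data.Fin.Base using (splitAt; join; finToFun; funToFin; combine; _↑ˡ_; _↑ʳ_)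
  open import Data.Vec.Functional using (Vector) renaming (_∷_ to _∷ᶠ_)
  open import Relation.Binary.PropositionalEquality as ≡ using (_≡_)
  import Algebra.Properties.CommutativeSemigroup as CommutativeSemigroupProperties

  -- The number [n]. This recursion mirrors that of `point`: q^n normalised vectors begin with 1,
  -- and the others lie in the hyperplane of first coordinate 0.
  repunit : ℕ → ℕ → ℕ
  repunit q zero    = 0
  repunit q (suc n) = q ℕ.^ n ℕ.+ repunit q n

  funToFin-cong : ∀ {m n} {f g : Fin m → Fin n} → (∀ i → f i ≡ g i) → funToFin f ≡ funToFin g
  funToFin-cong {zero}  e = ≡.refl
  funToFin-cong {suc m} e = ≡.cong₂ combine (e zero) (funToFin-cong (e ∘ suc))

  module FieldGeometry {c ℓ₁ : Level} {q : ℕ} (F : FiniteField c ℓ₁ q) where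

    open FiniteField F using (0≉1; inverse; cardinality)
    open CommutativeRing (FiniteField.commutativeRing F) hiding (zero)
    open CommutativeSemigroupProperties +-commutativeSemigroup using (interchange)
    open import Relation.Binary.Reasoning.Setoid setoid

    private
      infix 4 _≋F_
      _≋F_ : ∀ {n} → (x y : Vector Carrier n) → Set ℓ₁
      _≋F_ = _≋_ F

    element : Fin q → Carrier
    element = Inverse.from cardinality

    index : Carrier → Fin q
    index = Inverse.to cardinality

    element-index : ∀ x → element (index x) ≈ x
    element-index = Inverse.strictlyInverseʳ cardinality

    element-injective : ∀ {i j} → element i ≈ element j → i ≡ j
    element-injective {i} {j} e = ≡.trans (≡.sym (Inverse.strictlyInverseˡ cardinality i))
      (≡.trans (Inverse.to-cong cardinality e) (Inverse.strictlyInverseˡ cardinality j))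

    infix 4 _≟_
    _≟_ : ∀ x y → Dec (x ≈ y)
    x ≟ y = map′ (λ e → trans (sym (element-index x)) (trans (reflexive (≡.cong element e)) (element-index y)))
                 (Inverse.to-cong cardinality) (index x Fin.≟ index y)

    +≈0 : ∀ {x y} → x + - y ≈ 0# → x ≈ y
    +≈0 {x} {y} e = begin
      x                  ≈⟨ +-identityʳ x ⟨
      x + 0#             ≈⟨ +-congˡ (-‿inverseˡ y) ⟨
      x + (- y + y)      ≈⟨ +-assoc x (- y) y ⟨
      (x + - y) + y      ≈⟨ +-congʳ e ⟩
      0# + y             ≈⟨ +-identityˡ y ⟩
      y                  ∎

    rotate : ∀ a b x → a * b * x ≈ b * (a * x)
    rotate a b x = trans (*-congʳ (*-comm a b)) (*-assoc b a x)

    cancel-* : ∀ {a x} → ¬ (a ≈ 0#) → a * x ≈ 0# → x ≈ 0#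
    cancel-* {a} {x} a≉0 ax≈0 with inverse a a≉0
    ... | b , ab≈1 = begin
      x              ≈⟨ *-identityˡ x ⟨
      1# * x         ≈⟨ *-congʳ ab≈1 ⟨
      a * b * x      ≈⟨ rotate a b x ⟩
      b * (a * x)    ≈⟨ *-congˡ ax≈0 ⟩
      b * 0#         ≈⟨ zeroʳ b ⟩
      0#             ∎

    pair : Carrier → Carrier → Vector Carrier 2
    pair a b zero       = a
    pair a b (suc zero) = b

    module _ {n : ℕ} where
      infixl 7 _·_
      _·_ : Carrier → Vector Carrier n → Vector Carrier n
      (a · x) i = a * x i

      IsZero : Vector Carrier n → Set ℓ₁
      IsZero x = ∀ i → x i ≈ 0#

      isZero? : ∀ x → Dec (IsZero x)
      isZero? x = Fin.all? (λ i → x i ≟ 0#)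

      Multiple : Vector Carrier n → Vector Carrier n → Set (c ⊔ ℓ₁)
      Multiple x y = ∃ λ a → y ≋F a · x

      comb : Carrier → Vector Carrier n → Carrier → Vector Carrier n → Vector Carrier n
      comb a x b y i = a * x i + b * y i

      Span : Vector Carrier n → Vector Carrier n → Vector Carrier n → Set (c ⊔ ℓ₁)
      Span x y z = ∃₂ λ a b → z ≋F comb a x b y

    comb-+ : ∀ a b a′ b′ x y → (a * x + b * y) + (a′ * x + b′ * y) ≈ (a + a′) * x + (b + b′) * y
    comb-+ a b a′ b′ x y = trans (interchange (a * x) (b * y) (a′ * x) (b′ * y)) (+-cong (sym (distribʳ x a a′)) (sym (distribʳ y b b′)))

    comb-* : ∀ k a b x y → k * (a * x + b * y) ≈ (k * a) * x + (k * b) * y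
    comb-* k a b x y = trans (distribˡ k (a * x) (b * y)) (+-cong (sym (*-assoc k a x)) (sym (*-assoc k b y)))

    -- Points as vectors whose first nonzero coordinate is 1

    vec : ∀ n → Fin (q ℕ.^ n) → Vector Carrier n
    vec n i j = element (finToFun i j)

    vec-onto : ∀ {n} (x : Vector Carrier n) → ∃ λ i → vec n i ≋F x
    vec-onto {n} x = funToFin (index ∘ x) , λ j →
      trans (reflexive (≡.cong element (Fin.finToFun-funToFin (index ∘ x) j))) (element-index (x j))

    vec-injective : ∀ {n i j} → vec n i ≋F vec n j → i ≡ j
    vec-injective {n} {i} {j} e = ≡.trans (≡.sym (Fin.funToFin-finToFin {n} {q} i))
      (≡.trans (funToFin-cong (λ k → element-injective (e k))) (Fin.funToFin-finToFin {n} {q} j))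

    points : ℕ → ℕ
    points = repunit q

    point : ∀ n → Fin (points n) → Vector Carrier n
    point′ : ∀ n → Fin (q ℕ.^ n) ⊎ Fin (points n) → Vector Carrier (suc n)

    point zero ()
    point (suc n) p = point′ n (splitAt (q ℕ.^ n) p)

    point′ n (inj₁ i) = 1# ∷ᶠ vec n i
    point′ n (inj₂ p) = 0# ∷ᶠ point n p

    point-nonzero : ∀ {n} p → ¬ IsZero (point n p)
    point-nonzero {suc n} p e with splitAt (q ℕ.^ n) p
    ... | inj₁ _  = 0≉1 (sym (e zero))
    ... | inj₂ p′ = point-nonzero p′ (e ∘ suc)

    multiple-zero : ∀ {n a} {x y : Vector Carrier n} → a ≈ 0# → y ≋F a · x → IsZero y
    multiple-zero {x = x} a≈0 e i = trans (e i) (trans (*-congʳ a≈0) (zeroˡ (x i)))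

    -- Leading coefficients are normalised: two vectors beginning with 1 force the factor to be 1, a
    -- 1 against a 0 makes one of them zero or 0 equal to 1, and two zeros are removed.
    point-unique : ∀ {n} p p′ → Multiple (point n p) (point n p′) → p ≡ p′
    point-unique {suc n} p p′ m = ≡.trans (≡.sym (Fin.join-splitAt (q ℕ.^ n) (points n) p))
      (≡.trans (≡.cong (join (q ℕ.^ n) (points n)) (unique (splitAt _ p) (splitAt _ p′) m))
               (Fin.join-splitAt (q ℕ.^ n) (points n) p′))
      where
      unique : ∀ s s′ → Multiple (point′ n s) (point′ n s′) → s ≡ s′
      unique (inj₁ i) (inj₁ j) (a , e) = ≡.cong inj₁ (vec-injective {n} (λ k → sym (trans (e (suc k)) (trans (*-congʳ a≈1) (*-identityˡ _)))))
        where
        a≈1 : a ≈ 1#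
        a≈1 = trans (sym (*-identityʳ a)) (sym (e zero))
      unique (inj₁ i) (inj₂ p) (a , e) = contradiction
        (multiple-zero {a = a} {vec n i} (trans (sym (*-identityʳ a)) (sym (e zero))) (e ∘ suc)) (point-nonzero p)
      unique (inj₂ p) (inj₁ j) (a , e) = contradiction (sym (trans (e zero) (zeroʳ a))) 0≉1
      unique (inj₂ p) (inj₂ p′) (a , e) = ≡.cong inj₂ (point-unique p p′ (a , e ∘ suc))

    locate : ∀ {n} (x : Vector Carrier n) → ¬ IsZero x → ∃ λ p → Multiple (point n p) x
    locate {zero}  x x≉0 = contradiction (λ ()) x≉0
    locate {suc n} x x≉0 with x zero ≟ 0#
    ... | yes x₀≈0 = let p , a , e = locate (x ∘ suc) (λ e → x≉0 λ { zero → x₀≈0 ; (suc i) → e i })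
                     in q ℕ.^ n ↑ʳ p , a , at (Fin.splitAt-↑ʳ (q ℕ.^ n) (points n) p)
                          λ { zero → trans x₀≈0 (sym (zeroʳ a)) ; (suc i) → e i }
      where
      at : ∀ {p s a} → splitAt (q ℕ.^ n) p ≡ s → x ≋F a · point′ n s → x ≋F a · point (suc n) p
      at eq e rewrite eq = e
    ... | no  x₀≉0 = let b , x₀b≈1 = inverse (x zero) x₀≉0
                         i , e = vec-onto (b · (x ∘ suc))
                     in i ↑ˡ points n , x zero , at (Fin.splitAt-↑ˡ (q ℕ.^ n) i (points n))
                          λ { zero → sym (*-identityʳ (x zero))
                            ; (suc k) → begin
                                x (suc k)                     ≈⟨ *-identityˡ (x (suc k)) ⟨
                                1# * x (suc k)                ≈⟨ *-congʳ x₀b≈1 ⟨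
                                x zero * b * x (suc k)        ≈⟨ *-assoc (x zero) b (x (suc k)) ⟩
                                x zero * (b * x (suc k))      ≈⟨ *-congˡ (e k) ⟨
                                x zero * vec n i k            ∎ }
      where
      at : ∀ {p s a} → splitAt (q ℕ.^ n) p ≡ s → x ≋F a · point′ n s → x ≋F a · point (suc n) p
      at eq e rewrite eq = e

    multiple-scale : ∀ {n a} {x y : Vector Carrier n} → ¬ (a ≈ 0#) → y ≋F a · x → Multiple y x
    multiple-scale {a = a} {x} {y} a≉0 e with inverse a a≉0
    ... | b , ab≈1 = b , λ i → begin
      x i              ≈⟨ *-identityˡ (x i) ⟨
      1# * x i         ≈⟨ *-congʳ ab≈1 ⟨
      a * b * x i      ≈⟨ rotate a b (x i) ⟩
      b * (a * x i)    ≈⟨ *-congˡ (e i) ⟨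
      b * y i          ∎

    multiple-trans : ∀ {n} {x y z : Vector Carrier n} → Multiple x y → Multiple y z → Multiple x z
    multiple-trans {x = x} (a , e) (b , e′) = b * a , λ i →
      trans (e′ i) (trans (*-congˡ (e i)) (sym (*-assoc b a (x i))))

    multiple-nonzero : ∀ {n a} {x y : Vector Carrier n} → ¬ IsZero y → y ≋F a · x → ¬ (a ≈ 0#)
    multiple-nonzero {x = x} y≉0 e a≈0 = y≉0 (multiple-zero {x = x} a≈0 e)

    span-left : ∀ {n} (x y : Vector Carrier n) → Span x y x
    span-left x y = 1# , 0# , λ i → sym (trans (+-cong (*-identityˡ (x i)) (zeroˡ (y i))) (+-identityʳ (x i)))

    span-right : ∀ {n} (x y : Vector Carrier n) → Span x y y
    span-right x y = 0# , 1# , λ i → sym (trans (+-cong (zeroˡ (x i)) (*-identityˡ (y i))) (+-identityˡ (y i)))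

    span-swap : ∀ {n} {x y z : Vector Carrier n} → Span x y z → Span y x z
    span-swap (a , b , e) = b , a , λ i → trans (e i) (+-comm _ _)

    span-trans : ∀ {n} {u v x y z : Vector Carrier n} → Span u v x → Span u v y → Span x y z → Span u v z
    span-trans {u = u} {v} {x} {y} {z} (a , b , x≋) (a′ , b′ , y≋) (α , β , z≋) =
      α * a + β * a′ , α * b + β * b′ , λ i → begin
        z i                                                    ≈⟨ z≋ i ⟩
        α * x i + β * y i                                      ≈⟨ +-cong (*-congˡ (x≋ i)) (*-congˡ (y≋ i)) ⟩
        α * (a * u i + b * v i) + β * (a′ * u i + b′ * v i)
          ≈⟨ +-cong (comb-* α a b (u i) (v i)) (comb-* β a′ b′ (u i) (v i)) ⟩
        (α * a * u i + α * b * v i) + (β * a′ * u i + β * b′ * v i)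
          ≈⟨ comb-+ (α * a) (α * b) (β * a′) (β * b′) (u i) (v i) ⟩
        (α * a + β * a′) * u i + (α * b + β * b′) * v i        ∎

    -- Steinitz exchange, y = b⁻¹z - ab⁻¹x.
    span-exchange : ∀ {n a b} {x y z : Vector Carrier n} → ¬ (b ≈ 0#) → z ≋F comb a x b y → Span x z y
    span-exchange {a = a} {b} {x} {y} {z} b≉0 e with inverse b b≉0
    ... | b⁻¹ , bb⁻¹≈1 = - (a * b⁻¹) , b⁻¹ , λ i → sym (begin
      - (a * b⁻¹) * x i + b⁻¹ * z i                      ≈⟨ +-congˡ (*-congˡ (e i)) ⟩
      - (a * b⁻¹) * x i + b⁻¹ * (a * x i + b * y i)      ≈⟨ +-congˡ (comb-* b⁻¹ a b (x i) (y i)) ⟩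
      - (a * b⁻¹) * x i + (b⁻¹ * a * x i + b⁻¹ * b * y i)
        ≈⟨ +-congˡ (+-cong (*-congʳ (*-comm b⁻¹ a)) (*-congʳ (*-comm b⁻¹ b))) ⟩
      - (a * b⁻¹) * x i + (a * b⁻¹ * x i + b * b⁻¹ * y i)    ≈⟨ +-assoc _ _ _ ⟨
      (- (a * b⁻¹) * x i + a * b⁻¹ * x i) + b * b⁻¹ * y i    ≈⟨ +-congʳ (distribʳ (x i) (- (a * b⁻¹)) (a * b⁻¹)) ⟨
      (- (a * b⁻¹) + a * b⁻¹) * x i + (b * b⁻¹) * y i    ≈⟨ +-cong (*-congʳ (-‿inverseˡ (a * b⁻¹))) (*-congʳ bb⁻¹≈1) ⟩
      0# * x i + 1# * y i                                ≈⟨ +-cong (zeroˡ (x i)) (*-identityˡ (y i)) ⟩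
      0# + y i                                           ≈⟨ +-identityˡ (y i) ⟩
      y i                                                ∎)

    span-multiple : ∀ {n a b} {x y z : Vector Carrier n} → b ≈ 0# → z ≋F comb a x b y → Multiple x z
    span-multiple {a = a} {x = x} {y} b≈0 e = a , λ i →
      trans (e i) (trans (+-congˡ (trans (*-congʳ b≈0) (zeroˡ (y i)))) (+-identityʳ (a * x i)))

    -- Two exchanges: x replaces whichever of u, v occurs in it with nonzero coefficient, and y
    -- replaces the other one, since y is no multiple of x.
    span-of-two : ∀ {n} {u v x y : Vector Carrier n} → Span u v x → Span u v y → ¬ IsZero x → ¬ Multiple x y →
                  Span x y u × Span x y v
    span-of-two {n} {u} {v} {x} {y} (a , b , x≋) y∈ x≉0 x∦y with b ≟ 0#
    ... | no b≉0 = steps b≉0 x≋ y∈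
      where
      steps : ∀ {a b u v} → ¬ (b ≈ 0#) → x ≋F comb a u b v → Span u v y → Span x y u × Span x y v
      steps {a} {b} {u} {v} b≉0 x≋ y∈ = u∈ , span-trans u∈ (span-left x y) v∈
        where
        v∈ : Span u x v
        v∈ = span-exchange b≉0 x≋
        u∈ : Span x y u
        u∈ with span-swap (span-trans (span-left u x) v∈ y∈)
        ... | α , β , y≋ with β ≟ 0#
        ...   | yes β≈0 = contradiction (span-multiple β≈0 y≋) x∦y
        ...   | no  β≉0 = span-exchange β≉0 y≋
    ... | yes b≈0 = swapped
      where
      a≉0 : ¬ (a ≈ 0#)
      a≉0 a≈0 = x≉0 (multiple-zero {x = u} a≈0 (proj₂ (span-multiple b≈0 x≋)))

      swapped : Span x y u × Span x y v
      swapped with span-exchange {a = b} {a} {v} {u} a≉0 (λ i → trans (x≋ i) (+-comm _ _))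
      ... | u∈ = span-trans v∈ (span-left x y) u∈ , v∈
        where
        v∈ : Span x y v
        v∈ with span-swap (span-trans u∈ (span-left v x) y∈)
        ... | α , β , y≋ with β ≟ 0#
        ...   | yes β≈0 = contradiction (span-multiple β≈0 y≋) x∦y
        ...   | no  β≉0 = span-exchange β≉0 y≋

    independent-pair : ∀ {n a b} {x y : Vector Carrier n} → ¬ IsZero x → ¬ Multiple x y →
                       (∀ i → a * x i + b * y i ≈ 0#) → a ≈ 0# × b ≈ 0#
    independent-pair {n} {a} {b} {x} {y} x≉0 x∦y e with b ≟ 0#
    ... | no b≉0 with span-exchange b≉0 (λ i → sym (e i))
    ...   | α , β , y≋ = contradiction (α , λ i → trans (y≋ i) (trans (+-congˡ (zeroʳ β)) (+-identityʳ (α * x i)))) x∦y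
    independent-pair {n} {a} {b} {x} {y} x≉0 x∦y e | yes b≈0 with a ≟ 0#
    ... | yes a≈0 = a≈0 , b≈0
    ... | no  a≉0 = contradiction (λ i → cancel-* a≉0 (begin
      a * x i              ≈⟨ +-identityʳ (a * x i) ⟨
      a * x i + 0#         ≈⟨ +-congˡ (trans (*-congʳ b≈0) (zeroˡ (y i))) ⟨
      a * x i + b * y i    ≈⟨ e i ⟩
      0#                   ∎)) x≉0

    spanned : ∀ {n} (x y : Vector Carrier n) → Subspace F n
    spanned x y = record
      { Mem      = Span x y
      ; respects = λ { u≋v (a , b , e) → a , b , λ i → trans (sym (u≋v i)) (e i) }
      ; 0-mem    = 0# , 0# , λ i → sym (trans (+-cong (zeroˡ (x i)) (zeroˡ (y i))) (+-identityˡ 0#))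
      ; +-mem    = λ { {u} {v} (a , b , e) (a′ , b′ , e′) → a + a′ , b + b′ , λ i → trans (+-cong (e i) (e′ i))
                     (comb-+ a b a′ b′ (x i) (y i)) }
      ; *-mem    = λ { k (a , b , e) → k * a , k * b , λ i → trans (*-congˡ (e i))
                     (comb-* k a b (x i) (y i)) }
      }

    span-line : ∀ {n} (x y : Vector Carrier n) → ¬ IsZero x → ¬ Multiple x y → Setoid.Carrier (Grassmannian F n 2)
    span-line x y x≉0 x∦y = spanned x y , record
      { basis       = x ∷ᶠ y ∷ᶠ (λ ())
      ; basis-mem   = λ { zero → span-left x y ; (suc zero) → span-right x y }
      ; independent = λ α e → λ { zero       → proj₁ (independent-pair x≉0 x∦y (pad α e))
                                ; (suc zero) → proj₂ (independent-pair x≉0 x∦y (pad α e)) }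
      ; spanning    = λ { (a , b , e) → pair a b , λ i → trans (e i) (+-congˡ (sym (+-identityʳ _))) }
      }
      where
      pad : ∀ (α : Vector Carrier 2) → linearCombination F α (x ∷ᶠ y ∷ᶠ (λ ())) ≋F (λ _ → 0#) →
            ∀ i → α zero * x i + α (suc zero) * y i ≈ 0#
      pad α e i = trans (+-congˡ (sym (+-identityʳ _))) (e i)

    module _ {n} (line : Setoid.Carrier (Grassmannian F n 2)) where
      open Subspace (proj₁ line)
      open HasDimension (proj₂ line)

      b₀ b₁ : Vector Carrier n
      b₀ = basis zero
      b₁ = basis (suc zero)

      span⊆ : ∀ {x y z} → Mem x → Mem y → Span x y z → Mem z
      span⊆ x∈ y∈ (a , b , e) = respects (λ i → sym (e i)) (+-mem (*-mem a x∈) (*-mem b y∈))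

      mem⇒span-basis : ∀ {z} → Mem z → Span b₀ b₁ z
      mem⇒span-basis z∈ with spanning z∈
      ... | α , e = α zero , α (suc zero) , λ i → trans (e i) (+-congˡ (+-identityʳ _))

      abstract
        mem? : ∀ z → Dec (Mem z)
        mem? z = map′ (λ { (i , j , e) → span⊆ (basis-mem zero) (basis-mem (suc zero)) (element i , element j , e) })
                      (λ z∈ → let a , b , e = mem⇒span-basis z∈ in index a , index b , λ k →
                         trans (e k) (sym (+-cong (*-congʳ (element-index a)) (*-congʳ (element-index b)))))
                      (Fin.any? λ i → Fin.any? λ j → Fin.all? λ k → z k ≟ comb (element i) b₀ (element j) b₁ k)

      mem⇒span : ∀ {x y z} → Mem x → Mem y → ¬ IsZero x → ¬ Multiple x y → Mem z → Span x y z
      mem⇒span x∈ y∈ x≉0 x∦y z∈ =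
        let u∈ , v∈ = span-of-two (mem⇒span-basis x∈) (mem⇒span-basis y∈) x≉0 x∦y
        in span-trans u∈ v∈ (mem⇒span-basis z∈)

      basis-unique : ∀ {s t s′ t′} → (∀ i → comb s b₀ t b₁ i ≈ comb s′ b₀ t′ b₁ i) → s ≈ s′ × t ≈ t′
      basis-unique {s} {t} {s′} {t′} e = +≈0 (zeros zero) , +≈0 (zeros (suc zero))
        where
        zeros : ∀ i → (pair (s + - s′) (t + - t′)) i ≈ 0#
        zeros = independent (pair (s + - s′) (t + - t′)) λ i → begin
          (s + - s′) * b₀ i + ((t + - t′) * b₁ i + 0#)        ≈⟨ +-congˡ (+-identityʳ _) ⟩
          (s + - s′) * b₀ i + (t + - t′) * b₁ i        ≈⟨ comb-+ s t (- s′) (- t′) (b₀ i) (b₁ i) ⟨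
          (s * b₀ i + t * b₁ i) + (- s′ * b₀ i + - t′ * b₁ i)        ≈⟨ +-congʳ (e i) ⟩
          (s′ * b₀ i + t′ * b₁ i) + (- s′ * b₀ i + - t′ * b₁ i)    ≈⟨ comb-+ s′ t′ (- s′) (- t′) (b₀ i) (b₁ i) ⟩
          (s′ + - s′) * b₀ i + (t′ + - t′) * b₁ i             ≈⟨ +-cong (*-congʳ (-‿inverseʳ s′)) (*-congʳ (-‿inverseʳ t′)) ⟩
          0# * b₀ i + 0# * b₁ i                               ≈⟨ +-cong (zeroˡ (b₀ i)) (zeroˡ (b₁ i)) ⟩
          0# + 0#                                             ≈⟨ +-identityˡ 0# ⟩
          0#                                                  ∎

-- Incidences of points and lines, and pencils of lines in a plane.

module Lines where

  open LinearForms
  open SmithForms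
  open IncidenceBounds
  open Vectors
  open import Data.Integer.Base using (+_; _+_; _*_; -_; _-_)
  open import Data.Integer.Tactic.RingSolver using (solve-∀)
  open import Data.Vec.Functional using (Vector)
  open import Relation.Binary.PropositionalEquality
    using (_≡_; _≢_; refl; sym; trans; cong; cong₂; subst; module ≡-Reasoning)
  open import Algebra.Properties.Semiring.Sum ℤ.+-*-semiring
    using (sum; sum-cong-≗; ∑-comm; *-distribˡ-sum; *-distribʳ-sum)
  open ≡-Reasoning

  indicator : ∀ {a} {A : Set a} → Dec A → ℤ
  indicator A? = if does A? then 1ℤ else 0ℤ

  indicator-yes : ∀ {a} {A : Set a} (A? : Dec A) → A → indicator A? ≡ 1ℤ
  indicator-yes A? a = cong (if_then 1ℤ else 0ℤ) (dec-true A? a)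

  indicator-no : ∀ {a} {A : Set a} (A? : Dec A) → ¬ A → indicator A? ≡ 0ℤ
  indicator-no A? ¬a = cong (if_then 1ℤ else 0ℤ) (dec-false A? ¬a)

  indicator-idem : ∀ {a} {A : Set a} (A? : Dec A) → indicator A? * indicator A? ≡ indicator A?
  indicator-idem (yes _) = refl
  indicator-idem (no  _) = refl

  indicator-disjoint : ∀ {a b} {A : Set a} {B : Set b} (A? : Dec A) (B? : Dec B) → ¬ (A × B) →
                       indicator A? * indicator B? ≡ 0ℤ
  indicator-disjoint (no  _) _       _   = refl
  indicator-disjoint (yes _) (no _)  _   = refl
  indicator-disjoint (yes a) (yes b) ¬ab = contradiction (a , b) ¬ab

  indicator-⇔ : ∀ {a b} {A : Set a} {B : Set b} (A? : Dec A) (B? : Dec B) → (A → B) → (B → A) → indicator A? ≡ indicator B?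
  indicator-⇔ A? (yes b) _   b⇒a = indicator-yes A? (b⇒a b)
  indicator-⇔ A? (no ¬b) a⇒b _   = indicator-no A? (¬b ∘ a⇒b)

  -- A point with property `P` is hit by exactly one index, so the indicator is a sum of Kronecker
  -- deltas at the values of `φ`; exchanging the sums counts the indices.
  sum-indicator : ∀ {m k a} {P : Fin m → Set a} (P? : ∀ p → Dec (P p)) (φ : Fin k → Fin m) →
                  (∀ {j j′} → φ j ≡ φ j′ → j ≡ j′) → (∀ j → P (φ j)) → (∀ p → P p → ∃ λ j → φ j ≡ p) →
                  sum (λ p → indicator (P? p)) ≡ + k
  sum-indicator {m} {k} P? φ φ-injective P-φ φ-onto = begin
    sum (λ p → indicator (P? p))                     ≡⟨ sum-cong-≗ fibre ⟩
    sum (λ p → sum (λ j → identity (φ j) p))         ≡⟨ ∑-comm (λ p j → identity (φ j) p) ⟩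
    sum (λ j → sum (λ p → identity (φ j) p))
      ≡⟨ sum-cong-≗ (λ j → trans (sum-cong-≗ (λ p → sym (ℤ.*-identityʳ (identity (φ j) p)))) (sum-identity (φ j) (λ _ → 1ℤ))) ⟩
    sum {k} (λ j → 1ℤ)                               ≡⟨ trans (sum-const k 1ℤ) (ℤ.*-identityʳ (+ k)) ⟩
    + k                                              ∎
    where
    fibre : ∀ p → indicator (P? p) ≡ sum (λ j → identity (φ j) p)
    fibre p with P? p
    ... | no  ¬Pp = sym (sum-zero (λ j → diagonal-≢ (λ _ → 1) {φ j} {p} λ e → ¬Pp (subst _ e (P-φ j))))
    ... | yes Pp with φ-onto p Pp
    ...   | j , refl = sym (trans (sum-single j (λ j′ j′≢j → diagonal-≢ (λ _ → 1) (j′≢j ∘ φ-injective))) (diagonal-≡ (λ _ → 1) (φ j)))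

  module LineGeometry {c ℓ₁ : Level} {q : ℕ} (F : FiniteField c ℓ₁ q)
    {n N : ℕ} (vertices : HasCardinality (Grassmannian F n 2) N) where

    open FieldGeometry F
    open Inverse vertices using (to; from; to-cong; strictlyInverseˡ; strictlyInverseʳ)

    private
      module F = FiniteField F
      Vec : Set c
      Vec = Vector F.Carrier n

    m : ℕ
    m = points n

    Through : Fin N → Vec → Set (c ⊔ ℓ₁)
    Through l = Subspace.Mem (proj₁ (from l))

    On : Fin m → Fin N → Set (c ⊔ ℓ₁)
    On p l = Through l (point n p)

    on? : ∀ p l → Dec (On p l)
    on? p l = mem? (from l) (point n p)

    B : Fin m → Fin N → ℤ
    B p l = indicator (on? p l)

    line-through : ∀ x y → ¬ IsZero x → ¬ Multiple x y → ∃ λ l → ∀ z → Through l z ⇔ Span x y z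
    line-through x y x≉0 x∦y = to (span-line x y x≉0 x∦y) , strictlyInverseʳ (span-line x y x≉0 x∦y)

    line-unique : ∀ {l l′ x y} → ¬ IsZero x → ¬ Multiple x y →
                  Through l x → Through l y → Through l′ x → Through l′ y → l ≡ l′
    line-unique {l} {l′} x≉0 x∦y x∈l y∈l x∈l′ y∈l′ =
      trans (sym (strictlyInverseˡ l)) (trans (to-cong λ z → mk⇔
        (λ z∈l  → span⊆ (from l′) x∈l′ y∈l′ (mem⇒span (from l) x∈l y∈l x≉0 x∦y z∈l))
        (λ z∈l′ → span⊆ (from l) x∈l y∈l (mem⇒span (from l′) x∈l′ y∈l′ x≉0 x∦y z∈l′))) (strictlyInverseˡ l′))

    distinct : ∀ {p p′} → p ≢ p′ → ¬ Multiple (point n p) (point n p′)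
    distinct p≢p′ mult = p≢p′ (point-unique _ _ mult)

    through-multiple : ∀ {l x y} → Multiple x y → Through l x → Through l y
    through-multiple {l} (a , e) x∈l =
      Subspace.respects (proj₁ (from l)) (λ i → F.sym (e i)) (Subspace.*-mem (proj₁ (from l)) a x∈l)

    locate-on : ∀ l x → ¬ IsZero x → Through l x → ∃ λ p → On p l × Multiple (point n p) x
    locate-on l x x≉0 x∈l = let p , a , e = locate x x≉0 in
      p , through-multiple {l} (multiple-scale (multiple-nonzero {x = point n p} x≉0 e) e) x∈l , a , e

    -- Coordinates in the basis of the line identify its points with the points of the plane F².
    -- Normalised coordinates need not give a normalised vector, so `locate-on` passes to the
    -- representative of the same point.
    points-on-line : ∀ l → sum (λ p → B p l) ≡ + points 2
    points-on-line l = sum-indicator (λ p → on? p l) φ φ-injective (proj₁ ∘ proj₂ ∘ located) φ-onto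
      where
      basis : Vec × Vec
      basis = b₀ (from l) , b₁ (from l)

      on-basis : Vector F.Carrier 2 → Vec
      on-basis α = comb (α zero) (proj₁ basis) (α (suc zero)) (proj₂ basis)

      on-basis∈ : ∀ α → Through l (on-basis α)
      on-basis∈ α = span⊆ (from l) (HasDimension.basis-mem (proj₂ (from l)) zero)
        (HasDimension.basis-mem (proj₂ (from l)) (suc zero)) (α zero , α (suc zero) , λ i → F.refl)

      on-basis-nonzero : ∀ α → ¬ IsZero α → ¬ IsZero (on-basis α)
      on-basis-nonzero α α≉0 e = α≉0 (HasDimension.independent (proj₂ (from l)) α
        (λ i → F.trans (CommutativeRing.+-congˡ F.commutativeRing (CommutativeRing.+-identityʳ F.commutativeRing _)) (e i)))

      located : ∀ j → ∃ λ p → On p l × Multiple (point n p) (on-basis (point 2 j))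
      located j = locate-on l (on-basis (point 2 j)) (on-basis-nonzero (point 2 j) (point-nonzero j)) (on-basis∈ (point 2 j))

      φ : Fin (points 2) → Fin m
      φ j = proj₁ (located j)

      scale-basis : ∀ a α i → (a · on-basis α) i F.≈ on-basis (a · α) i
      scale-basis a α i = comb-* a (α zero) (α (suc zero)) _ _

      pull-back : ∀ {α β} → Multiple (on-basis α) (on-basis β) → Multiple α β
      pull-back {α} {β} (a , e) = a , λ { zero → proj₁ coordinates ; (suc zero) → proj₂ coordinates }
        where
        coordinates : _
        coordinates = basis-unique (from l) (λ i → F.trans (e i) (scale-basis a α i))

      φ-injective : ∀ {j j′} → φ j ≡ φ j′ → j ≡ j′
      φ-injective {j} {j′} e = point-unique j j′ (pull-back (multiple-trans
        (multiple-scale (multiple-nonzero {x = point n (φ j)} (on-basis-nonzero (point 2 j) (point-nonzero j)) (proj₂ (proj₂ (proj₂ (located j)))))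
                        (proj₂ (proj₂ (proj₂ (located j)))))
        (subst (λ p → Multiple (point n p) (on-basis (point 2 j′))) (sym e) (proj₂ (proj₂ (located j′))))))

      φ-onto : ∀ p → On p l → ∃ λ j → φ j ≡ p
      φ-onto p p∈l with mem⇒span-basis (from l) p∈l
      ... | s , t , e with isZero? (pair s t)
      ...   | yes st≈0 = contradiction (λ i → F.trans (e i) (F.trans
                (CommutativeRing.+-cong F.commutativeRing
                  (F.trans (F.*-congʳ (st≈0 zero)) (CommutativeRing.zeroˡ F.commutativeRing _))
                  (F.trans (F.*-congʳ (st≈0 (suc zero))) (CommutativeRing.zeroˡ F.commutativeRing _)))
                (CommutativeRing.+-identityˡ F.commutativeRing _))) (point-nonzero p)
      ...   | no st≉0 with locate (pair s t) st≉0
      ...     | j , a , e′ = j , point-unique (φ j) p (multiple-trans (proj₂ (proj₂ (located j)))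
                (a , λ i → F.trans (e i) (F.trans
                  (CommutativeRing.+-cong F.commutativeRing (F.*-congʳ (e′ zero)) (F.*-congʳ (e′ (suc zero))))
                  (F.sym (scale-basis a (point 2 j) i)))))

    joining : ∀ {p p′} → p ≢ p′ → ∃ λ l → On p l × On p′ l
    joining {p} {p′} p≢p′ =
      let l , on⇔ = line-through (point n p) (point n p′) (point-nonzero p) (distinct p≢p′)
      in l , Equivalence.from (on⇔ _) (span-left _ _) , Equivalence.from (on⇔ _) (span-right _ _)

    joining-line-count : ∀ {p p′} → p ≢ p′ → sum (λ l → B p l * B p′ l) ≡ 1ℤ
    joining-line-count {p} {p′} p≢p′ with joining p≢p′
    ... | l , p∈l , p′∈l = trans (sum-single l others) (cong₂ _*_ (indicator-yes (on? p l) p∈l) (indicator-yes (on? p′ l) p′∈l))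
      where
      others : ∀ l′ → l′ ≢ l → B p l′ * B p′ l′ ≡ 0ℤ
      others l′ l′≢l = indicator-disjoint (on? p l′) (on? p′ l′) λ (p∈l′ , p′∈l′) →
        l′≢l (line-unique (point-nonzero p) (distinct p≢p′) p∈l′ p′∈l′ p∈l p′∈l)

    joining-lines : ∀ p p′ → sum (λ l → B p l * B p′ l) ≡ 1ℤ + (sum (B p) - 1ℤ) * identity p p′
    joining-lines p p′ with p Fin.≟ p′
    ... | yes refl = trans (sum-cong-≗ (λ l → indicator-idem (on? p l))) (simplify (sum (B p)))
      where
      simplify : ∀ a → a ≡ 1ℤ + (a - 1ℤ) * 1ℤ
      simplify = solve-∀
    ... | no p≢p′ = trans (joining-line-count p≢p′) (simplify (sum (B p)))
      where
      simplify : ∀ a → 1ℤ ≡ 1ℤ + (a - 1ℤ) * 0ℤ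
      simplify = solve-∀

    -- Counting the flags (p′ , l) with p on l.
    lines-through-count : ∀ p → (+ points 2 - 1ℤ) * sum (B p) ≡ + m - 1ℤ
    lines-through-count p = begin
      (+ points 2 - 1ℤ) * sum (B p)                            ≡⟨ expand (+ points 2) (sum (B p)) ⟩
      sum (B p) * + points 2 - sum (B p)                       ≡⟨ cong (_- sum (B p)) (sym by-lines) ⟩
      sum (λ p′ → sum (λ l → B p l * B p′ l)) - sum (B p)      ≡⟨ cong (_- sum (B p)) by-points ⟩
      + m + (sum (B p) - 1ℤ) - sum (B p)                       ≡⟨ simplify (+ m) (sum (B p)) ⟩
      + m - 1ℤ                                                 ∎
      where
      expand : ∀ k a → (k - 1ℤ) * a ≡ a * k - a
      expand = solve-∀
      simplify : ∀ m a → m + (a - 1ℤ) - a ≡ m - 1ℤ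
      simplify = solve-∀

      by-lines : sum (λ p′ → sum (λ l → B p l * B p′ l)) ≡ sum (B p) * + points 2
      by-lines = begin
        sum (λ p′ → sum (λ l → B p l * B p′ l))    ≡⟨ ∑-comm (λ p′ l → B p l * B p′ l) ⟩
        sum (λ l → sum (λ p′ → B p l * B p′ l))    ≡⟨ sum-cong-≗ (λ l → sym (*-distribˡ-sum (B p l) (λ p′ → B p′ l))) ⟩
        sum (λ l → B p l * sum (λ p′ → B p′ l))    ≡⟨ sum-cong-≗ (λ l → cong (B p l *_) (points-on-line l)) ⟩
        sum (λ l → B p l * + points 2)             ≡⟨ *-distribʳ-sum (+ points 2) (B p) ⟨
        sum (B p) * + points 2                     ∎

      by-points : sum (λ p′ → sum (λ l → B p l * B p′ l)) ≡ + m + (sum (B p) - 1ℤ)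
      by-points = begin
        sum (λ p′ → sum (λ l → B p l * B p′ l))                      ≡⟨ sum-cong-≗ (joining-lines p) ⟩
        sum (λ p′ → 1ℤ + (sum (B p) - 1ℤ) * identity p p′)           ≡⟨ axpy sum-linear (λ _ → 1ℤ) (sum (B p) - 1ℤ) (identity p) ⟩
        sum {m} (λ _ → 1ℤ) + (sum (B p) - 1ℤ) * sum (identity p)
          ≡⟨ cong₂ (λ a b → a + (sum (B p) - 1ℤ) * b) (trans (sum-const m 1ℤ) (ℤ.*-identityʳ (+ m)))
               (trans (sum-cong-≗ (λ p′ → sym (ℤ.*-identityʳ (identity p p′)))) (sum-identity p (λ _ → 1ℤ))) ⟩
        + m + (sum (B p) - 1ℤ) * 1ℤ                                  ≡⟨ cong (λ z → + m + z) (ℤ.*-identityʳ (sum (B p) - 1ℤ)) ⟩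
        + m + (sum (B p) - 1ℤ)                                       ∎

    -- Counts all incident pairs of a point and a line in two ways.
    line-count : ∀ R → (∀ p → sum (B p) ≡ R) → + m * R ≡ + N * + points 2
    line-count R rows = begin
      + m * R                                ≡⟨ sum-const m R ⟨
      sum {m} (λ _ → R)                      ≡⟨ sum-cong-≗ (λ p → sym (rows p)) ⟩
      sum (λ p → sum (λ l → B p l))          ≡⟨ ∑-comm (λ p l → B p l) ⟩
      sum (λ l → sum (λ p → B p l))          ≡⟨ sum-cong-≗ points-on-line ⟩
      sum {N} (λ _ → + points 2)             ≡⟨ sum-const N (+ points 2) ⟩
      + N * + points 2                       ∎

    private
      skew⇒disjoint : ∀ {l l′} → Skew F (from l) (from l′) → ∀ p → ¬ (On p l × On p l′)
      skew⇒disjoint skew p (p∈l , p∈l′) = point-nonzero p (skew (point n p) p∈l p∈l′)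

      disjoint⇒skew : ∀ {l l′} → (∀ p → ¬ (On p l × On p l′)) → Skew F (from l) (from l′)
      disjoint⇒skew {l} {l′} disjoint x x∈l x∈l′ with isZero? x
      ... | yes x≈0 = x≈0
      ... | no  x≉0 = let p , p∈l , a , e = locate-on l x x≉0 x∈l in contradiction
        (p∈l , through-multiple {l′} (multiple-scale (multiple-nonzero {x = point n p} x≉0 e) e) x∈l′) (disjoint p)

    common-points : ∀ {l l′} → l ≢ l′ → sum (λ p → B p l * B p l′) ≡ 1ℤ - adjacencyMatrix F vertices l l′
    common-points {l} {l′} l≢l′ = meet (Fin.any? (λ p → on? p l ×-dec on? p l′))
      where
      meet : Dec (∃ λ p → On p l × On p l′) → sum (λ p → B p l * B p l′) ≡ 1ℤ - adjacencyMatrix F vertices l l′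
      meet (no none) = trans
        (sum-zero λ p → indicator-disjoint (on? p l) (on? p l′) (λ on → none (p , on)))
        (cong (λ z → 1ℤ - z) (sym (indicator-yes (skew? F (from l) (from l′)) (disjoint⇒skew {l} {l′} (λ p on → none (p , on))))))
      meet (yes (p , p∈l , p∈l′)) = trans
        (trans (sum-single p others) (cong₂ _*_ (indicator-yes (on? p l) p∈l) (indicator-yes (on? p l′) p∈l′)))
        (cong (λ z → 1ℤ - z) (sym (indicator-no (skew? F (from l) (from l′)) (λ skew → skew⇒disjoint {l} {l′} skew p (p∈l , p∈l′)))))
        where
        others : ∀ p′ → p′ ≢ p → B p′ l * B p′ l′ ≡ 0ℤ
        others p′ p′≢p = indicator-disjoint (on? p′ l) (on? p′ l′) λ (p′∈l , p′∈l′) →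
          l≢l′ (line-unique (point-nonzero p) (distinct (p′≢p ∘ sym)) p∈l p′∈l p∈l′ p′∈l′)

    not-self-skew : ∀ l → adjacencyMatrix F vertices l l ≡ 0ℤ
    not-self-skew l = indicator-no (skew? F (from l) (from l)) λ skew →
      basis-nonzero (skew (b₀ (from l)) (basis-mem zero) (basis-mem zero))
      where
      open HasDimension (proj₂ (from l)) using (basis-mem; independent)
      basis-nonzero : ¬ IsZero (b₀ (from l))
      basis-nonzero e = FiniteField.0≉1 F (F.sym (independent (pair F.1# F.0#)
        (λ i → F.trans (+-cong (F.trans (*-identityˡ _) (e i)) (F.trans (+-identityʳ _) (zeroˡ _))) (+-identityʳ _)) zero))
        where open CommutativeRing F.commutativeRing using (+-cong; *-identityˡ; +-identityʳ; zeroˡ)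

    -- Differences of points as combinations of lines: in the plane spanned by
    -- x, y and k, the lines through x other than xy and the lines through y
    -- other than xy cover the same points off the line xy exactly once.
    module Pencil (x y k : Vec) (x≉0 : ¬ IsZero x) (x∦y : ¬ Multiple x y) (k∉xy : ¬ Span x y k) where

      private
        module K = CommutativeRing F.commutativeRing

        sub-span : ∀ {w z} → (∀ i → z i F.≈ k i F.⊕ w i) → Span z w k
        sub-span {w} {z} e = F.1# , K.- F.1# , λ i → F.sym
          (F.trans (K.+-cong (F.trans (K.*-identityˡ (z i)) (e i)) (-1*x≈-x (w i)))
          (F.trans (K.+-assoc (k i) (w i) (K.- w i))
          (F.trans (K.+-congˡ (K.-‿inverseʳ (w i))) (K.+-identityʳ (k i)))))
          where open import Algebra.Properties.Ring K.ring using (-1*x≈-x)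

      -- As t runs through the field, x and k + ty span the q lines through x in the plane other
      -- than xy.
      direction : Fin q → Vec
      direction t i = k i F.⊕ element t F.⊙ y i

      private
        y-span : ∀ t → Span x y (element t · y)
        y-span t = F.0# , element t , λ i → F.sym (F.trans (K.+-congʳ (K.zeroˡ (x i))) (K.+-identityˡ _))

        direction∉ : ∀ t → ¬ Span x y (direction t)
        direction∉ t d∈ = k∉xy (span-trans d∈ (y-span t) (sub-span {element t · y} (λ i → F.refl)))

        x∦direction : ∀ t → ¬ Multiple x (direction t)
        x∦direction t (a , e) = direction∉ t (a , F.0# , λ i → F.trans (e i)
          (F.sym (F.trans (K.+-congˡ (K.zeroˡ (y i))) (K.+-identityʳ _))))

      line : Fin q → Fin N
      line t = proj₁ (line-through x (direction t) x≉0 (x∦direction t))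

      private
        on-line : ∀ t z → Through (line t) z ⇔ Span x (direction t) z
        on-line t = proj₂ (line-through x (direction t) x≉0 (x∦direction t))

        x∈line : ∀ t → Through (line t) x
        x∈line t = Equivalence.from (on-line t x) (span-left x (direction t))

        y∉line : ∀ t → ¬ Through (line t) y
        y∉line t y∈ with Equivalence.to (on-line t y) y∈
        ... | a , b , e with b ≟ F.0#
        ...   | yes b≈0 = x∦y (span-multiple {y = direction t} b≈0 e)
        ...   | no  b≉0 = direction∉ t (span-exchange b≉0 e)

      -- The points of the plane off the line xy, each scaled from a vector k + ty + sx. The
      -- description is symmetric in x and y, so the pencils at x and at y refer to the same set.
      Off : Fin m → Set ℓ₁
      Off p = ∃ λ t → ∃ λ s → ∃ λ a → ∀ i → point n p i F.≈ (element a · (λ i → k i F.⊕ comb (element t) y (element s) x i)) i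

      off? : ∀ p → Dec (Off p)
      off? p = Fin.any? λ t → Fin.any? λ s → Fin.any? λ a → Fin.all? λ i → _ ≟ _

      private
        -- A line carrying two directions contains their difference, a nonzero multiple of y,
        -- although y lies on no line of the pencil.
        same-line : ∀ {t t′} → line t ≡ line t′ → t ≡ t′
        same-line {t} {t′} e with element t ≟ element t′
        ... | yes e′ = element-injective e′
        ... | no  t≉t′ = contradiction y∈ (y∉line t)
          where
          U = proj₁ (from (line t))
          d′∈ : Through (line t) (direction t′)
          d′∈ = subst (λ l → Through l (direction t′)) (sym e) (Equivalence.from (on-line t′ _) (span-right x (direction t′)))
          d∈ : Through (line t) (direction t)
          d∈ = Equivalence.from (on-line t _) (span-right x (direction t))
          δ : F.Carrier
          δ = element t K.+ K.- element t′
          δ≉0 : ¬ (δ F.≈ F.0#)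
          δ≉0 δ≈0 = t≉t′ (+≈0 δ≈0)
          open import Algebra.Properties.Ring K.ring using (-1*x≈-x; -‿distribˡ-*; -‿+-comm)
          open import Algebra.Properties.CommutativeSemigroup K.+-commutativeSemigroup using (interchange)
          difference : ∀ i → direction t i F.⊕ K.- F.1# F.⊙ direction t′ i F.≈ δ F.⊙ y i
          difference i = F.trans (K.+-congˡ (F.trans (-1*x≈-x _) (F.sym (-‿+-comm (k i) (element t′ F.⊙ y i)))))
            (F.trans (interchange (k i) (element t F.⊙ y i) (K.- k i) (K.- (element t′ F.⊙ y i)))
            (F.trans (K.+-cong (K.-‿inverseʳ (k i)) (K.+-congˡ (-‿distribˡ-* (element t′) (y i))))
            (F.trans (K.+-identityˡ _) (F.sym (K.distribʳ (y i) (element t) (K.- element t′))))))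
          y∈ : Through (line t) y
          y∈ = through-multiple {line t} (multiple-scale δ≉0 (λ i → F.refl))
            (Subspace.respects U difference (Subspace.+-mem U d∈ (Subspace.*-mem U (K.- F.1#) d′∈)))

      module _ (p₁ : Fin m) (x≡ : point n p₁ ≡ x) where
        private
          x∉off : ¬ Off p₁
          x∉off (t , s , a , e) = k∉xy (span-trans
            (b , F.0# , λ i → F.trans (e″ i) (F.sym (F.trans (K.+-congˡ (K.zeroˡ (y i))) (K.+-identityʳ _))))
            (span-swap (element t , element s , λ i → F.refl))
            (sub-span {comb (element t) y (element s) x} (λ i → F.refl)))
            where
            z : Vec
            z i = k i F.⊕ comb (element t) y (element s) x i
            e′ : ∀ i → x i F.≈ (element a · z) i
            e′ i = subst (λ x → x i F.≈ (element a · z) i) x≡ (e i)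
            mult : Multiple x z
            mult = multiple-scale (multiple-nonzero {x = z} x≉0 e′) e′
            b : F.Carrier
            b = proj₁ mult
            e″ : ∀ i → z i F.≈ (b · x) i
            e″ = proj₂ mult

          through⇒off : ∀ {p} → p ≢ p₁ → ∀ t → On p (line t) → Off p
          through⇒off {p} p≢p₁ t p∈ with Equivalence.to (on-line t _) p∈
          ... | α , β , e with β ≟ F.0#
          ...   | yes β≈0 = contradiction (sym (point-unique p₁ p (subst (λ x → Multiple x (point n p)) (sym x≡)
                              (span-multiple {y = direction t} β≈0 e)))) p≢p₁
          ...   | no  β≉0 = let γ , βγ≈1 = FiniteField.inverse F β β≉0 in
            t , index (γ F.⊙ α) , index β , λ i → F.trans (e i) (F.trans (value γ βγ≈1 i)
              (K.*-cong (F.sym (element-index β)) (K.+-congˡ (K.+-congˡ (K.*-congʳ (F.sym (element-index (γ F.⊙ α))))))))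
            where
            value : ∀ γ → β F.⊙ γ F.≈ F.1# → ∀ i →
                    α F.⊙ x i F.⊕ β F.⊙ direction t i F.≈ β F.⊙ (k i F.⊕ (element t F.⊙ y i F.⊕ γ F.⊙ α F.⊙ x i))
            value γ βγ≈1 i = F.trans (K.+-comm _ _) (F.trans (K.+-congˡ (F.sym
              (F.trans (F.sym (K.*-assoc β (γ F.⊙ α) (x i))) (K.*-congʳ
                (F.trans (F.sym (K.*-assoc β γ α)) (F.trans (K.*-congʳ βγ≈1) (K.*-identityˡ α)))))))
              (F.trans (F.sym (K.distribˡ β (direction t i) (γ F.⊙ α F.⊙ x i)))
                       (K.*-congˡ (K.+-assoc (k i) (element t F.⊙ y i) (γ F.⊙ α F.⊙ x i)))))

          off⇒through : ∀ {p} ((t , _) : Off p) → On p (line t)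
          off⇒through {p} (t , s , a , e) = Equivalence.from (on-line t _)
            (element a F.⊙ element s , element a , λ i → F.trans (e i) (F.sym (F.trans (K.+-comm _ _)
              (F.trans (K.+-congˡ (K.*-assoc (element a) (element s) (x i)))
              (F.trans (F.sym (K.distribˡ (element a) (direction t i) (element s F.⊙ x i)))
                       (K.*-congˡ (K.+-assoc (k i) _ _)))))))

        -- All q lines pass through the centre, which is not in `Off`; any other point is on at most
        -- one of them, and on one exactly if it is in `Off`.
        pencil-count : ∀ p → sum (λ t → B p (line t)) ≡ + q * identity p p₁ + indicator (off? p)
        pencil-count p with p Fin.≟ p₁
        ... | yes refl = trans (sum-cong-≗ (λ t → indicator-yes (on? p (line t)) (subst (Through (line t)) (sym x≡) (x∈line t))))
          (trans (sum-const q 1ℤ) (trans (sym (ℤ.+-identityʳ _)) (cong (λ z → + q * 1ℤ + z) (sym (indicator-no (off? p) x∉off)))))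
        ... | no p≢p₁ = trans (count-off (off? p)) (sym (trans (cong (_+ indicator (off? p)) (ℤ.*-zeroʳ (+ q))) (ℤ.+-identityˡ _)))
          where
          count-off : (d : Dec (Off p)) → sum (λ t → B p (line t)) ≡ indicator d
          count-off (no ¬off) = sum-zero λ t → indicator-no (on? p (line t)) (¬off ∘ through⇒off p≢p₁ t)
          count-off (yes off@(t , _)) = trans
            (sum-single t λ t′ t′≢t → indicator-no (on? p (line t′)) λ p∈ → t′≢t (same-line
              (line-unique (point-nonzero p₁) (distinct (p≢p₁ ∘ sym))
                (subst (Through (line t′)) (sym x≡) (x∈line t′)) p∈
                (subst (Through (line t)) (sym x≡) (x∈line t)) (off⇒through off))))
            (indicator-yes (on? p (line t)) (off⇒through off))

-- Differences of points in the image of B, and the entries of L.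

module Planes where

  open LinearForms
  open SmithForms
  open IncidenceBounds
  open Vectors
  open Lines
  open import Data.Integer.Base using (+_; _+_; _*_; -_; _-_)
  open import Data.Integer.Tactic.RingSolver using (solve-∀)
  import Data.Nat.Properties as ℕ
  open import Data.Vec.Functional using (Vector)
  open import Relation.Binary.PropositionalEquality
    using (_≡_; _≢_; refl; sym; trans; cong; cong₂; module ≡-Reasoning)
  open import Algebra.Properties.Semiring.Sum ℤ.+-*-semiring
    using (sum; sum-cong-≗; ∑-comm; *-distribˡ-sum)
  open ≡-Reasoning

  module LineDifferences {c ℓ₁ : Level} {q : ℕ} (F : FiniteField c ℓ₁ q)
    {n N : ℕ} (vertices : HasCardinality (Grassmannian F n 2) N) where

    open FieldGeometry F
    open LineGeometry F vertices
    private
      module K = CommutativeRing (FiniteField.commutativeRing F)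

    point-off-line : points 2 ≢ m → ∀ l → ∃ λ p → ¬ On p l
    point-off-line few l with Fin.all? (λ p → on? p l)
    ... | no  ¬all = Fin.¬∀⟶∃¬ m _ (λ p → on? p l) ¬all
    ... | yes all  = contradiction (ℤ.+-injective (begin
      + points 2            ≡⟨ points-on-line l ⟨
      sum (λ p → B p l)     ≡⟨ sum-cong-≗ (λ p → indicator-yes (on? p l) (all p)) ⟩
      sum {m} (λ _ → 1ℤ)    ≡⟨ trans (sum-const m 1ℤ) (ℤ.*-identityʳ (+ m)) ⟩
      + m                   ∎)) few

    -- One pencil is subtracted from the other: their contributions off the joining line agree, and
    -- q remains at one centre, -q at the other. Having more points in the space than on a line
    -- supplies a third point to span the plane.
    difference : points 2 ≢ m → ∀ p p₀ → ∃ λ D → ∀ p′ →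
                 sum (λ l → B p′ l * D l) ≡ + q * (identity p′ p - identity p′ p₀)
    difference few p p₀ with p Fin.≟ p₀
    ... | yes refl = (λ _ → 0ℤ) , λ p′ → trans (sum-zero (λ l → ℤ.*-zeroʳ (B p′ l)))
                       (sym (trans (cong (+ q *_) (ℤ.+-inverseʳ (identity p′ p))) (ℤ.*-zeroʳ (+ q))))
    ... | no p≢p₀ = D , λ p′ → begin
      sum (λ l → B p′ l * D l)
        ≡⟨ sum-cong-≗ (λ l → expand (B p′ l) (sum (λ t → identity (X.line t) l)) (sum (λ t → identity (Y.line t) l))) ⟩
      sum (λ l → B p′ l * sum (λ t → identity (X.line t) l) + - 1ℤ * (B p′ l * sum (λ t → identity (Y.line t) l)))
        ≡⟨ axpy sum-linear (λ l → B p′ l * sum (λ t → identity (X.line t) l)) (- 1ℤ) (λ l → B p′ l * sum (λ t → identity (Y.line t) l)) ⟩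
      sum (λ l → B p′ l * sum (λ t → identity (X.line t) l)) + - 1ℤ * sum (λ l → B p′ l * sum (λ t → identity (Y.line t) l))
        ≡⟨ cong₂ (λ a b → a + - 1ℤ * b) (evaluate X.line p′) (evaluate Y.line p′) ⟩
      sum (λ t → B p′ (X.line t)) + - 1ℤ * sum (λ t → B p′ (Y.line t))
        ≡⟨ cong₂ (λ a b → a + - 1ℤ * b) (X.pencil-count p refl p′) (Y.pencil-count p₀ refl p′) ⟩
      (+ q * identity p′ p + indicator (X.off? p′)) + - 1ℤ * (+ q * identity p′ p₀ + indicator (Y.off? p′))
        ≡⟨ cong (λ z → (+ q * identity p′ p + indicator (X.off? p′)) + - 1ℤ * (+ q * identity p′ p₀ + z)) (same-off p′) ⟩
      (+ q * identity p′ p + indicator (X.off? p′)) + - 1ℤ * (+ q * identity p′ p₀ + indicator (X.off? p′))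
        ≡⟨ collect (+ q) (identity p′ p) (identity p′ p₀) (indicator (X.off? p′)) ⟩
      + q * (identity p′ p - identity p′ p₀)    ∎
      where
      expand : ∀ b u w → b * (u - w) ≡ b * u + - 1ℤ * (b * w)
      expand = solve-∀
      collect : ∀ q a b e → (q * a + e) + - 1ℤ * (q * b + e) ≡ q * (a - b)
      collect = solve-∀

      x y k : Vector K.Carrier n
      x = point n p
      y = point n p₀

      xy : ∃ λ l → ∀ z → Through l z ⇔ Span x y z
      xy = line-through x y (point-nonzero p) (distinct p≢p₀)

      off : ∃ λ p → ¬ On p (proj₁ xy)
      off = point-off-line few (proj₁ xy)

      k = point n (proj₁ off)

      k∉xy : ¬ Span x y k
      k∉xy k∈ = proj₂ off (Equivalence.from (proj₂ xy k) k∈)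

      module X = Pencil x y k (point-nonzero p) (distinct p≢p₀) k∉xy
      module Y = Pencil y x k (point-nonzero p₀) (distinct (p≢p₀ ∘ sym)) (k∉xy ∘ span-swap)

      D : Fin N → ℤ
      D l = sum (λ t → identity (X.line t) l) - sum (λ t → identity (Y.line t) l)

      evaluate : ∀ (line : Fin q → Fin N) p′ → sum (λ l → B p′ l * sum (λ t → identity (line t) l)) ≡ sum (λ t → B p′ (line t))
      evaluate line p′ = begin
        sum (λ l → B p′ l * sum (λ t → identity (line t) l))     ≡⟨ sum-cong-≗ (λ l → *-distribˡ-sum (B p′ l) (λ t → identity (line t) l)) ⟩
        sum (λ l → sum (λ t → B p′ l * identity (line t) l))     ≡⟨ ∑-comm (λ l t → B p′ l * identity (line t) l) ⟩
        sum (λ t → sum (λ l → B p′ l * identity (line t) l))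
          ≡⟨ sum-cong-≗ (λ t → trans (sum-cong-≗ (λ l → ℤ.*-comm (B p′ l) (identity (line t) l))) (sum-identity (line t) (B p′))) ⟩
        sum (λ t → B p′ (line t))                                ∎

      same-off : ∀ p′ → indicator (Y.off? p′) ≡ indicator (X.off? p′)
      same-off p′ = indicator-⇔ (Y.off? p′) (X.off? p′)
        (λ (t , s , a , e) → s , t , a , λ i → K.trans (e i) (K.*-congˡ (K.+-congˡ (K.+-comm _ _))))
        (λ (t , s , a , e) → s , t , a , λ i → K.trans (e i) (K.*-congˡ (K.+-congˡ (K.+-comm _ _))))

    -- The coefficient of the identity is fixed by the diagonal, where L has the valency and BᵀB - J
    -- has the number of points on a line minus 1. So s is the valency minus q.
    laplacian-entries : ∀ {N′} (lines′ : HasCardinality (Grassmannian F (n ℕ.∸ 2) 2) N′) l l′ →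
      laplacian F vertices lines′ l l′ ≡
      sum (λ p → B p l * B p l′) - 1ℤ + (+ (q ℕ.^ 4 ℕ.* N′) - (+ points 2 - 1ℤ)) * identity l l′
    laplacian-entries {N′} lines′ l l′ = entries (l Fin.≟ l′)
      where
      k κ : ℤ
      k = + (q ℕ.^ 4 ℕ.* N′)
      κ = k - (+ points 2 - 1ℤ)

      off-diagonal : ∀ a κ → 0ℤ - a ≡ (1ℤ - a) - 1ℤ + κ * 0ℤ
      off-diagonal = solve-∀
      on-diagonal : ∀ k π → k - 0ℤ ≡ π - 1ℤ + (k - (π - 1ℤ)) * 1ℤ
      on-diagonal = solve-∀

      square : sum (λ p → B p l * B p l) ≡ + points 2
      square = trans (sum-cong-≗ (λ p → indicator-idem (on? p l))) (points-on-line l)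

      entries : Dec (l ≡ l′) → diagonal (λ _ → q ℕ.^ 4 ℕ.* N′) l l′ - adjacencyMatrix F vertices l l′ ≡
                sum (λ p → B p l * B p l′) - 1ℤ + κ * identity l l′
      entries (yes refl) = begin
        diagonal (λ _ → q ℕ.^ 4 ℕ.* N′) l l - adjacencyMatrix F vertices l l
          ≡⟨ cong₂ _-_ (diagonal-≡ (λ _ → q ℕ.^ 4 ℕ.* N′) l) (not-self-skew l) ⟩
        k - 0ℤ                                                  ≡⟨ on-diagonal k (+ points 2) ⟩
        + points 2 - 1ℤ + κ * 1ℤ
          ≡⟨ cong₂ (λ a b → a - 1ℤ + κ * b) square (diagonal-≡ (λ _ → 1) l) ⟨
        sum (λ p → B p l * B p l) - 1ℤ + κ * identity l l       ∎
      entries (no l≢l′) = begin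
        diagonal (λ _ → q ℕ.^ 4 ℕ.* N′) l l′ - adjacencyMatrix F vertices l l′
          ≡⟨ cong (_- adjacencyMatrix F vertices l l′) (diagonal-≢ (λ _ → q ℕ.^ 4 ℕ.* N′) l≢l′) ⟩
        0ℤ - adjacencyMatrix F vertices l l′                    ≡⟨ off-diagonal (adjacencyMatrix F vertices l l′) κ ⟩
        (1ℤ - adjacencyMatrix F vertices l l′) - 1ℤ + κ * 0ℤ
          ≡⟨ cong₂ (λ a b → a - 1ℤ + κ * b) (common-points l≢l′) (diagonal-≢ (λ _ → 1) l≢l′) ⟨
        sum (λ p → B p l * B p l′) - 1ℤ + κ * identity l l′     ∎

-- The order of the critical group as a product of Smith entries.

module CriticalGroupOrder where

  open LinearForms
  open SmithForms
  open ElementaryDivisors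
  import Algebra.Properties.CommutativeMonoid.Mult as Mult
  open import Data.Fin.Base using (combine; remQuot)
  open import Data.Integer.Base using (+_; _+_; _*_; -_; _-_)
  open import Data.Integer.DivMod using (_%ℕ_; _/ℕ_; n%ℕd<d; a≡a%ℕn+[a/ℕn]*n)
  open import Data.Integer.Tactic.RingSolver using (solve-∀)
  open import Data.Nat.Base using (NonZero)
  import Data.Nat.Properties as ℕ
  open import Data.Nat.Divisibility as ℕ using (_∣_)
  open import Data.Product.Base using (uncurry)
  open import Relation.Binary.PropositionalEquality
    using (_≡_; _≢_; refl; sym; trans; cong; cong₂; subst; module ≡-Reasoning)
  open Linear

  ∏ : ∀ {N} → (Fin N → ℕ) → ℕ
  ∏ {zero}  d = 1
  ∏ {suc N} d = d zero ℕ.* ∏ (d ∘ suc)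

  encode : ∀ {N} (d : Fin N → ℕ) → (∀ j → Fin (d j)) → Fin (∏ d)
  encode {zero}  d x = zero
  encode {suc N} d x = combine (x zero) (encode (d ∘ suc) (x ∘ suc))

  encode-injective : ∀ {N} (d : Fin N → ℕ) x y → encode d x ≡ encode d y → ∀ j → x j ≡ y j
  encode-injective {suc N} d x y e zero    = proj₁ (Fin.combine-injective (x zero) _ (y zero) _ e)
  encode-injective {suc N} d x y e (suc j) =
    encode-injective (d ∘ suc) (x ∘ suc) (y ∘ suc) (proj₂ (Fin.combine-injective (x zero) _ (y zero) _ e)) j

  decode : ∀ {N} (d : Fin N → ℕ) → Fin (∏ d) → ∀ j → Fin (d j)
  decode {suc N} d i zero    = proj₁ (remQuot {d zero} (∏ (d ∘ suc)) i)
  decode {suc N} d i (suc j) = decode (d ∘ suc) (proj₂ (remQuot {d zero} (∏ (d ∘ suc)) i)) j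

  decode-injective : ∀ {N} (d : Fin N → ℕ) i i′ → (∀ j → decode d i j ≡ decode d i′ j) → i ≡ i′
  decode-injective {zero}  d zero zero e = refl
  decode-injective {suc N} d i i′ e = begin
    i                                            ≡⟨ Fin.combine-remQuot {d zero} (∏ (d ∘ suc)) i ⟨
    uncurry combine (remQuot {d zero} (∏ (d ∘ suc)) i)
      ≡⟨ cong₂ combine (e zero) (decode-injective (d ∘ suc) _ _ (e ∘ suc)) ⟩
    uncurry combine (remQuot {d zero} (∏ (d ∘ suc)) i′)    ≡⟨ Fin.combine-remQuot {d zero} (∏ (d ∘ suc)) i′ ⟩
    i′                                           ∎
    where open ≡-Reasoning

  ∣∏ : ∀ {N} (d : Fin N → ℕ) j → d j ∣ ∏ d
  ∣∏ d zero    = ℕ.m∣m*n (∏ (d ∘ suc))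
  ∣∏ d (suc j) = ℕ.∣n⇒∣m*n (d zero) (∣∏ (d ∘ suc) j)

  ∏≢0 : ∀ {N} (d : Fin N → ℕ) → (∀ j → NonZero (d j)) → NonZero (∏ d)
  ∏≢0 {zero}  d nz = _
  ∏≢0 {suc N} d nz = ℕ.m*n≢0 (d zero) (∏ (d ∘ suc)) {{nz zero}} {{∏≢0 (d ∘ suc) (nz ∘ suc)}}

  residue-unique : ∀ {d a b} k → a ℕ.< d → b ℕ.< d → + a ≡ + d * k + + b → a ≡ b
  residue-unique {d} {a} {b} k a<d b<d e = ℤ.+-injective (ℤ.i-j≡0⇒i≡j (+ a) (+ b) (ℤ.∣i∣≡0⇒i≡0 (vanish _ refl)))
    where
    difference : + a - + b ≡ + d * k
    difference = trans (cong (_- + b) e) (simplify (+ d * k) (+ b))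
      where
      simplify : ∀ x b → (x + b) - b ≡ x
      simplify = solve-∀

    small : ℤ.∣ + a - + b ∣ ℕ.< d
    small = ℕ.≤-<-trans (subst (λ z → ℤ.∣ z ∣ ℕ.≤ a ℕ.⊔ b) (sym (ℤ.m-n≡m⊖n a b)) (ℤ.∣m⊝n∣≤m⊔n a b)) (ℕ.⊔-lub a<d b<d)

    vanish : ∀ x → ℤ.∣ + a - + b ∣ ≡ x → x ≡ 0
    vanish zero    _ = refl
    vanish (suc x) eq = contradiction
      (subst (d ∣_) (trans (sym (trans (cong ℤ.∣_∣ difference) (ℤ.abs-* (+ d) k))) eq) (ℕ.m∣m*n ℤ.∣ k ∣))
      (ℕ.>⇒∤ (subst (ℕ._< d) eq small))

  module GroupOrder {N} (L : Matrix N) (S : SmithNormalForm L) where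
    open SmithNormalForm S
    open Diagonalised S

    private
      module K = AbelianGroup (criticalGroup L)
      C = cokernel (ℤ^ N) (ℤ^ N) (apply L) (apply-homomorphism L)
      open Mult (AbelianGroup.commutativeMonoid C) renaming (_×_ to _·_)

    -- Orders of the cyclic factors of the torsion subgroup: a zero entry gives a free summand of
    -- the cokernel and hence a trivial factor.
    order : Fin N → ℕ
    order j with d j
    ... | zero  = 1
    ... | suc k = suc k

    order-nonZero : ∀ j → NonZero (order j)
    order-nonZero j with d j
    ... | zero  = _
    ... | suc k = _

    private
      instance
        order-nonZeroᵢ : ∀ {j} → NonZero (order j)
        order-nonZeroᵢ {j} = order-nonZero j

      order-≢0 : ∀ j → d j ≢ 0 → order j ≡ d j
      order-≢0 j dj≢0 with d j
      ... | zero  = contradiction refl dj≢0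
      ... | suc k = refl

      order-≡0 : ∀ j → d j ≡ 0 → order j ≡ 1
      order-≡0 j dj≡0 with d j
      order-≡0 j refl | zero = refl

      ·-apply : ∀ k x i → (k · x) i ≡ + k * x i
      ·-apply zero    x i = sym (ℤ.*-zeroˡ (x i))
      ·-apply (suc k) x i = trans (cong (λ z → x i + z) (·-apply k x i)) (distribute (x i) (+ k))
        where
        distribute : ∀ x k → x + k * x ≡ (1ℤ + k) * x
        distribute = solve-∀

      P-+ : ∀ x y j → apply P (λ i → x i + y i) j ≡ apply P x j + apply P y j
      P-+ x y j = begin
        apply P (λ i → x i + y i) j
          ≡⟨ lin-apply P j .≗-cong (λ i → cong₂ _+_ (sym (ℤ.*-identityˡ (x i))) (sym (ℤ.*-identityˡ (y i)))) ⟩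
        apply P (λ i → 1ℤ * x i + 1ℤ * y i) j      ≡⟨ lin-apply P j .homo 1ℤ 1ℤ x y ⟩
        1ℤ * apply P x j + 1ℤ * apply P y j        ≡⟨ cong₂ _+_ (ℤ.*-identityˡ (apply P x j)) (ℤ.*-identityˡ (apply P y j)) ⟩
        apply P x j + apply P y j                  ∎
        where open ≡-Reasoning

    -- From kx = Ly follows k(Px) = DQ⁻¹y, which is 0 at a zero entry; k can be cancelled.
    torsion-coordinate : ((x , _) : K.Carrier) → ∀ j → d j ≡ 0 → apply P x j ≡ 0ℤ
    torsion-coordinate (x , k , k≢0 , y , kx≡Ly) j dj≡0 =
      [ (λ k≡0 → contradiction (ℤ.+-injective k≡0) (ℕ.≢-nonZero⁻¹ k {{k≢0}})) , id ]′ (ℤ.i*j≡0⇒i≡0∨j≡0 (+ k) (begin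
        + k * apply P x j                      ≡⟨ scale (lin-apply P j) (+ k) x ⟨
        apply P (λ i → + k * x i) j
          ≡⟨ apply-cong P (λ i → trans (sym (·-apply k x i)) (trans (kx≡Ly i) (ℤ.+-identityʳ (apply L y i)))) j ⟩
        apply P (apply L y) j                  ≡⟨ PL y j ⟩
        + d j * apply Q⁻¹ y j                  ≡⟨ cong (λ z → + z * apply Q⁻¹ y j) dj≡0 ⟩
        0ℤ * apply Q⁻¹ y j                     ≡⟨ ℤ.*-zeroˡ (apply Q⁻¹ y j) ⟩
        0ℤ                                     ∎))
      where
      open ≡-Reasoning
      open import Data.Sum.Base using ([_,_]′)

    residues : K.Carrier → ∀ j → Fin (order j)
    residues (x , _) j = fromℕ< (n%ℕd<d (apply P x j) (order j))

    -- At nonzero entries equal residues make P(x - y) divisible by `d j`, and at zero entries both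
    -- coordinates vanish by torsion. The quotients `w` give the preimage Qw of x - y under L.
    residues-injective : ∀ x y → (∀ j → residues x j ≡ residues y j) → x K.≈ y
    residues-injective X@(x , _) Y@(y , _) e = apply Q w , λ i → begin
      x i                                                       ≡⟨ split (x i) (y i) ⟩
      (x i - y i) + y i                                         ≡⟨ cong (_+ y i) (P⁻¹P (λ i → x i - y i) i) ⟨
      apply P⁻¹ (apply P (λ i → x i - y i)) i + y i             ≡⟨ cong (_+ y i) (apply-cong P⁻¹ Pxy i) ⟩
      apply P⁻¹ (λ j → + d j * w j) i + y i                     ≡⟨ cong (_+ y i) (LQ w i) ⟨
      apply L (apply Q w) i + y i                               ∎
      where
      open ≡-Reasoning
      split : ∀ a b → a ≡ (a - b) + b
      split = solve-∀

      w : Fin N → ℤ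
      w j = apply P x j /ℕ order j - apply P y j /ℕ order j

      Pxy : ∀ j → apply P (λ i → x i - y i) j ≡ + d j * w j
      Pxy j = trans P-minus (by-order (d j ℕ.≟ 0))
        where
        P-minus : apply P (λ i → x i - y i) j ≡ apply P x j - apply P y j
        P-minus = begin
          apply P (λ i → x i - y i) j                        ≡⟨ recover (apply P (λ i → x i - y i) j) (apply P y j) ⟩
          (apply P (λ i → x i - y i) j + apply P y j) - apply P y j
            ≡⟨ cong (_- apply P y j) (trans (sym (P-+ (λ i → x i - y i) y j)) (apply-cong P (λ i → sym (split (x i) (y i))) j)) ⟩
          apply P x j - apply P y j                          ∎
          where
          recover : ∀ a b → a ≡ (a + b) - b
          recover = solve-∀

        remainders : apply P x j %ℕ order j ≡ apply P y j %ℕ order j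
        remainders = trans (sym (Fin.toℕ-fromℕ< (n%ℕd<d (apply P x j) (order j))))
                    (trans (cong toℕ (e j)) (Fin.toℕ-fromℕ< (n%ℕd<d (apply P y j) (order j))))

        by-order : Dec (d j ≡ 0) → apply P x j - apply P y j ≡ + d j * w j
        by-order (yes dj≡0) = trans
          (cong₂ _-_ (torsion-coordinate X j dj≡0) (torsion-coordinate Y j dj≡0))
          (trans (sym (ℤ.*-zeroˡ (w j))) (cong (λ z → + z * w j) (sym dj≡0)))
        by-order (no dj≢0) = begin
          apply P x j - apply P y j
            ≡⟨ cong₂ _-_ (a≡a%ℕn+[a/ℕn]*n (apply P x j) (order j)) (a≡a%ℕn+[a/ℕn]*n (apply P y j) (order j)) ⟩
          (+ (apply P x j %ℕ order j) + (apply P x j /ℕ order j) * + order j) -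
          (+ (apply P y j %ℕ order j) + (apply P y j /ℕ order j) * + order j)
            ≡⟨ cong (λ z → (+ z + (apply P x j /ℕ order j) * + order j) -
                           (+ (apply P y j %ℕ order j) + (apply P y j /ℕ order j) * + order j)) remainders ⟩
          (+ (apply P y j %ℕ order j) + (apply P x j /ℕ order j) * + order j) -
          (+ (apply P y j %ℕ order j) + (apply P y j /ℕ order j) * + order j)
            ≡⟨ collect (+ (apply P y j %ℕ order j)) (apply P x j /ℕ order j) (apply P y j /ℕ order j) (+ order j) ⟩
          + order j * w j    ≡⟨ cong (λ z → + z * w j) (order-≢0 j dj≢0) ⟩
          + d j * w j        ∎
          where
          collect : ∀ r a b o → (r + a * o) - (r + b * o) ≡ o * (a - b)
          collect = solve-∀

    -- The product of all orders serves as torsion multiplier: it is a multiple of every nonzero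
    -- entry, and at a zero entry the residue itself is 0.
    representative : (∀ j → Fin (order j)) → K.Carrier
    representative z = x , ∏ order , ∏≢0 order order-nonZero , apply Q w , λ i → begin
      (∏ order · x) i                               ≡⟨ ·-apply (∏ order) x i ⟩
      + ∏ order * x i                               ≡⟨ scale (lin-apply P⁻¹ i) (+ ∏ order) (λ j → + toℕ (z j)) ⟨
      apply P⁻¹ (λ j → + ∏ order * + toℕ (z j)) i   ≡⟨ apply-cong P⁻¹ (λ j → entry j (d j ℕ.≟ 0)) i ⟩
      apply P⁻¹ (λ j → + d j * w j) i               ≡⟨ LQ w i ⟨
      apply L (apply Q w) i                         ≡⟨ ℤ.+-identityʳ (apply L (apply Q w) i) ⟨
      apply L (apply Q w) i + 0ℤ                    ∎
      where
      open ≡-Reasoning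
      x : Fin N → ℤ
      x = apply P⁻¹ (λ j → + toℕ (z j))

      cofactor : Fin N → ℕ
      cofactor j = _∣_.quotient (∣∏ order j)

      w : Fin N → ℤ
      w j = + cofactor j * + toℕ (z j)

      entry : ∀ j → Dec (d j ≡ 0) → + ∏ order * + toℕ (z j) ≡ + d j * w j
      entry j (yes dj≡0) = begin
        + ∏ order * + toℕ (z j)    ≡⟨ cong (λ k → + ∏ order * + k) (ℕ.n<1⇒n≡0 (subst (toℕ (z j) ℕ.<_) (order-≡0 j dj≡0) (Fin.toℕ<n (z j)))) ⟩
        + ∏ order * 0ℤ             ≡⟨ ℤ.*-zeroʳ (+ ∏ order) ⟩
        0ℤ                         ≡⟨ ℤ.*-zeroˡ (w j) ⟨
        0ℤ * w j                   ≡⟨ cong (λ k → + k * w j) dj≡0 ⟨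
        + d j * w j                ∎
      entry j (no dj≢0) = begin
        + ∏ order * + toℕ (z j)
          ≡⟨ cong (_* + toℕ (z j)) (trans (cong +_ (_∣_.equality (∣∏ order j))) (ℤ.pos-* (cofactor j) (order j))) ⟩
        + cofactor j * + order j * + toℕ (z j)    ≡⟨ rotate (+ cofactor j) (+ order j) (+ toℕ (z j)) ⟩
        + order j * w j                           ≡⟨ cong (λ k → + k * w j) (order-≢0 j dj≢0) ⟩
        + d j * w j                               ∎
        where
        rotate : ∀ a b c → a * b * c ≡ b * (a * c)
        rotate = solve-∀

    representative-injective : ∀ z z′ → representative z K.≈ representative z′ → ∀ j → z j ≡ z′ j
    representative-injective z z′ (y , e) j = Fin.toℕ-injective (by-order (d j ℕ.≟ 0))
      where
      open ≡-Reasoning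
      ζ ζ′ : Fin N → ℤ
      ζ j = + toℕ (z j)
      ζ′ j = + toℕ (z′ j)

      congruent : ζ j ≡ + d j * apply Q⁻¹ y j + ζ′ j
      congruent = begin
        ζ j                                                    ≡⟨ PP⁻¹ ζ j ⟨
        apply P (apply P⁻¹ ζ) j                                ≡⟨ apply-cong P e j ⟩
        apply P (λ i → apply L y i + apply P⁻¹ ζ′ i) j         ≡⟨ P-+ (apply L y) (apply P⁻¹ ζ′) j ⟩
        apply P (apply L y) j + apply P (apply P⁻¹ ζ′) j       ≡⟨ cong₂ _+_ (PL y j) (PP⁻¹ ζ′ j) ⟩
        + d j * apply Q⁻¹ y j + ζ′ j                           ∎

      by-order : Dec (d j ≡ 0) → toℕ (z j) ≡ toℕ (z′ j)
      by-order (yes dj≡0) = ℤ.+-injective (trans congruent (trans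
        (cong (λ k → + k * apply Q⁻¹ y j + ζ′ j) dj≡0)
        (trans (cong (_+ ζ′ j) (ℤ.*-zeroˡ (apply Q⁻¹ y j))) (ℤ.+-identityˡ (ζ′ j)))))
      by-order (no dj≢0) = residue-unique (apply Q⁻¹ y j)
        (subst (toℕ (z j) ℕ.<_) (order-≢0 j dj≢0) (Fin.toℕ<n (z j)))
        (subst (toℕ (z′ j) ℕ.<_) (order-≢0 j dj≢0) (Fin.toℕ<n (z′ j))) congruent

    -- Cardinalities are compared through an injection in each direction, by `residues` and by
    -- `representative`, in place of an isomorphism with a product of cyclic groups.
    group-order : ∀ {κ} → HasCardinality (AbelianGroup.setoid (criticalGroup L)) κ → κ ≡ ∏ order
    group-order {κ} cardinality = ℕ.≤-antisym
      (Fin.injective⇒≤ {f = encode order ∘ residues ∘ from} λ {i} {j} e →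
        trans (sym (strictlyInverseˡ i)) (trans
          (to-cong (residues-injective (from i) (from j) (encode-injective order (residues (from i)) (residues (from j)) e)))
          (strictlyInverseˡ j)))
      (Fin.injective⇒≤ {f = to ∘ representative ∘ decode order} λ {i} {j} e →
        decode-injective order i j (representative-injective (decode order i) (decode order j)
          (K.trans {representative (decode order i)} {from (to (representative (decode order i)))} {representative (decode order j)}
            (K.sym {from (to (representative (decode order i)))} {representative (decode order i)}
              (strictlyInverseʳ (representative (decode order i))))
            (subst (λ k → from k K.≈ representative (decode order j)) (sym e) (strictlyInverseʳ (representative (decode order j)))))))
      where open Inverse cardinality using (to; from; to-cong; strictlyInverseˡ; strictlyInverseʳ)

    order-prime-to : ∀ {ℓ} → Prime ℓ → (∀ j → d j ≢ 0 → ¬ (ℓ ∣ d j)) → ¬ (ℓ ∣ ∏ order)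
    order-prime-to {ℓ} ℓ-prime ℓ∤d = product order factor
      where
      open Valuation ℓ-prime using (∤-*)
      ℓ∤1 : ¬ (ℓ ∣ 1)
      ℓ∤1 ℓ∣1 = ℕ.<⇒≱ (prime>1 ℓ-prime) (ℕ.∣⇒≤ ℓ∣1)

      factor : ∀ j → ¬ (ℓ ∣ order j)
      factor j = by-order (d j ℕ.≟ 0)
        where
        by-order : Dec (d j ≡ 0) → ¬ (ℓ ∣ order j)
        by-order (yes dj≡0) = subst (λ k → ¬ (ℓ ∣ k)) (sym (order-≡0 j dj≡0)) ℓ∤1
        by-order (no dj≢0)  = subst (λ k → ¬ (ℓ ∣ k)) (sym (order-≢0 j dj≢0)) (ℓ∤d j dj≢0)

      product : ∀ {k} (x : Fin k → ℕ) → (∀ j → ¬ (ℓ ∣ x j)) → ¬ (ℓ ∣ ∏ x)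
      product {zero}  x ∤x = ℓ∤1
      product {suc k} x ∤x = ∤-* (∤x zero) (product (x ∘ suc) (∤x ∘ suc))

-- Arithmetic of r, s, ρ, θ and μ, and the three cases.

module Cases where

  open LinearForms
  open SmithForms
  open ElementaryDivisors
  open IncidenceBounds
  open Vectors
  open CriticalGroupOrder
  import Data.Integer.Divisibility.Signed as ℤ
  import Data.Integer.Tactic.RingSolver as ℤSolver
  open import Data.Nat.Base
  open import Data.Nat.Properties
  open import Data.Nat.Divisibility
  open import Data.Nat.DivMod using (m*n/n≡m)
  open import Data.Nat.Tactic.RingSolver using (solve-∀)
  open import Relation.Binary.PropositionalEquality hiding ([_])
  open import Algebra.Properties.Semiring.Sum ℤ.+-*-semiring using (sum; sum-cong-≗)

  repunit-suc : ∀ q n → repunit q (suc n) ≡ 1 + q * repunit q n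
  repunit-suc q zero    = cong suc (sym (*-zeroʳ q))
  repunit-suc q (suc n) = begin
    q * q ^ n + repunit q (suc n)          ≡⟨ cong (q * q ^ n +_) (repunit-suc q n) ⟩
    q * q ^ n + (1 + q * repunit q n)      ≡⟨ collect q (q ^ n) (repunit q n) ⟩
    1 + q * (q ^ n + repunit q n)          ∎
    where
    open ≡-Reasoning
    collect : ∀ q a b → q * a + (1 + q * b) ≡ 1 + q * (a + b)
    collect = solve-∀

  ÷-exact : ∀ {d} m k → 0 < d → d * k ≡ m → m ÷ d ≡ k
  ÷-exact {suc d} m k _ refl = trans (cong (_/ suc d) (*-comm (suc d) k)) (m*n/n≡m k (suc d))

  bracket≡repunit : ∀ {q} → 1 < q → ∀ n → [ n ] q ≡ repunit q n
  bracket≡repunit {suc zero}    (s≤s ()) n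
  bracket≡repunit {suc (suc j)} _        n = ÷-exact {suc j} ((2 + j) ^ n ∸ 1) (repunit (2 + j) n) (s≤s z≤n)
    (cong (_∸ 1) (sym (power n)))
    where
    power : ∀ n → (2 + j) ^ n ≡ 1 + suc j * repunit (2 + j) n
    power zero    = cong suc (sym (*-zeroʳ (suc j)))
    power (suc n) = trans (cong ((2 + j) *_) (power n)) (trans (collect j (repunit (2 + j) n))
      (cong (λ z → 1 + suc j * (z + repunit (2 + j) n)) (sym (power n))))
      where
      collect : ∀ j a → (2 + j) * (1 + suc j * a) ≡ 1 + suc j * ((1 + suc j * a) + a)
      collect = solve-∀

  -- The sum 1 + q² + ... + q^(2h-2), the cofactor of q + 1 in [2h].
  even-powers : ℕ → ℕ → ℕ
  even-powers q zero    = 0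
  even-powers q (suc h) = 1 + q * (q * even-powers q h)

  repunit-even : ∀ q h → repunit q (h * 2) ≡ (q + 1) * even-powers q h
  repunit-even q zero    = sym (*-zeroʳ (q + 1))
  repunit-even q (suc h) = begin
    repunit q (2 + h * 2)                                ≡⟨ repunit-suc q (1 + h * 2) ⟩
    1 + q * repunit q (1 + h * 2)                        ≡⟨ cong (λ z → 1 + q * z) (repunit-suc q (h * 2)) ⟩
    1 + q * (1 + q * repunit q (h * 2))                  ≡⟨ cong (λ z → 1 + q * (1 + q * z)) (repunit-even q h) ⟩
    1 + q * (1 + q * ((q + 1) * even-powers q h))        ≡⟨ collect q (even-powers q h) ⟩
    (q + 1) * (1 + q * (q * even-powers q h))            ∎
    where
    open ≡-Reasoning
    collect : ∀ q a → 1 + q * (1 + q * ((q + 1) * a)) ≡ (q + 1) * (1 + q * (q * a))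
    collect = solve-∀

  -- Modulo q + 1 each of the h terms is 1, because q² - 1 = (q + 1)(q - 1); here `j` is q - 1. This
  -- brings (n - 1)/2 into case (C).
  even-powers-mod : ∀ q h → 0 < q → ∃ λ x → even-powers q h ≡ h + (q + 1) * x
  even-powers-mod q       zero    _ = 0 , sym (*-zeroʳ (q + 1))
  even-powers-mod (suc j) (suc h) _ with even-powers-mod (suc j) h (s≤s z≤n)
  ... | x , e = x + j * even-powers (suc j) h , (begin
    1 + suc j * (suc j * even-powers (suc j) h)                                  ≡⟨ expand j (even-powers (suc j) h) ⟩
    1 + even-powers (suc j) h + (suc j + 1) * (j * even-powers (suc j) h)        ≡⟨ cong (λ z → 1 + z + (suc j + 1) * (j * even-powers (suc j) h)) e ⟩
    1 + (h + (suc j + 1) * x) + (suc j + 1) * (j * even-powers (suc j) h)        ≡⟨ collect j h x (j * even-powers (suc j) h) ⟩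
    suc h + (suc j + 1) * (x + j * even-powers (suc j) h)                        ∎)
    where
    open ≡-Reasoning
    expand : ∀ j a → 1 + (1 + j) * ((1 + j) * a) ≡ 1 + a + ((1 + j) + 1) * (j * a)
    expand = solve-∀
    collect : ∀ j h x y → 1 + (h + ((1 + j) + 1) * x) + ((1 + j) + 1) * y ≡ (1 + h) + ((1 + j) + 1) * (x + y)
    collect = solve-∀

  -- Everything that the arithmetic takes from the geometry, with the field and the subspaces
  -- removed.
  record LineSystem (m N : ℕ) (L : Matrix N) (q R s : ℤ) : Set where
    field
      B              : Fin m → Fin N → ℤ
      B-01           : ∀ p l → B p l ≡ 0ℤ ⊎ B p l ≡ 1ℤ
      points-on-line : ∀ l → sum (λ p → B p l) ≡ q ℤ.+ 1ℤ
      lines-through  : ∀ p → sum (λ l → B p l) ≡ R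
      joining-lines  : ∀ p p′ → sum (λ l → B p l ℤ.* B p′ l) ≡ 1ℤ ℤ.+ (R ℤ.- 1ℤ) ℤ.* identity p p′
      L-entries      : ∀ l l′ → L l l′ ≡ sum (λ p → B p l ℤ.* B p l′) ℤ.- 1ℤ ℤ.+ s ℤ.* identity l l′
      difference     : ∀ p p₀ → ∃ λ (D : Fin N → ℤ) → ∀ p′ → sum (λ l → B p′ l ℤ.* D l) ≡ q ℤ.* (identity p′ p ℤ.- identity p′ p₀)

  -- Q, P, R and m stand for [n-3], [n-2], [n-1] and [n].
  module Spectrum {q Q w s N : ℕ} (1<q : 1 < q) (0<Q : 0 < Q)
    (w≡ : q * (q * Q) ≡ suc w)
    (s≡ : (q + 1) * s ≡ (1 + q * (1 + q * Q)) * (q * w))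
    (N≡ : (q + 1) * N ≡ suc (q * (1 + q * (1 + q * Q))) * (1 + q * (1 + q * Q)))
    {L : Matrix N}
    (system : LineSystem (suc (q * (1 + q * (1 + q * Q)))) N L (ℤ.+ q) (ℤ.+ (1 + q * (1 + q * Q))) (ℤ.+ s)) where

    -- The parameter w is [n-1] - (q + 2) = q²[n-3] - 1, so `ρ` and `θ` are the natural numbers
    -- behind those of `Incidence`. From (q + 1)s = Rθ and R = ρ + q + 1 the difference s - θ is
    -- ρθ/(q + 1), that is, the μ of the theorem.
    P R f m u r ρ θ μ : ℕ
    P = 1 + q * Q
    R = 1 + q * P
    f = q * R
    m = suc f
    u = q * P
    r = u + s
    ρ = suc w
    θ = q * w
    μ = s ∸ θ

    private
      0<q : 0 < q
      0<q = <-trans (s≤s z≤n) 1<q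

      q≢0 : q ≢ 0
      q≢0 = m<n⇒n≢0 0<q

      instance
        q-nonZero : NonZero q
        q-nonZero = ≢-nonZero q≢0

        q+1-nonZero : NonZero (q + 1)
        q+1-nonZero = ≢-nonZero λ e → q≢0 (m+n≡0⇒m≡0 q e)

      R≡ : R ≡ q + 2 + w
      R≡ = trans (expand q Q) (trans (cong (λ z → 1 + q + z) w≡) (shift q w))
        where
        expand : ∀ q Q → 1 + q * (1 + q * Q) ≡ 1 + q + q * (q * Q)
        expand = solve-∀
        shift : ∀ q w → 1 + q + (1 + w) ≡ q + 2 + w
        shift = solve-∀

      u≡ : u ≡ q + ρ
      u≡ = suc-injective (trans R≡ (shift q w))
        where
        shift : ∀ q w → q + 2 + w ≡ 1 + (q + (1 + w))
        shift = solve-∀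

      m≡ : m ≡ (q + 1) * (q + 1) + θ
      m≡ = trans (cong (λ z → suc (q * z)) R≡) (expand q w)
        where
        expand : ∀ q w → 1 + q * (q + 2 + w) ≡ (q + 1) * (q + 1) + q * w
        expand = solve-∀

    w>0 : 0 < w
    w>0 = s≤s⁻¹ (begin
      2                ≤⟨ 1<q ⟩
      q                ≤⟨ m≤m*n q (q * Q) {{m*n≢0 q Q {{q-nonZero}} {{>-nonZero 0<Q}}}} ⟩
      q * (q * Q)      ≡⟨ w≡ ⟩
      suc w            ∎)
      where open ≤-Reasoning

    θ≢0 : θ ≢ 0
    θ≢0 e = [ q≢0 , m<n⇒n≢0 w>0 ]′ (m*n≡0⇒m≡0∨n≡0 q e)

    s≢0 : s ≢ 0
    s≢0 refl = [ (λ ()) , θ≢0 ]′ (m*n≡0⇒m≡0∨n≡0 R (trans (sym s≡) (*-zeroʳ (q + 1))))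

    r≢0 : r ≢ 0
    r≢0 e = s≢0 (m+n≡0⇒n≡0 u e)

    r-product : (q + 1) * r ≡ ρ * m
    r-product = begin
      (q + 1) * (u + s)                          ≡⟨ *-distribˡ-+ (q + 1) u s ⟩
      (q + 1) * u + (q + 1) * s                  ≡⟨ cong₂ (λ a b → (q + 1) * a + b) u≡ (trans s≡ (cong (_* θ) R≡)) ⟩
      (q + 1) * (q + suc w) + (q + 2 + w) * θ    ≡⟨ expand q w ⟩
      suc w * ((q + 1) * (q + 1) + θ)            ≡⟨ cong (suc w *_) m≡ ⟨
      ρ * m                                      ∎
      where
      open ≡-Reasoning
      expand : ∀ q w → (q + 1) * (q + (1 + w)) + (q + 2 + w) * (q * w) ≡ (1 + w) * ((q + 1) * (q + 1) + q * w)
      expand = solve-∀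

    μ-product : (q + 1) * μ ≡ ρ * θ
    μ-product = begin
      (q + 1) * (s ∸ θ)                          ≡⟨ *-distribˡ-∸ (q + 1) s θ ⟩
      (q + 1) * s ∸ (q + 1) * θ                  ≡⟨ cong (_∸ (q + 1) * θ) (trans s≡ (trans (cong (_* θ) R≡) (expand q w))) ⟩
      (q + 1) * θ + suc w * θ ∸ (q + 1) * θ      ≡⟨ m+n∸m≡n ((q + 1) * θ) (suc w * θ) ⟩
      ρ * θ                                      ∎
      where
      open ≡-Reasoning
      expand : ∀ q w → (q + 2 + w) * (q * w) ≡ (q + 1) * (q * w) + (1 + w) * (q * w)
      expand = solve-∀

    μ≢0 : μ ≢ 0
    μ≢0 e = [ (λ ()) , θ≢0 ]′ (m*n≡0⇒m≡0∨n≡0 ρ (trans (sym μ-product) (trans (cong ((q + 1) *_) e) (*-zeroʳ (q + 1)))))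

    line-count : N ≡ s + (q + 1) * R
    line-count = *-cancelˡ-≡ N (s + (q + 1) * R) (q + 1) (begin
      (q + 1) * N                                    ≡⟨ trans N≡ (cong (_* R) m≡) ⟩
      ((q + 1) * (q + 1) + θ) * R                    ≡⟨ expand q θ R ⟩
      R * θ + (q + 1) * ((q + 1) * R)                ≡⟨ cong (_+ (q + 1) * ((q + 1) * R)) s≡ ⟨
      (q + 1) * s + (q + 1) * ((q + 1) * R)          ≡⟨ *-distribˡ-+ (q + 1) s ((q + 1) * R) ⟨
      (q + 1) * (s + (q + 1) * R)                    ∎)
      where
      open ≡-Reasoning
      expand : ∀ q θ R → ((q + 1) * (q + 1) + θ) * R ≡ R * θ + (q + 1) * ((q + 1) * R)
      expand = solve-∀

    -- Makes the subtractions in g, g - f + 1 and g - 1 true ones. Multiplied by q + 1 it becomes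
    -- 2(q + 1) ≤ R = q + 2 + w, that is q ≤ w, and indeed w + 1 = q²Q ≥ 2q > q + 1.
    2m≤N : m + m ≤ N
    2m≤N = *-cancelˡ-≤ (q + 1) (begin
      (q + 1) * (m + m)              ≡⟨ expand q m ⟩
      m * ((q + 2) + q)              ≤⟨ *-monoʳ-≤ m (+-monoʳ-≤ (q + 2) (s≤s⁻¹ q<w+1)) ⟩
      m * (q + 2 + w)                ≡⟨ cong (m *_) R≡ ⟨
      m * R                          ≡⟨ N≡ ⟨
      (q + 1) * N                    ∎)
      where
      open ≤-Reasoning
      expand : ∀ q m → (q + 1) * (m + m) ≡ m * ((q + 2) + q)
      expand = solve-∀
      q<w+1 : suc q ≤ suc w
      q<w+1 = begin
        suc q          <⟨ +-monoˡ-< q 1<q ⟩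
        q + q          ≡⟨ double q ⟩
        q * 2          ≤⟨ *-monoʳ-≤ q (≤-trans 1<q (m≤m*n q Q {{>-nonZero 0<Q}})) ⟩
        q * (q * Q)    ≡⟨ w≡ ⟩
        suc w          ∎
        where
        double : ∀ q → q + q ≡ q * 2
        double = solve-∀

    g : ℕ
    g = N ∸ m

    N-split : N ≡ m + g
    N-split = sym (m+[n∸m]≡n (≤-trans (m≤m+n m m) 2m≤N))

    m≤g : m ≤ g
    m≤g = +-cancelˡ-≤ m m g (subst (m + m ≤_) N-split 2m≤N)

    module Local (S : SmithNormalForm L) {ℓ : ℕ} (ℓ-prime : Prime ℓ) (ℓ∤q : ¬ (ℓ ∣ q)) where

      open Valuation ℓ-prime
      open Multiplicities S ℓ-prime
      open LocalSmith S ℓ-prime using (c)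

      private
        e : ℕ → ℕ
        e = multiplicity S ℓ

        module Sys = LineSystem system

        line-countℤ : ℤ.+ N ≡ ℤ.+ s ℤ.+ (ℤ.+ q ℤ.+ 1ℤ) ℤ.* ℤ.+ R
        line-countℤ = trans (cong ℤ.+_ line-count) (cong (λ z → ℤ.+ s ℤ.+ z) (ℤ.pos-* (q + 1) R))

        q+1≢0 : ℤ.+ q ℤ.+ 1ℤ ≢ 0ℤ
        q+1≢0 e = q≢0 (m+n≡0⇒m≡0 q (ℤ.+-injective e))

        l₀ : Fin N
        l₀ = fromℕ< (≤-trans (s≤s z≤n) (≤-trans (m≤m+n m m) 2m≤N))

        module I = Incidence Sys.B L (ℤ.+ q) (ℤ.+ R) (ℤ.+ s) Sys.points-on-line Sys.lines-through
                             Sys.joining-lines Sys.L-entries line-countℤ q+1≢0 l₀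
        open I.Bounds S ℓ-prime hiding (unit-cancels₁; unit-cancels)

        ρℤ : I.ρ ≡ ℤ.+ ρ
        ρℤ = trans (cong (λ z → ℤ.+ z ℤ.- (ℤ.+ q ℤ.+ 1ℤ)) (trans R≡ (shift q w))) (simplify (ℤ.+ (q + 1)) (ℤ.+ ρ))
          where
          shift : ∀ q w → q + 2 + w ≡ (q + 1) + (1 + w)
          shift = solve-∀
          simplify : ∀ a b → (a ℤ.+ b) ℤ.- a ≡ b
          simplify = ℤSolver.solve-∀

        θℤ : I.θ ≡ ℤ.+ θ
        θℤ = trans (cong₂ (λ a b → ℤ.+ a ℤ.- b) m≡ (sym (ℤ.pos-* (q + 1) (q + 1)))) (simplify (ℤ.+ ((q + 1) * (q + 1))) (ℤ.+ θ))
          where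
          simplify : ∀ a b → (a ℤ.+ b) ℤ.- a ≡ b
          simplify = ℤSolver.solve-∀

        ∣ℤ : ∀ {i t} → ℓ ^ i ∣ t → ℓ^ i ℤ.∣ ℤ.+ t
        ∣ℤ = ℤ.∣ᵤ⇒∣

        ∤ℤ : ∀ {t} → ¬ (ℓ ∣ t) → ¬ (ℤ.+ ℓ ℤ.∣ ℤ.+ t)
        ∤ℤ ℓ∤t = ℓ∤t ∘ ℤ.∣⇒∣ᵤ

        cancels : ∀ {t i j} → t ≢ 0 → v ℓ t + j ≤ i → Cancels (ℤ.+ t) i (ℓ^ j)
        cancels {t} {i} {j} t≢0 vt+j≤i x ∣tx = ℤ.∣ᵤ⇒∣ (v-cancel {i} {j} {t} ℤ.∣ x ∣ t≢0 vt+j≤i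
          (subst (ℓ ^ i ∣_) (ℤ.abs-* (ℤ.+ t) x) (ℤ.∣⇒∣ᵤ ∣tx)))

        cancels₁ : ∀ {t i} → t ≢ 0 → v ℓ t < i → Cancels (ℤ.+ t) i (ℤ.+ ℓ)
        cancels₁ {t} {i} t≢0 vt<i = subst (λ k → Cancels (ℤ.+ t) i (ℤ.+ k)) (*-identityʳ ℓ)
          (cancels {t} {i} {1} t≢0 (subst (_≤ i) (+-comm 1 (v ℓ t)) vt<i))

        a b : ℕ
        a = v ℓ r
        b = v ℓ s

        -- Of at least a + b + 1 factors ℓ the number r absorbs a, and the remaining b + 1 are one
        -- more than s can absorb.
        c-top : ∀ i → a + b < i → c i ≡ 1
        c-top i a+b<i = ≤-antisym
          (c≤1 {i} {suc b} (≤-trans (s≤s (m≤n+m b a)) a+b<i)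
               (cancels {r} {i} {suc b} r≢0 (subst (_≤ i) (sym (+-suc a b)) a+b<i))
               (cancels₁ {s} {suc b} s≢0 ≤-refl))
          (c≥1 i)

        ∣r : ∀ {i} → i ≤ a → ℓ^ i ℤ.∣ I.r
        ∣r {i} i≤a = ∣ℤ {i} {r} (≤v⇒∣ {i} {r} i≤a)

        ∣s : ∀ {i} → i ≤ b → ℓ^ i ℤ.∣ ℤ.+ s
        ∣s {i} i≤b = ∣ℤ {i} {s} (≤v⇒∣ {i} {s} i≤b)

        1+g≤ : ∀ {x} → N ≤ x + f → suc g ≤ x
        1+g≤ {x} N≤ = +-cancelʳ-≤ f (suc g) x (subst (_≤ x + f) (trans N-split (shift f g)) N≤)
          where
          shift : ∀ f g → suc f + g ≡ suc g + f
          shift f g = cong suc (+-comm f g)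

        g≤ : ∀ {x} → N ≤ x + m → g ≤ x
        g≤ {x} N≤ = +-cancelʳ-≤ m g x (subst (_≤ x + m) (trans N-split (+-comm m g)) N≤)

        ≤g : ∀ {x} j → j + m + x ≤ N + j → x ≤ g
        ≤g {x} j h = +-cancelˡ-≤ (j + m) x g (subst (j + m + x ≤_) (trans (cong (_+ j) N-split) (shift m g j)) h)
          where
          shift : ∀ m g j → m + g + j ≡ j + m + g
          shift = solve-∀

        ≤1+g : ∀ {x} j → j + m + x ≤ N + suc j → x ≤ suc g
        ≤1+g {x} j h = +-cancelˡ-≤ (j + m) x (suc g) (subst (j + m + x ≤_) (trans (cong (_+ suc j) N-split) (shift m g j)) h)
          where
          shift : ∀ m g j → m + g + suc j ≡ j + m + suc g
          shift = solve-∀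

      all-units : ¬ (ℓ ∣ r) → ¬ (ℓ ∣ s) → ∀ i → 0 < i → c i ≡ 1
      all-units ℓ∤r ℓ∤s i 0<i = c-top i (subst (_< i) (sym (cong₂ _+_ (∤⇒v≡0 ℓ∤r) (∤⇒v≡0 ℓ∤s))) 0<i)

      critical-group-prime-to : ∀ {κ} → HasCardinality (AbelianGroup.setoid (criticalGroup L)) κ →
                                ¬ (ℓ ∣ r) → ¬ (ℓ ∣ s) → ¬ (ℓ ∣ κ)
      critical-group-prime-to cardinality ℓ∤r ℓ∤s ℓ∣κ =
        GroupOrder.order-prime-to L S ℓ-prime (entries-prime-to (all-units ℓ∤r ℓ∤s))
          (subst (ℓ ∣_) (GroupOrder.group-order L S cardinality) ℓ∣κ)

      module _ (ℓ∣r : ℓ ∣ r) (ℓ∤s : ¬ (ℓ ∣ s)) where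
        private
          ℓ∤u : ¬ (ℓ ∣ u)
          ℓ∤u ℓ∣u = ℓ∤s (∣m+n∣m⇒∣n ℓ∣r ℓ∣u)

          a>0 : 0 < a
          a>0 = ∣⇒v>0 r≢0 ℓ∣r

          c-low : ∀ i → 0 < i → i ≤ a → i ≤ v ℓ ρ → c i ≡ suc f
          c-low i 0<i i≤a i≤vρ = ≤-antisym
            (c≤m {i} (cancels₁ {s} {i} s≢0 (subst (_< i) (sym (∤⇒v≡0 ℓ∤s)) 0<i)))
            (s≤s⁻¹ (subst (suc m ≤_) (+-comm (c i) 1)
              (m+1≤c+1 {i} 0<i (∣r i≤a) (subst (ℓ^ i ℤ.∣_) (sym ρℤ) (∣ℤ {i} {ρ} (≤v⇒∣ {i} {ρ} i≤vρ))) (∤ℤ ℓ∤u))))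

          c-high : ∀ i → 0 < i → i ≤ a → v ℓ ρ < i → c i ≡ f
          c-high i 0<i i≤a vρ<i = ≤-antisym
            (c≤m-1 {i} 0<i (subst (λ z → Cancels z i (ℤ.+ ℓ)) (sym ρℤ) (cancels₁ {ρ} {i} (λ ()) vρ<i)) (∤ℤ ℓ∤s)
                   (fromℕ< {0} (m<m+n 0 (*-pos 0<q))))
            (s≤s⁻¹ (subst (m ≤_) (+-comm (c i) 1) (m≤c+1 {i} (∣r i≤a) (∤ℤ ℓ∤u))))
            where
            *-pos : 0 < q → 0 < f
            *-pos 0<q = ≤-trans 0<q (m≤m*n q R)

          c-top′ : ∀ i → a < i → c i ≡ 1
          c-top′ i a<i = c-top i (subst (_< i) (sym (trans (cong (a +_) (∤⇒v≡0 ℓ∤s)) (+-identityʳ a))) a<i)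

          f-1+1 : f ∸ 1 + 1 ≡ f
          f-1+1 = m∸n+n≡m (≤-trans 0<q (m≤m*n q R))

        r-only-high : ∀ {x} → a ≡ x → v ℓ ρ ≡ 0 → e IsExactly ((x , f ∸ 1) ∷ (0 , g + 1) ∷ [])
        r-only-high refl vρ≡0 = one-step a>0 (λ i 0<i i≤a → c-high i 0<i i≤a (subst (_< i) (sym vρ≡0) 0<i)) c-top′
          f-1+1 (trans (shift g f) (sym N-split))
          where
          shift : ∀ g f → g + 1 + f ≡ 1 + f + g
          shift = solve-∀

        r-only-both : ∀ {x y} → a ≡ x → v ℓ ρ ≡ y → 0 < y → y < x →
                      e IsExactly ((x , f ∸ 1) ∷ (y , 1) ∷ (0 , g) ∷ [])
        r-only-both refl refl vρ>0 vρ<a = two-steps vρ>0 vρ<a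
          (λ i 0<i i≤vρ → c-low i 0<i (≤-trans i≤vρ (<⇒≤ vρ<a)) i≤vρ)
          (λ i vρ<i i≤a → c-high i (≤-trans (s≤s z≤n) vρ<i) i≤a vρ<i) c-top′
          f-1+1 refl (trans (+-comm g m) (sym N-split))

        r-only-low : ∀ {x} → a ≡ x → x ≤ v ℓ ρ → e IsExactly ((x , f) ∷ (0 , g) ∷ [])
        r-only-low refl a≤vρ = one-step a>0 (λ i 0<i i≤a → c-low i 0<i i≤a (≤-trans i≤a a≤vρ)) c-top′
          (+-comm f 1) (trans (+-comm g m) (sym N-split))

      module _ (ℓ∣s : ℓ ∣ s) (ℓ∤r : ¬ (ℓ ∣ r)) where
        private
          ℓ∤u : ¬ (ℓ ∣ u)
          ℓ∤u ℓ∣u = ℓ∤r (∣m∣n⇒∣m+n ℓ∣u ℓ∣s)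

          b>0 : 0 < b
          b>0 = ∣⇒v>0 s≢0 ℓ∣s

          c-low : ¬ (ℓ ∣ q + 1) → ∀ i → 0 < i → i ≤ b → i ≤ v ℓ θ → c i ≡ suc g
          c-low ℓ∤q+1 i 0<i i≤b i≤vθ = ≤-antisym
            (≤1+g 0 (m+c≤N+1 {i} 0<i (∣s i≤b) (∤ℤ ℓ∤u) (∤ℤ ℓ∤q+1)))
            (1+g≤ (N≤c+m-1 {i} (∣s i≤b) λ x y eq → cancels {q + 1} {i} {i} (λ e → q≢0 (m+n≡0⇒m≡0 q e))
              (≤-reflexive (cong (_+ i) (∤⇒v≡0 ℓ∤q+1))) y
              (subst (ℓ^ i ℤ.∣_) (sym (trans eq (cong (ℤ._* x) θℤ))) (ℤ.∣m⇒∣m*n x (∣ℤ {i} {θ} (≤v⇒∣ {i} {θ} i≤vθ))))))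

          c-high : ∀ i → 0 < i → i ≤ b → v ℓ θ < i → c i ≡ g
          c-high i 0<i i≤b vθ<i = ≤-antisym
            (≤g 1 (m+1+c≤N+1 {i} 0<i (∣s i≤b) (∤ℤ ℓ∤u) (subst (λ z → Cancels z i (ℤ.+ ℓ)) (sym θℤ) (cancels₁ {θ} {i} θ≢0 vθ<i))))
            (g≤ (N≤c+m {i} (∣s i≤b)))

          c-top′ : ∀ i → b < i → c i ≡ 1
          c-top′ i b<i = c-top i (subst (_< i) (sym (cong (_+ b) (∤⇒v≡0 ℓ∤r))) b<i)

          g-1+1 : g ∸ 1 + 1 ≡ g
          g-1+1 = m∸n+n≡m (≤-trans (s≤s z≤n) m≤g)

        s-only-high : ∀ {x} → b ≡ x → v ℓ θ ≡ 0 → e IsExactly ((x , g ∸ 1) ∷ (0 , f + 1) ∷ [])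
        s-only-high refl vθ≡0 = one-step b>0 (λ i 0<i i≤b → c-high i 0<i i≤b (subst (_< i) (sym vθ≡0) 0<i)) c-top′
          g-1+1 (trans (cong (_+ g) (+-comm f 1)) (sym N-split))

        s-only-both : ¬ (ℓ ∣ q + 1) → ∀ {x y} → b ≡ x → v ℓ θ ≡ y → 0 < y → y < x →
                      e IsExactly ((x , g ∸ 1) ∷ (y , 1) ∷ (0 , f) ∷ [])
        s-only-both ℓ∤q+1 refl refl vθ>0 vθ<b = two-steps vθ>0 vθ<b
          (λ i 0<i i≤vθ → c-low ℓ∤q+1 i 0<i (≤-trans i≤vθ (<⇒≤ vθ<b)) i≤vθ)
          (λ i vθ<i i≤b → c-high i (≤-trans (s≤s z≤n) vθ<i) i≤b vθ<i) c-top′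
          g-1+1 refl (trans (+-suc f g) (sym N-split))

        s-only-low : ¬ (ℓ ∣ q + 1) → b ≤ v ℓ θ → e IsExactly ((b , g) ∷ (0 , f) ∷ [])
        s-only-low ℓ∤q+1 b≤vθ = one-step b>0 (λ i 0<i i≤b → c-low ℓ∤q+1 i 0<i i≤b (≤-trans i≤b b≤vθ)) c-top′
          (+-comm g 1) (trans (+-suc f g) (sym N-split))

      module _ (ℓ∣q+1 : ℓ ∣ q + 1) (ℓ∣r : ℓ ∣ r) (ℓ∣s : ℓ ∣ s) {θ′ : ℕ} (θ≡ : θ ≡ (q + 1) * θ′) (ℓ∤R : ¬ (ℓ ∣ R)) where
        private
          a>0 : 0 < a
          a>0 = ∣⇒v>0 r≢0 ℓ∣r

          b>0 : 0 < b
          b>0 = ∣⇒v>0 s≢0 ℓ∣s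

          s≡Rθ′ : s ≡ R * θ′
          s≡Rθ′ = *-cancelˡ-≡ s (R * θ′) (q + 1) (trans s≡ (trans (cong (R *_) θ≡) (swap R (q + 1) θ′)))
            where
            swap : ∀ a b c → a * (b * c) ≡ b * (a * c)
            swap = solve-∀

          -- In s = Rθ′ the factor R is a unit at ℓ, so θ′ carries all of ℓ^b. Hence θ = (q + 1)θ′
          -- carries at least one factor ℓ more, as `c≤m-1′` requires.
          ℓᵇ∣θ′ : ∀ {i} → i ≤ b → ℓ ^ i ∣ θ′
          ℓᵇ∣θ′ {i} i≤b = v-cancel {i} {i} {R} θ′ (λ ()) (≤-reflexive (cong (_+ i) (∤⇒v≡0 ℓ∤R)))
            (subst (ℓ ^ i ∣_) s≡Rθ′ (≤v⇒∣ {i} {s} i≤b))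

          module D = Differences (λ p → proj₁ (Sys.difference p zero)) (λ p → proj₂ (Sys.difference p zero)) (∤ℤ ℓ∤q)

          low : ∀ i → 0 < i → i ≤ b → c i ≡ suc g
          low i 0<i i≤b = ≤-antisym
            (≤1+g 1 (D.m+1+c≤N+2 {i} 0<i (ℤ.∣ᵤ⇒∣ ℓ∣s) (ℤ.∣ᵤ⇒∣ ℓ∣q+1)))
            (1+g≤ (N≤c+m-1 {i} (∣s i≤b) λ x y eq →
              subst (ℓ^ i ℤ.∣_) (sym (ℤ.*-cancelˡ-≡ (ℤ.+ (q + 1)) y (ℤ.+ θ′ ℤ.* x) {{q+1-nonZeroℤ}} (trans eq (factor x))))
                    (ℤ.∣m⇒∣m*n x (∣ℤ {i} {θ′} (ℓᵇ∣θ′ i≤b)))))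
            where
            q+1-nonZeroℤ : ℤ.NonZero (ℤ.+ (q + 1))
            q+1-nonZeroℤ = ℤ.≢-nonZero (λ e → q+1≢0 e)

            factor : ∀ x → I.θ ℤ.* x ≡ ℤ.+ (q + 1) ℤ.* (ℤ.+ θ′ ℤ.* x)
            factor x = trans (cong (ℤ._* x) (trans θℤ (trans (cong ℤ.+_ θ≡) (ℤ.pos-* (q + 1) θ′))))
                             (ℤ.*-assoc (ℤ.+ (q + 1)) (ℤ.+ θ′) x)

          N≢R : N ≢ R
          N≢R N≡R = <⇒≢ (begin-strict
            R              <⟨ n<1+n R ⟩
            suc R          ≤⟨ s≤s (m≤n*m R q) ⟩
            m              ≤⟨ m≤m+n m m ⟩
            m + m          ≤⟨ 2m≤N ⟩
            N              ∎) (sym N≡R)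
            where open ≤-Reasoning

          all-lines : ∀ {x} → (∀ l → Sys.B zero l ≡ x) → ℤ.+ R ≡ ℤ.+ N ℤ.* x
          all-lines {x} all = trans (sym (Sys.lines-through zero)) (trans (sum-cong-≗ all) (sum-const N x))

          -- The first point is on R lines, and R is neither N nor 0; so some line misses it and, by
          -- `line-on`, some line contains it.
          line-off : ∃ λ l → Sys.B zero l ≡ 0ℤ
          line-off with Fin.any? (λ l → Sys.B zero l ℤ.≟ 0ℤ)
          ... | yes found = found
          ... | no none = contradiction
            (sym (ℤ.+-injective (trans (all-lines (λ l → [ (λ B≡0 → contradiction (l , B≡0) none) , id ]′ (Sys.B-01 zero l))) (ℤ.*-identityʳ (ℤ.+ N)))))
            N≢R

          line-on : ∃ λ l → Sys.B zero l ≡ 1ℤ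
          line-on with Fin.any? (λ l → Sys.B zero l ℤ.≟ 1ℤ)
          ... | yes found = found
          ... | no none = contradiction
            (ℤ.+-injective (trans (all-lines (λ l → [ id , (λ B≡1 → contradiction (l , B≡1) none) ]′ (Sys.B-01 zero l))) (ℤ.*-zeroʳ (ℤ.+ N))))
            λ ()

          middle : ∀ i → b < i → i ≤ a + b → c i ≡ f
          middle i b<i i≤a+b = ≤-antisym
            (c≤m-1′ {b} {i} b<i (ℤ.∣ᵤ⇒∣ ℓ∣q+1) (∣s ≤-refl) (cancels₁ {s} {suc b} s≢0 ≤-refl)
              (subst (ℓ^ suc b ℤ.∣_) (sym θℤ) (∣ℤ {suc b} {θ} (subst (ℓ ^ suc b ∣_) (sym θ≡) (*-pres-∣ ℓ∣q+1 (ℓᵇ∣θ′ ≤-refl)))))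
              (fromℕ< {0} (≤-trans 0<q (m≤m*n q R))) (proj₂ line-off) (proj₂ line-on))
            (s≤s⁻¹ (s≤s⁻¹ (subst (suc m ≤_) (+-comm (c i) 2)
              (D.m+1≤c+2 {i} (ℤ.∣ᵤ⇒∣ ℓ∣r) (subst (ℓ^ i ℤ.∣_) (ℤ.pos-* r s) (∣ℤ {i} {r * s}
                (≤v⇒∣ {i} {r * s} (subst (i ≤_) (sym (v-* r≢0 s≢0)) i≤a+b))))))))

        both : e IsExactly ((a + b , f ∸ 1) ∷ (b , g ∸ f + 1) ∷ (0 , f) ∷ [])
        both = two-steps b>0 (m<n+m b a>0) low middle c-top
          (m∸n+n≡m (≤-trans 0<q (m≤m*n q R)))
          (trans (shift (g ∸ f) f) (cong suc (m∸n+n≡m (≤-trans (n≤1+n f) m≤g))))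
          (trans (+-suc f g) (sym N-split))
          where
          shift : ∀ x f → x + 1 + f ≡ suc (x + f)
          shift x f = cong (_+ f) (+-comm x 1)

      private
        ∤1 : ¬ (ℓ ∣ 1)
        ∤1 ℓ∣1 = <⇒≱ (prime>1 ℓ-prime) (∣⇒≤ ℓ∣1)

        ∤suc : ∀ {x} → ℓ ∣ x → ¬ (ℓ ∣ suc x)
        ∤suc {x} ℓ∣x ℓ∣1+x = ∤1 (∣m+n∣m⇒∣n (subst (ℓ ∣_) (+-comm 1 x) ℓ∣1+x) ℓ∣x)

        split-prime : ∀ x y → ℓ ∣ x * y → ℓ ∣ x ⊎ ℓ ∣ y
        split-prime x y = euclidsLemma x y ℓ-prime

        ∣-cancel-q : ∀ x → ℓ ∣ q * x → ℓ ∣ x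
        ∣-cancel-q x ℓ∣qx = [ (λ ℓ∣q → contradiction ℓ∣q ℓ∤q) , id ]′ (split-prime q x ℓ∣qx)

        v-unit-* : ∀ {x y} → ¬ (ℓ ∣ x) → y ≢ 0 → v ℓ (x * y) ≡ v ℓ y
        v-unit-* {x} {y} ℓ∤x y≢0 = trans (v-* {x} {y} (λ { refl → ℓ∤x (ℓ ∣0) }) y≢0) (cong (_+ v ℓ y) (∤⇒v≡0 {x} ℓ∤x))

        Q≢0 : Q ≢ 0
        Q≢0 = m<n⇒n≢0 0<Q

        vρ≡vQ : v ℓ ρ ≡ v ℓ Q
        vρ≡vQ = trans (cong (v ℓ) (sym w≡)) (trans (v-unit-* {q} {q * Q} ℓ∤q qQ≢0) (v-unit-* {q} {Q} ℓ∤q Q≢0))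
          where
          qQ≢0 : q * Q ≢ 0
          qQ≢0 e = [ q≢0 , Q≢0 ]′ (m*n≡0⇒m≡0∨n≡0 q e)

      module CaseA (ℓ∤q+1 : ¬ (ℓ ∣ q + 1)) where

        -- If ℓ divided both, it would divide u = qP and so P. From P = 1 + qQ and m = q²P + (q + 1)
        -- neither Q nor m is divisible by ℓ, in contradiction to (q + 1)r = q²Qm.
        not-both : ¬ (ℓ ∣ r × ℓ ∣ s)
        not-both (ℓ∣r , ℓ∣s) = [ ℓ∤Q , ℓ∤m ]′ (split-prime Q m ℓ∣Qm)
          where
          ℓ∣P : ℓ ∣ P
          ℓ∣P = ∣-cancel-q P (∣m+n∣m⇒∣n (subst (ℓ ∣_) (+-comm u s) ℓ∣r) ℓ∣s)
          ℓ∤Q : ¬ (ℓ ∣ Q)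
          ℓ∤Q ℓ∣Q = ∤suc (∣n⇒∣m*n q ℓ∣Q) ℓ∣P
          ℓ∤m : ¬ (ℓ ∣ m)
          ℓ∤m ℓ∣m = ℓ∤q+1 (∣m+n∣m⇒∣n (subst (ℓ ∣_) (expand q P) ℓ∣m) (∣n⇒∣m*n (q * q) ℓ∣P))
            where
            expand : ∀ q P → 1 + q * (1 + q * P) ≡ q * q * P + (q + 1)
            expand = solve-∀
          ℓ∣Qm : ℓ ∣ Q * m
          ℓ∣Qm = ∣-cancel-q (Q * m) (∣-cancel-q (q * (Q * m))
            (subst (ℓ ∣_) (trans r-product (trans (cong (_* m) (sym w≡)) (assoc q Q m))) (∣n⇒∣m*n (q + 1) ℓ∣r)))
            where
            assoc : ∀ q Q m → q * (q * Q) * m ≡ q * (q * (Q * m))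
            assoc = solve-∀

        private
          vr≡ : a ≡ v ℓ m + v ℓ Q
          vr≡ = begin
            a                  ≡⟨ v-unit-* {q + 1} {r} ℓ∤q+1 r≢0 ⟨
            v ℓ ((q + 1) * r)  ≡⟨ cong (v ℓ) r-product ⟩
            v ℓ (ρ * m)        ≡⟨ v-* {ρ} {m} (λ ()) (λ ()) ⟩
            v ℓ ρ + v ℓ m      ≡⟨ cong (_+ v ℓ m) vρ≡vQ ⟩
            v ℓ Q + v ℓ m      ≡⟨ +-comm (v ℓ Q) (v ℓ m) ⟩
            v ℓ m + v ℓ Q      ∎
            where open ≡-Reasoning

          vs≡ : b ≡ v ℓ R + v ℓ θ
          vs≡ = begin
            b                  ≡⟨ v-unit-* {q + 1} {s} ℓ∤q+1 s≢0 ⟨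
            v ℓ ((q + 1) * s)  ≡⟨ cong (v ℓ) s≡ ⟩
            v ℓ (R * θ)        ≡⟨ v-* {R} {θ} (λ ()) θ≢0 ⟩
            v ℓ R + v ℓ θ      ∎
            where open ≡-Reasoning

          -- Since R = ρ + (q + 1), a prime dividing R and not q + 1 does not divide ρ. So in (q +
          -- 1)μ = ρθ only θ contributes, and the break of `c` at v(θ) can be stated through μ.
          vμ≡ : ℓ ∣ R → v ℓ μ ≡ v ℓ θ
          vμ≡ ℓ∣R = begin
            v ℓ μ              ≡⟨ v-unit-* {q + 1} {μ} ℓ∤q+1 μ≢0 ⟨
            v ℓ ((q + 1) * μ)  ≡⟨ cong (v ℓ) μ-product ⟩
            v ℓ (ρ * θ)        ≡⟨ v-unit-* {ρ} {θ} ℓ∤ρ θ≢0 ⟩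
            v ℓ θ              ∎
            where
            open ≡-Reasoning
            ℓ∤ρ : ¬ (ℓ ∣ ρ)
            ℓ∤ρ ℓ∣ρ = ℓ∤q+1 (∣m+n∣m⇒∣n (subst (ℓ ∣_) (trans R≡ (shift q w)) ℓ∣R) ℓ∣ρ)
              where
              shift : ∀ q w → q + 2 + w ≡ (1 + w) + (q + 1)
              shift = solve-∀

          zeroˡ : ∀ {x y z} → x ≡ y + z → y ≡ 0 → x ≡ z
          zeroˡ x≡ refl = x≡

          zeroʳ : ∀ {x y z} → x ≡ y + z → z ≡ 0 → x ≡ y
          zeroʳ {y = y} x≡ refl = trans x≡ (+-identityʳ y)

        part-i : ℓ ∣ r → ¬ (ℓ ∣ s) →
          (ℓ ∣ m → ¬ (ℓ ∣ Q) → e IsExactly ((v ℓ m , f ∸ 1) ∷ (0 , g + 1) ∷ []))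
          × (ℓ ∣ m → ℓ ∣ Q → e IsExactly ((v ℓ m + v ℓ Q , f ∸ 1) ∷ (v ℓ Q , 1) ∷ (0 , g) ∷ []))
          × (¬ (ℓ ∣ m) → ℓ ∣ Q → e IsExactly ((v ℓ Q , f) ∷ (0 , g) ∷ []))
        part-i ℓ∣r ℓ∤s = onlyᵐ , bothᵐ , onlyQ
          where
          onlyᵐ : ℓ ∣ m → ¬ (ℓ ∣ Q) → e IsExactly ((v ℓ m , f ∸ 1) ∷ (0 , g + 1) ∷ [])
          onlyᵐ _ ℓ∤Q = r-only-high ℓ∣r ℓ∤s {v ℓ m} (zeroʳ {a} {v ℓ m} {v ℓ Q} vr≡ (∤⇒v≡0 {Q} ℓ∤Q))
                          (trans {j = v ℓ Q} vρ≡vQ (∤⇒v≡0 {Q} ℓ∤Q))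

          bothᵐ : ℓ ∣ m → ℓ ∣ Q → e IsExactly ((v ℓ m + v ℓ Q , f ∸ 1) ∷ (v ℓ Q , 1) ∷ (0 , g) ∷ [])
          bothᵐ ℓ∣m ℓ∣Q = r-only-both ℓ∣r ℓ∤s {v ℓ m + v ℓ Q} {v ℓ Q} vr≡ vρ≡vQ (∣⇒v>0 {Q} Q≢0 ℓ∣Q)
                            (m<n+m (v ℓ Q) {v ℓ m} (∣⇒v>0 {m} (λ ()) ℓ∣m))

          onlyQ : ¬ (ℓ ∣ m) → ℓ ∣ Q → e IsExactly ((v ℓ Q , f) ∷ (0 , g) ∷ [])
          onlyQ ℓ∤m _ = r-only-low ℓ∣r ℓ∤s {v ℓ Q} (zeroˡ {a} {v ℓ m} {v ℓ Q} vr≡ (∤⇒v≡0 {m} ℓ∤m))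
                          (≤-reflexive (sym vρ≡vQ))

        part-ii : ℓ ∣ s → ¬ (ℓ ∣ r) →
          (¬ (ℓ ∣ R) → e IsExactly ((b , g) ∷ (0 , f) ∷ []))
          × (ℓ ∣ R → b ≡ v ℓ R + v ℓ μ
              × (v ℓ μ ≡ 0 → e IsExactly ((v ℓ R , g ∸ 1) ∷ (0 , f + 1) ∷ []))
              × (0 < v ℓ μ → e IsExactly ((v ℓ R + v ℓ μ , g ∸ 1) ∷ (v ℓ μ , 1) ∷ (0 , f) ∷ [])))
        part-ii ℓ∣s ℓ∤r = coprime , λ ℓ∣R → vs≡′ ℓ∣R , high ℓ∣R , two ℓ∣R
          where
          coprime : ¬ (ℓ ∣ R) → e IsExactly ((b , g) ∷ (0 , f) ∷ [])
          coprime ℓ∤R = s-only-low ℓ∣s ℓ∤r ℓ∤q+1 (≤-reflexive (zeroˡ {b} {v ℓ R} {v ℓ θ} vs≡ (∤⇒v≡0 {R} ℓ∤R)))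

          vs≡′ : ℓ ∣ R → b ≡ v ℓ R + v ℓ μ
          vs≡′ ℓ∣R = trans {j = v ℓ R + v ℓ θ} vs≡ (cong (λ x → v ℓ R + x) (sym {x = v ℓ μ} {v ℓ θ} (vμ≡ ℓ∣R)))

          high : ℓ ∣ R → v ℓ μ ≡ 0 → e IsExactly ((v ℓ R , g ∸ 1) ∷ (0 , f + 1) ∷ [])
          high ℓ∣R vμ≡0 = s-only-high ℓ∣s ℓ∤r {v ℓ R} (zeroʳ {b} {v ℓ R} {v ℓ μ} (vs≡′ ℓ∣R) vμ≡0)
                            (trans {j = v ℓ μ} (sym {x = v ℓ μ} {v ℓ θ} (vμ≡ ℓ∣R)) vμ≡0)

          two : ℓ ∣ R → 0 < v ℓ μ → e IsExactly ((v ℓ R + v ℓ μ , g ∸ 1) ∷ (v ℓ μ , 1) ∷ (0 , f) ∷ [])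
          two ℓ∣R vμ>0 = s-only-both ℓ∣s ℓ∤r ℓ∤q+1 {v ℓ R + v ℓ μ} {v ℓ μ} (vs≡′ ℓ∣R) (sym {x = v ℓ μ} {v ℓ θ} (vμ≡ ℓ∣R)) vμ>0
                           (m<n+m (v ℓ μ) {v ℓ R} (∣⇒v>0 {R} (λ ()) ℓ∣R))

      -- For even n, q + 1 divides [n-2] and [n]. The first makes r - s = qP divisible by ℓ and R =
      -- 1 + qP a unit; the second makes θ = m - (q + 1)² a multiple of q + 1.
      module CaseB (ℓ∣q+1 : ℓ ∣ q + 1) (q+1∣P : q + 1 ∣ P) (q+1∣m : q + 1 ∣ m) where
        private
          ℓ∣P : ℓ ∣ P
          ℓ∣P = ∣-trans ℓ∣q+1 q+1∣P

          q+1∣θ : q + 1 ∣ θ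
          q+1∣θ = ∣m+n∣m⇒∣n (subst (q + 1 ∣_) m≡ q+1∣m) (m∣m*n (q + 1))

          r⇒s : ℓ ∣ r → ℓ ∣ s
          r⇒s ℓ∣r = ∣m+n∣m⇒∣n ℓ∣r (∣n⇒∣m*n q ℓ∣P)

          s⇒r : ℓ ∣ s → ℓ ∣ r
          s⇒r ℓ∣s = ∣m∣n⇒∣m+n (∣n⇒∣m*n q ℓ∣P) ℓ∣s

        part : ∀ {κ} → HasCardinality (AbelianGroup.setoid (criticalGroup L)) κ →
          (0 < a ⇔ 0 < b) × (a ≡ 0 → b ≡ 0 → ¬ (ℓ ∣ κ))
          × (0 < a → 0 < b → e IsExactly ((a + b , f ∸ 1) ∷ (b , g ∸ f + 1) ∷ (0 , f) ∷ []))
        part cardinality =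
            mk⇔ (λ a>0 → ∣⇒v>0 {s} s≢0 (r⇒s (v>0⇒∣ {r} a>0))) (λ b>0 → ∣⇒v>0 {r} r≢0 (s⇒r (v>0⇒∣ {s} b>0)))
          , (λ a≡0 b≡0 → critical-group-prime-to cardinality
              (λ ℓ∣r → n≮0 (subst (0 <_) a≡0 (∣⇒v>0 {r} r≢0 ℓ∣r))) (λ ℓ∣s → n≮0 (subst (0 <_) b≡0 (∣⇒v>0 {s} s≢0 ℓ∣s))))
          , (λ a>0 b>0 → both ℓ∣q+1 (v>0⇒∣ {r} a>0) (v>0⇒∣ {s} b>0)
              (trans (_∣_.equality q+1∣θ) (*-comm (_∣_.quotient q+1∣θ) (q + 1))) (∤suc (∣n⇒∣m*n q ℓ∣P)))

      -- For odd n, q + 1 divides [n-3] and [n-1]. Then u, m and θ are units at ℓ, and s = Hθ with H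
      -- congruent to h = (n - 1)/2 modulo q + 1, so that ℓ ∣ s exactly if ℓ ∣ h.
      module CaseC (ℓ∣q+1 : ℓ ∣ q + 1) (q+1∣Q : q + 1 ∣ Q) {H h : ℕ} (R≡H : R ≡ (q + 1) * H)
                   (H⇒h : ℓ ∣ H → ℓ ∣ h) (h⇒H : ℓ ∣ h → ℓ ∣ H) where
        private
          ℓ∣Q : ℓ ∣ Q
          ℓ∣Q = ∣-trans ℓ∣q+1 q+1∣Q

          ℓ∤u : ¬ (ℓ ∣ u)
          ℓ∤u = ∤suc (∣n⇒∣m*n q ℓ∣Q) ∘ ∣-cancel-q P

          ℓ∤m : ¬ (ℓ ∣ m)
          ℓ∤m = ∤suc (∣n⇒∣m*n q (subst (ℓ ∣_) (sym R≡H) (∣m⇒∣m*n H ℓ∣q+1)))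

          ℓ∤θ : ¬ (ℓ ∣ θ)
          ℓ∤θ ℓ∣θ = ∤suc (∣-cancel-q w ℓ∣θ) (subst (ℓ ∣_) w≡ (∣n⇒∣m*n q (∣n⇒∣m*n q ℓ∣Q)))

          s≡Hθ : s ≡ H * θ
          s≡Hθ = *-cancelˡ-≡ s (H * θ) (q + 1) (trans s≡ (trans (cong (_* θ) R≡H) (*-assoc (q + 1) H θ)))

          -- Here r = (ρ/(q + 1))m with m a unit at ℓ, so v(r) is at most v(ρ) and the break of `c`
          -- at v(ρ) is never reached below a.
          r≤ρ : a ≤ v ℓ ρ
          r≤ρ = ∣⇒≤v a {ρ} (λ ()) (subst (ℓ ^ a ∣_) (sym ρ≡) (∣n⇒∣m*n (q + 1)
            (cancel-prime-power ℓ-prime a ℓ∤m (subst (ℓ ^ a ∣_) r≡ (≤v⇒∣ {a} {r} ≤-refl)))))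
            where
            Q′ = _∣_.quotient q+1∣Q
            ρ≡ : ρ ≡ (q + 1) * (q * (q * Q′))
            ρ≡ = trans (sym w≡) (trans (cong (λ z → q * (q * z)) (_∣_.equality q+1∣Q)) (shift q Q′))
              where
              shift : ∀ q Q′ → q * (q * (Q′ * (q + 1))) ≡ (q + 1) * (q * (q * Q′))
              shift = solve-∀
            r≡ : r ≡ q * (q * Q′) * m
            r≡ = *-cancelˡ-≡ r (q * (q * Q′) * m) (q + 1)
              (trans r-product (trans (cong (_* m) ρ≡) (*-assoc (q + 1) (q * (q * Q′)) m)))

          s⇒h : ℓ ∣ s → ℓ ∣ h
          s⇒h ℓ∣s = [ H⇒h , (λ ℓ∣θ → contradiction ℓ∣θ ℓ∤θ) ]′ (split-prime H θ (subst (ℓ ∣_) s≡Hθ ℓ∣s))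

          h⇒s : ℓ ∣ h → ℓ ∣ s
          h⇒s ℓ∣h = subst (ℓ ∣_) (sym s≡Hθ) (∣m⇒∣m*n θ (h⇒H ℓ∣h))

          s⇒∤r : ℓ ∣ s → ¬ (ℓ ∣ r)
          s⇒∤r ℓ∣s ℓ∣r = ℓ∤u (∣m+n∣m⇒∣n (subst (ℓ ∣_) (+-comm u s) ℓ∣r) ℓ∣s)

          v≡0⇒∤ : ∀ {t} → t ≢ 0 → v ℓ t ≡ 0 → ¬ (ℓ ∣ t)
          v≡0⇒∤ {t} t≢0 vt≡0 ℓ∣t = n≮0 (subst (0 <_) vt≡0 (∣⇒v>0 {t} t≢0 ℓ∣t))

        part : ∀ {κ} → HasCardinality (AbelianGroup.setoid (criticalGroup L)) κ → ℓ ∣ κ →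
          ((a ≢ 0 × b ≡ 0) ⊎ (a ≡ 0 × b ≢ 0))
          × (¬ (ℓ ∣ h) →
              (0 < a → b ≡ 0 → e IsExactly ((a , f) ∷ (0 , g) ∷ []))
              × (a ≡ 0 → 0 < b → e IsExactly ((b , g) ∷ (0 , f) ∷ [])))
          × (ℓ ∣ h → 0 < b × a ≡ 0 × e IsExactly ((b , g ∸ 1) ∷ (0 , f + 1) ∷ []))
        part cardinality ℓ∣κ =
            exclusive
          , (λ ℓ∤h → (λ a>0 b≡0 → r-only-low (v>0⇒∣ {r} a>0) (v≡0⇒∤ {s} s≢0 b≡0) refl r≤ρ)
                   -- By s = Hθ the prime ℓ can divide s only if it divides h, which is excluded
                   -- here.
                   , (λ _ b>0 → contradiction (s⇒h (v>0⇒∣ {s} b>0)) ℓ∤h))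
          , (λ ℓ∣h → ∣⇒v>0 {s} s≢0 (h⇒s ℓ∣h) , ∤⇒v≡0 {r} (s⇒∤r (h⇒s ℓ∣h))
                   , s-only-high (h⇒s ℓ∣h) (s⇒∤r (h⇒s ℓ∣h)) refl (∤⇒v≡0 {θ} ℓ∤θ))
          where
          by-divisibility : Dec (ℓ ∣ r) → Dec (ℓ ∣ s) → (a ≢ 0 × b ≡ 0) ⊎ (a ≡ 0 × b ≢ 0)
          by-divisibility _         (yes ℓ∣s) = inj₂ (∤⇒v≡0 {r} (s⇒∤r ℓ∣s) , m<n⇒n≢0 {0} {b} (∣⇒v>0 {s} s≢0 ℓ∣s))
          by-divisibility (yes ℓ∣r) (no ℓ∤s)  = inj₁ (m<n⇒n≢0 {0} {a} (∣⇒v>0 {r} r≢0 ℓ∣r) , ∤⇒v≡0 {s} ℓ∤s)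
          by-divisibility (no ℓ∤r)  (no ℓ∤s)  = contradiction ℓ∣κ (critical-group-prime-to cardinality ℓ∤r ℓ∤s)

          exclusive : (a ≢ 0 × b ≡ 0) ⊎ (a ≡ 0 × b ≢ 0)
          exclusive = by-divisibility (ℓ ∣? r) (ℓ ∣? s)

-- The skew-lines graph as an instance.

module SkewLines where

  open LinearForms
  open SmithForms
  open ElementaryDivisors
  open Vectors
  open Lines
  open Planes
  open Cases
  import Data.Integer.Tactic.RingSolver as ℤSolver
  open import Data.Nat.Base
  open import Data.Nat.Properties
  open import Data.Nat.Divisibility
  open import Data.Nat.DivMod using (_/_; m/n*n≡m)
  open import Data.Nat.Primality using (prime⇒irreducible)
  open import Data.Nat.Tactic.RingSolver using (solve-∀)
  open import Relation.Binary.PropositionalEquality hiding ([_])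
  open import Algebra.Properties.Semiring.Sum ℤ.+-*-semiring using (sum)

  repunit-2 : ∀ q → repunit q 2 ≡ q + 1
  repunit-2 q = cong (_+ 1) (*-identityʳ q)

  indicator-01 : ∀ {a} {A : Set a} (A? : Dec A) → indicator A? ≡ 0ℤ ⊎ indicator A? ≡ 1ℤ
  indicator-01 (yes _) = inj₂ refl
  indicator-01 (no  _) = inj₁ refl

  module _ {c ℓ₁ : Level} {q : ℕ} (1<q : 1 < q) (F : FiniteField c ℓ₁ q) where

    module _ {n N : ℕ} (vertices : HasCardinality (Grassmannian F (suc n) 2) N) where
      open LineGeometry F vertices

      -- The flag count reads qR = [n] - 1 = q[n-1], and q is cancelled.
      lines-through : ∀ p → sum (B p) ≡ ℤ.+ repunit q n
      lines-through p = ℤ.*-cancelˡ-≡ (ℤ.+ q) (sum (B p)) (ℤ.+ repunit q n) {{ℤ.≢-nonZero (λ e → m<n⇒n≢0 1<q (ℤ.+-injective e))}} (begin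
        ℤ.+ q ℤ.* sum (B p)                              ≡⟨ cong (ℤ._* sum (B p)) (simplify (ℤ.+ q)) ⟩
        (ℤ.+ (q + 1) ℤ.- 1ℤ) ℤ.* sum (B p)               ≡⟨ cong (λ z → (ℤ.+ z ℤ.- 1ℤ) ℤ.* sum (B p)) (repunit-2 q) ⟨
        (ℤ.+ repunit q 2 ℤ.- 1ℤ) ℤ.* sum (B p)           ≡⟨ lines-through-count p ⟩
        ℤ.+ repunit q (suc n) ℤ.- 1ℤ                     ≡⟨ cong (λ z → ℤ.+ z ℤ.- 1ℤ) (trans (repunit-suc q n) (+-comm 1 (q * repunit q n))) ⟩
        ℤ.+ (q * repunit q n + 1) ℤ.- 1ℤ                 ≡⟨ simplify (ℤ.+ (q * repunit q n)) ⟨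
        ℤ.+ (q * repunit q n)                            ≡⟨ ℤ.pos-* q (repunit q n) ⟩
        ℤ.+ q ℤ.* ℤ.+ repunit q n                        ∎)
        where
        open ≡-Reasoning
        simplify : ∀ a → a ≡ a ℤ.+ 1ℤ ℤ.- 1ℤ
        simplify = ℤSolver.solve-∀

      flag-count : (q + 1) * N ≡ repunit q (suc n) * repunit q n
      flag-count = ℤ.+-injective (begin
        ℤ.+ ((q + 1) * N)                                ≡⟨ cong ℤ.+_ (*-comm (q + 1) N) ⟩
        ℤ.+ (N * (q + 1))                                ≡⟨ ℤ.pos-* N (q + 1) ⟩
        ℤ.+ N ℤ.* ℤ.+ (q + 1)                            ≡⟨ cong (λ z → ℤ.+ N ℤ.* ℤ.+ z) (repunit-2 q) ⟨
        ℤ.+ N ℤ.* ℤ.+ repunit q 2                        ≡⟨ line-count (ℤ.+ repunit q n) lines-through ⟨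
        ℤ.+ repunit q (suc n) ℤ.* ℤ.+ repunit q n        ≡⟨ ℤ.pos-* (repunit q (suc n)) (repunit q n) ⟨
        ℤ.+ (repunit q (suc n) * repunit q n)            ∎)
        where open ≡-Reasoning

    module _ {k N N′ : ℕ} (vertices : HasCardinality (Grassmannian F (4 + k) 2) N)
             (lines′ : HasCardinality (Grassmannian F (2 + k) 2) N′) where
      open LineGeometry F vertices
      open LineDifferences F vertices

      lineSystem : ∀ {s} → q ^ 4 * N′ ≡ q + s →
        LineSystem (repunit q (4 + k)) N (laplacian F vertices lines′) (ℤ.+ q) (ℤ.+ repunit q (3 + k)) (ℤ.+ s)
      lineSystem {s} k≡q+s = record
        { B              = B
        ; B-01           = λ p l → indicator-01 (on? p l)
        ; points-on-line = λ l → trans (points-on-line l) (cong ℤ.+_ (repunit-2 q))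
        ; lines-through  = lines-through vertices
        ; joining-lines  = λ p p′ → trans (joining-lines p p′)
            (cong (λ z → 1ℤ ℤ.+ (z ℤ.- 1ℤ) ℤ.* identity p p′) (lines-through vertices p))
        ; L-entries      = λ l l′ → trans (laplacian-entries lines′ l l′)
            (cong (λ z → sum (λ p → B p l ℤ.* B p l′) ℤ.- 1ℤ ℤ.+ z ℤ.* identity l l′) valency)
        ; difference     = difference few
        }
        where
        simplify : ∀ q s → (q ℤ.+ s) ℤ.- (q ℤ.+ 1ℤ ℤ.- 1ℤ) ≡ s
        simplify = ℤSolver.solve-∀

        valency : ℤ.+ (q ^ 4 * N′) ℤ.- (ℤ.+ repunit q 2 ℤ.- 1ℤ) ≡ ℤ.+ s
        valency = trans (cong₂ (λ x y → ℤ.+ x ℤ.- (ℤ.+ y ℤ.- 1ℤ)) k≡q+s (repunit-2 q)) (simplify (ℤ.+ q) (ℤ.+ s))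

        few : repunit q 2 ≢ repunit q (4 + k)
        few = <⇒≢ (begin-strict
          repunit q 2                      ≤⟨ repunit-mono k ⟩
          repunit q (2 + k)                ≤⟨ m≤n+m (repunit q (2 + k)) (q ^ (2 + k)) ⟩
          repunit q (3 + k)                <⟨ m<n+m (repunit q (3 + k)) (m^n>0 q {{>-nonZero (<-trans (s≤s z≤n) 1<q)}} (3 + k)) ⟩
          repunit q (4 + k)                ∎)
          where
          open ≤-Reasoning
          repunit-mono : ∀ k → repunit q 2 ≤ repunit q (2 + k)
          repunit-mono zero    = ≤-refl
          repunit-mono (suc k) = ≤-trans (repunit-mono k) (m≤n+m (repunit q (2 + k)) (q ^ (2 + k)))

  suc-even : ∀ {j} → ¬ (2 ∣ suc j) → 2 ∣ j
  suc-even {zero}        _    = 2 ∣0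
  suc-even {suc zero}    2∤2  = contradiction ∣-refl 2∤2
  suc-even {suc (suc j)} odd  = ∣m∣n⇒∣m+n (∣-refl {2}) (suc-even {j} λ 2∣1+j → odd (∣m∣n⇒∣m+n (∣-refl {2}) 2∣1+j))

  q+1∣repunit : ∀ q {j} → 2 ∣ j → q + 1 ∣ repunit q j
  q+1∣repunit q (divides h refl) = subst (q + 1 ∣_) (sym (repunit-even q h)) (m∣m*n (even-powers q h))

  ∣even-powers⇔ : ∀ {q ℓ} h → 0 < q → ℓ ∣ q + 1 → (ℓ ∣ even-powers q h → ℓ ∣ h) × (ℓ ∣ h → ℓ ∣ even-powers q h)
  ∣even-powers⇔ {q} {ℓ} h 0<q ℓ∣q+1 with even-powers-mod q h 0<q
  ... | x , e =
      (λ ℓ∣E → ∣m+n∣m⇒∣n (subst (ℓ ∣_) (trans e (+-comm h ((q + 1) * x))) ℓ∣E) (∣m⇒∣m*n x ℓ∣q+1))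
    , (λ ℓ∣h → subst (ℓ ∣_) (sym e) (∣m∣n⇒∣m+n ℓ∣h (∣m⇒∣m*n x ℓ∣q+1)))

  prime∤power : ∀ {p ℓ} t → Prime p → Prime ℓ → ℓ ≢ p → ¬ (ℓ ∣ p ^ t)
  prime∤power {p} {ℓ} zero    p-prime ℓ-prime ℓ≢p ℓ∣1  = <⇒≱ (prime>1 ℓ-prime) (∣⇒≤ ℓ∣1)
  prime∤power {p} {ℓ} (suc t) p-prime ℓ-prime ℓ≢p ℓ∣pᵗ =
    [ (λ ℓ∣p → [ (λ ℓ≡1 → <⇒≢ (prime>1 ℓ-prime) (sym ℓ≡1)) , ℓ≢p ]′ (prime⇒irreducible p-prime ℓ∣p))
    , prime∤power t p-prime ℓ-prime ℓ≢p ]′ (euclidsLemma p (p ^ t) ℓ-prime ℓ∣pᵗ)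

  prime-power>1 : ∀ {p} t → Prime p → 1 ≤ t → 1 < p ^ t
  prime-power>1 {p} (suc t) p-prime _ = ≤-trans (prime>1 p-prime) (m≤m*n p (p ^ t) {{m^n≢0 p t {{>-nonZero (<⇒≤ (prime>1 p-prime))}}}})

  -- The six numbers are variables, so that Claim-cong can match on equations for them.
  Claim : (e : ℕ → ℕ) (q n ℓ N κ bₙ bₙ₋₃ bₙ₋₁ r s μ : ℕ) → Set
  Claim e q n ℓ N κ bₙ bₙ₋₃ bₙ₋₁ r s μ =
    let f = bₙ ∸ 1
        g = N ∸ bₙ
        a = v ℓ r
        b = v ℓ s
    in
    ( ¬ (ℓ ∣ q + 1)
      → ¬ (ℓ ∣ r × ℓ ∣ s)
      × (¬ (ℓ ∣ r) → ¬ (ℓ ∣ s) → ¬ (ℓ ∣ κ))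
      × ( ℓ ∣ r → ¬ (ℓ ∣ s)
          → (ℓ ∣ bₙ → ¬ (ℓ ∣ bₙ₋₃) → e IsExactly ((v ℓ bₙ , f ∸ 1) ∷ (0 , g + 1) ∷ []))
          × (ℓ ∣ bₙ → ℓ ∣ bₙ₋₃ → e IsExactly ((v ℓ bₙ + v ℓ bₙ₋₃ , f ∸ 1) ∷ (v ℓ bₙ₋₃ , 1) ∷ (0 , g) ∷ []))
          × (¬ (ℓ ∣ bₙ) → ℓ ∣ bₙ₋₃ → e IsExactly ((v ℓ bₙ₋₃ , f) ∷ (0 , g) ∷ [])) )
      × ( ℓ ∣ s → ¬ (ℓ ∣ r)
          → (¬ (ℓ ∣ bₙ₋₁) → e IsExactly ((b , g) ∷ (0 , f) ∷ []))
          × ( ℓ ∣ bₙ₋₁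
              → b ≡ v ℓ bₙ₋₁ + v ℓ μ
              × (v ℓ μ ≡ 0 → e IsExactly ((v ℓ bₙ₋₁ , g ∸ 1) ∷ (0 , f + 1) ∷ []))
              × (0 < v ℓ μ → e IsExactly ((v ℓ bₙ₋₁ + v ℓ μ , g ∸ 1) ∷ (v ℓ μ , 1) ∷ (0 , f) ∷ [])) ) ) )
    × ( ℓ ∣ q + 1 → 2 ∣ n
        → (0 < a ⇔ 0 < b)
        × (a ≡ 0 → b ≡ 0 → ¬ (ℓ ∣ κ))
        × (0 < a → 0 < b → e IsExactly ((a + b , f ∸ 1) ∷ (b , g ∸ f + 1) ∷ (0 , f) ∷ [])) )
    × ( ℓ ∣ q + 1 → ¬ (2 ∣ n) → ℓ ∣ κ
        → ((a ≢ 0 × b ≡ 0) ⊎ (a ≡ 0 × b ≢ 0))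
        × ( ¬ (ℓ ∣ (n ∸ 1) ÷ 2)
            → (0 < a → b ≡ 0 → e IsExactly ((a , f) ∷ (0 , g) ∷ []))
            × (a ≡ 0 → 0 < b → e IsExactly ((b , g) ∷ (0 , f) ∷ [])) )
        × (ℓ ∣ (n ∸ 1) ÷ 2 → 0 < b × a ≡ 0 × e IsExactly ((b , g ∸ 1) ∷ (0 , f + 1) ∷ [])) )

  Claim-cong : ∀ {e q n ℓ N κ x x′ y y′ z z′ r r′ s s′ μ μ′} →
               x ≡ x′ → y ≡ y′ → z ≡ z′ → r ≡ r′ → s ≡ s′ → μ ≡ μ′ →
               Claim e q n ℓ N κ x y z r s μ → Claim e q n ℓ N κ x′ y′ z′ r′ s′ μ′
  Claim-cong refl refl refl refl refl refl claim = claim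

  module _ {c ℓ₁ : Level} {q k ℓ N N′ κ : ℕ} (1<q : 1 < q) (ℓ-prime : Prime ℓ) (ℓ∤q : ¬ (ℓ ∣ q))
    (F : FiniteField c ℓ₁ q)
    (vertices : HasCardinality (Grassmannian F (4 + k) 2) N) (lines′ : HasCardinality (Grassmannian F (2 + k) 2) N′)
    (cardinality : HasCardinality (AbelianGroup.setoid (criticalGroup (laplacian F vertices lines′))) κ)
    (S : SmithNormalForm (laplacian F vertices lines′)) where

    private
      L : Matrix N
      L = laplacian F vertices lines′

      Q P R m w s : ℕ
      Q = repunit q (1 + k)
      P = 1 + q * Q
      R = 1 + q * P
      m = 1 + q * R
      w = q * (q * Q) ∸ 1
      -- The valency minus q, as the diagonal of L dictates; its agreement with the closed formula
      -- is proved afterwards.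
      s = q ^ 4 * N′ ∸ q

      0<q : 0 < q
      0<q = <-trans (s≤s z≤n) 1<q

      instance
        q-nonZero : NonZero q
        q-nonZero = >-nonZero 0<q

      0<Q : 0 < Q
      0<Q = subst (0 <_) (sym (repunit-suc q k)) (s≤s z≤n)

      P≡ : repunit q (2 + k) ≡ P
      P≡ = repunit-suc q (1 + k)

      R≡ : repunit q (3 + k) ≡ R
      R≡ = trans (repunit-suc q (2 + k)) (cong (λ z → 1 + q * z) P≡)

      m≡ : repunit q (4 + k) ≡ m
      m≡ = trans (repunit-suc q (3 + k)) (cong (λ z → 1 + q * z) R≡)

      w≡ : q * (q * Q) ≡ suc w
      w≡ = sym (suc-pred (q * (q * Q)) {{m*n≢0 q (q * Q) {{q-nonZero}} {{m*n≢0 q Q {{q-nonZero}} {{>-nonZero 0<Q}}}}}})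

      R≡w : R ≡ q + 2 + w
      R≡w = trans (expand q Q) (trans (cong (λ z → 1 + q + z) w≡) (shift q w))
        where
        expand : ∀ q Q → 1 + q * (1 + q * Q) ≡ 1 + q + q * (q * Q)
        expand = solve-∀
        shift : ∀ q w → 1 + q + (1 + w) ≡ q + 2 + w
        shift = solve-∀

      -- The flag count in dimension n - 2 gives (q + 1)N′ = [n-2][n-3]; substituting q²Q = 1 + w
      -- brings out the term (q + 1)q that separates s from the valency.
      valency-product : (q + 1) * (q ^ 4 * N′) ≡ (q + 1) * q + R * (q * w)
      valency-product = begin
        (q + 1) * (q ^ 4 * N′)                  ≡⟨ swap (q + 1) (q ^ 4) N′ ⟩
        q ^ 4 * ((q + 1) * N′)                  ≡⟨ cong (q ^ 4 *_) (trans (flag-count 1<q F lines′) (cong (_* Q) P≡)) ⟩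
        q ^ 4 * (P * Q)                         ≡⟨ regroup q Q ⟩
        q * (q * (q * Q)) * (q + q * (q * Q))   ≡⟨ cong (λ z → q * z * (q + z)) w≡ ⟩
        q * suc w * (q + suc w)                 ≡⟨ collect q w ⟩
        (q + 1) * q + (q + 2 + w) * (q * w)     ≡⟨ cong (λ z → (q + 1) * q + z * (q * w)) R≡w ⟨
        (q + 1) * q + R * (q * w)               ∎
        where
        open ≡-Reasoning
        swap : ∀ a b c → a * (b * c) ≡ b * (a * c)
        swap = solve-∀
        regroup : ∀ q Q → q * (q * (q * (q * 1))) * ((1 + q * Q) * Q) ≡ q * (q * (q * Q)) * (q + q * (q * Q))
        regroup = solve-∀
        collect : ∀ q w → q * (1 + w) * (q + (1 + w)) ≡ (q + 1) * q + (q + 2 + w) * (q * w)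
        collect = solve-∀

      instance
        q+1-nonZero : NonZero (q + 1)
        q+1-nonZero = >-nonZero (subst (0 <_) (+-comm 1 q) (s≤s z≤n))

      -- The valency is at least q by `valency-product`, so the truncated subtraction in s is a true
      -- one.
      k≡q+s : q ^ 4 * N′ ≡ q + s
      k≡q+s = sym (m+[n∸m]≡n (*-cancelˡ-≤ (q + 1) (subst ((q + 1) * q ≤_) (sym valency-product) (m≤m+n ((q + 1) * q) (R * (q * w))))))

      s≡ : (q + 1) * s ≡ R * (q * w)
      s≡ = +-cancelˡ-≡ ((q + 1) * q) ((q + 1) * s) (R * (q * w)) (begin
        (q + 1) * q + (q + 1) * s    ≡⟨ *-distribˡ-+ (q + 1) q s ⟨
        (q + 1) * (q + s)            ≡⟨ cong ((q + 1) *_) k≡q+s ⟨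
        (q + 1) * (q ^ 4 * N′)       ≡⟨ valency-product ⟩
        (q + 1) * q + R * (q * w)    ∎)
        where open ≡-Reasoning

      N≡ : (q + 1) * N ≡ m * R
      N≡ = trans (flag-count 1<q F vertices) (cong₂ _*_ m≡ R≡)

      system : LineSystem m N L (ℤ.+ q) (ℤ.+ R) (ℤ.+ s)
      system = subst₂ (λ m R → LineSystem m N L (ℤ.+ q) (ℤ.+ R) (ℤ.+ s)) m≡ R≡ (lineSystem 1<q F vertices lines′ k≡q+s)

      open Spectrum {q} {Q} {w} {s} {N} 1<q 0<Q w≡ s≡ N≡ {L} system using (r; μ; r-product; μ-product; module Local)
      open Local S ℓ-prime ℓ∤q

      bracket-n : [ 4 + k ] q ≡ m
      bracket-n = trans (bracket≡repunit 1<q (4 + k)) m≡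

      bracket-n-1 : [ 3 + k ] q ≡ R
      bracket-n-1 = trans (bracket≡repunit 1<q (3 + k)) R≡

      bracket-n-3 : [ 1 + k ] q ≡ Q
      bracket-n-3 = bracket≡repunit 1<q (1 + k)

      0<q+1 : 0 < q + 1
      0<q+1 = subst (0 <_) (+-comm 1 q) (s≤s z≤n)

      [n-1]-[q+2] : [ 3 + k ] q ∸ (q + 2) ≡ w
      [n-1]-[q+2] = trans (cong (_∸ (q + 2)) (trans bracket-n-1 R≡w)) (m+n∸m≡n (q + 2) w)

      rᴸ≡ : rᴸ q (4 + k) ≡ r
      rᴸ≡ = ÷-exact {q + 1} (q ^ 2 * [ 1 + k ] q * [ 4 + k ] q) r 0<q+1 (begin
        (q + 1) * r                              ≡⟨ r-product ⟩
        suc w * m                                ≡⟨ cong (_* m) w≡ ⟨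
        q * (q * Q) * m                          ≡⟨ regroup q Q m ⟩
        q ^ 2 * Q * m                            ≡⟨ cong₂ (λ x y → q ^ 2 * x * y) bracket-n-3 bracket-n ⟨
        q ^ 2 * [ 1 + k ] q * [ 4 + k ] q        ∎)
        where
        open ≡-Reasoning
        regroup : ∀ q Q m → q * (q * Q) * m ≡ q * (q * 1) * Q * m
        regroup = solve-∀

      sᴸ≡ : sᴸ q (4 + k) ≡ s
      sᴸ≡ = ÷-exact {q + 1} (q * [ 3 + k ] q * ([ 3 + k ] q ∸ (q + 2))) s 0<q+1 (begin
        (q + 1) * s                                         ≡⟨ s≡ ⟩
        R * (q * w)                                         ≡⟨ regroup R q w ⟩
        q * R * w                                           ≡⟨ cong₂ (λ x y → q * x * y) bracket-n-1 [n-1]-[q+2] ⟨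
        q * [ 3 + k ] q * ([ 3 + k ] q ∸ (q + 2))           ∎)
        where
        open ≡-Reasoning
        regroup : ∀ R q w → R * (q * w) ≡ q * R * w
        regroup = solve-∀

      μᴸ≡ : μᴸ q (4 + k) ≡ μ
      μᴸ≡ = ÷-exact {q + 1} (q ^ 3 * [ 1 + k ] q * ([ 3 + k ] q ∸ (q + 2))) μ 0<q+1 (begin
        (q + 1) * μ                                         ≡⟨ μ-product ⟩
        suc w * (q * w)                                     ≡⟨ cong (_* (q * w)) w≡ ⟨
        q * (q * Q) * (q * w)                               ≡⟨ regroup Q q w ⟩
        q ^ 3 * Q * w                                       ≡⟨ cong₂ (λ x y → q ^ 3 * x * y) bracket-n-3 [n-1]-[q+2] ⟨
        q ^ 3 * [ 1 + k ] q * ([ 3 + k ] q ∸ (q + 2))       ∎)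
        where
        open ≡-Reasoning
        regroup : ∀ Q q w → q * (q * Q) * (q * w) ≡ q * (q * (q * 1)) * Q * w
        regroup = solve-∀

      claim : Claim (multiplicity S ℓ) q (4 + k) ℓ N κ m Q R r s μ
      claim =
          (λ ℓ∤q+1 → CaseA.not-both ℓ∤q+1 , critical-group-prime-to cardinality , CaseA.part-i ℓ∤q+1 , CaseA.part-ii ℓ∤q+1)
        , (λ ℓ∣q+1 2∣n → CaseB.part ℓ∣q+1
             (subst (q + 1 ∣_) P≡ (q+1∣repunit q (∣m+n∣m⇒∣n {2} {2} 2∣n ∣-refl)))
             (subst (q + 1 ∣_) m≡ (q+1∣repunit q 2∣n)) cardinality)
        , odd
        where
        odd : ℓ ∣ q + 1 → ¬ (2 ∣ 4 + k) → ℓ ∣ κ → _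
        odd ℓ∣q+1 2∤n = CaseC.part ℓ∣q+1 (q+1∣repunit q (∣m+n∣m⇒∣n {2} {2} (suc-even 2∤n) ∣-refl))
          {even-powers q h} {h} (trans (sym R≡) (trans (cong (repunit q) 3+k≡) (repunit-even q h)))
          (proj₁ (∣even-powers⇔ h 0<q ℓ∣q+1)) (proj₂ (∣even-powers⇔ h 0<q ℓ∣q+1)) cardinality
          where
          h : ℕ
          -- By computation this is the `(n ∸ 1) ÷ 2` of the claim for n = 4 + k.
          h = (3 + k) / 2
          3+k≡ : 3 + k ≡ h * 2
          3+k≡ = sym (m/n*n≡m (suc-even 2∤n))

    theorem : Claim (multiplicity S ℓ) q (4 + k) ℓ N κ ([ 4 + k ] q) ([ 1 + k ] q) ([ 3 + k ] q)
                    (rᴸ q (4 + k)) (sᴸ q (4 + k)) (μᴸ q (4 + k))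
    theorem = Claim-cong (sym bracket-n) (sym bracket-n-3) (sym bracket-n-1) (sym rᴸ≡) (sym sᴸ≡) (sym μᴸ≡) claim

open import Data.List.Base using (_∷_; [])
open import Data.Nat.Base using (ℕ; _+_; _*_; _∸_; _^_; _≤_; _<_)
open import Data.Nat.Divisibility using (_∣_)
open import Data.Nat.Primality using (Prime)
open import Data.Product.Base using (_×_; _,_)
open import Data.Sum.Base using (_⊎_)
open import Function.Bundles using (_⇔_)
open import Algebra.Bundles using (AbelianGroup)
open import Relation.Binary.PropositionalEquality using (_≡_; _≢_)
open import Relation.Nullary.Negation using (¬_)
open import Data.Nat.Base using (suc; s≤s)
open import Relation.Binary.PropositionalEquality using (refl)

mainTheorem7 :
  ∀ {c ℓ₁} (p t q n ℓ N N′ κ : ℕ)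
  → Prime p → 1 ≤ t → q ≡ p ^ t → 4 ≤ n
  → Prime ℓ → ℓ ≢ p
  → (F : FiniteField c ℓ₁ q)
    (vertices : HasCardinality (Grassmannian F n 2) N)
    (lines′ : HasCardinality (Grassmannian F (n ∸ 2) 2) N′)
  → let L = laplacian F vertices lines′ in
    HasCardinality (AbelianGroup.setoid (criticalGroup L)) κ
  → (S : SmithNormalForm L)
  → let e = multiplicity S ℓ
        f = [ n ] q ∸ 1
        g = N ∸ [ n ] q
        r = rᴸ q n
        s = sᴸ q n
        μ = μᴸ q n
    in
    -- (A)
    ( ¬ (ℓ ∣ q + 1)
      → ¬ (ℓ ∣ r × ℓ ∣ s)
      × (¬ (ℓ ∣ r) → ¬ (ℓ ∣ s) → ¬ (ℓ ∣ κ))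
      -- (i)
      × ( ℓ ∣ r → ¬ (ℓ ∣ s)
          → ( ℓ ∣ [ n ] q → ¬ (ℓ ∣ [ n ∸ 3 ] q)
              → let a = v ℓ ([ n ] q) in
                e IsExactly ((a , f ∸ 1) ∷ (0 , g + 1) ∷ []) )
          × ( ℓ ∣ [ n ] q → ℓ ∣ [ n ∸ 3 ] q
              → let a = v ℓ ([ n ] q)
                    b = v ℓ ([ n ∸ 3 ] q)
                in
                e IsExactly ((a + b , f ∸ 1) ∷ (b , 1) ∷ (0 , g) ∷ []) )
          × ( ¬ (ℓ ∣ [ n ] q) → ℓ ∣ [ n ∸ 3 ] q
              → let a = v ℓ ([ n ∸ 3 ] q) in
                e IsExactly ((a , f) ∷ (0 , g) ∷ []) ) )
      -- (ii)
      × ( ℓ ∣ s → ¬ (ℓ ∣ r)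
          → ( ¬ (ℓ ∣ [ n ∸ 1 ] q)
              → let a = v ℓ s in
                e IsExactly ((a , g) ∷ (0 , f) ∷ []) )
          × ( ℓ ∣ [ n ∸ 1 ] q
              → let a = v ℓ ([ n ∸ 1 ] q)
                    b = v ℓ μ
                in
                v ℓ s ≡ a + b
                × ( b ≡ 0
                    → e IsExactly ((a , g ∸ 1) ∷ (0 , f + 1) ∷ []) )
                × ( 0 < b
                    → e IsExactly ((a + b , g ∸ 1) ∷ (b , 1) ∷ (0 , f) ∷ []) ) ) ) )
    -- (B)
    × ( ℓ ∣ q + 1 → 2 ∣ n
        → let a = v ℓ r
              b = v ℓ s
          in
          (0 < a ⇔ 0 < b)
          × (a ≡ 0 → b ≡ 0 → ¬ (ℓ ∣ κ))
          × ( 0 < a → 0 < b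
              → e IsExactly ((a + b , f ∸ 1) ∷ (b , g ∸ f + 1) ∷ (0 , f) ∷ []) ) )
    -- (C)
    × ( ℓ ∣ q + 1 → ¬ (2 ∣ n) → ℓ ∣ κ
        → let a = v ℓ r
              b = v ℓ s
          in
          ((a ≢ 0 × b ≡ 0) ⊎ (a ≡ 0 × b ≢ 0))
          -- (a)
          × ( ¬ (ℓ ∣ (n ∸ 1) ÷ 2)
              → (0 < a → b ≡ 0 → e IsExactly ((a , f) ∷ (0 , g) ∷ []))
              × (a ≡ 0 → 0 < b → e IsExactly ((b , g) ∷ (0 , f) ∷ [])) )
          -- (b)
          × ( ℓ ∣ (n ∸ 1) ÷ 2
              → 0 < b × a ≡ 0
              × e IsExactly ((b , g ∸ 1) ∷ (0 , f + 1) ∷ []) ) )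
mainTheorem7 p t q (suc (suc (suc (suc k)))) ℓ N N′ κ p-prime 1≤t refl (s≤s (s≤s (s≤s (s≤s _)))) ℓ-prime ℓ≢p
  F vertices lines′ cardinality S =
  SkewLines.theorem (SkewLines.prime-power>1 t p-prime 1≤t) ℓ-prime (SkewLines.prime∤power t p-prime ℓ-prime ℓ≢p)
    F vertices lines′ cardinality S
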